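{- Let $s\in\mathbb{Q}$ and let $r$ be a complex number such that $r^2\in\mathbb{Q}\setminus\{0\}$ and $J_s(r)\neq 0$. Then $rJ_{s+1}(r)/J_s(r)$ is irrational, i.e. it does not belong to $\mathbb{Q}$.
   Context: $J_\nu$ denotes the Bessel function of the first kind of order $\nu$, $$J_{\nu}(r)=\sum_{k=0}^{\infty} \frac{(-1)^k}{k!\,\Gamma(\nu+k+1)}\left(\frac{r}{2}\right)^{\nu+2k},$$ where $1/\Gamma(z)$ is interpreted as $0$ when $z$ is a non-positive integer. For non-integer $\nu$ and $r$ not a positive real, the power $(r/2)^{\nu+2k}=(r/2)^{2k}(r/2)^{\nu}$ is taken with a fixed choice of logarithm of $r/2$ (e.g. the principal one), the same for all orders. -}

module Defs where

open import Data.Integer.Base as ℤ using (+_)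
open import Data.Nat.Base as ℕ using (ℕ; zero; suc; _!)
open import Data.Nat.Properties as ℕ using (_!≢0)
open import Data.Product using (Σ-syntax; ∃-syntax; _×_; _,_)
open import Data.Rational.Base as ℚ
  using (ℚ; 0ℚ; 1ℚ; ½; _+_; _*_; _-_; -_; _≤_; _<_; ∣_∣; 1/_; _/_; positive; nonNegative)
open import Data.Rational.Properties as ℚ using ()
open import Data.Rational.Solver using (module +-*-Solver)
open import Data.Sum using (_⊎_; inj₁; inj₂)
open import Relation.Binary.PropositionalEquality using (_≡_; refl; sym; trans; cong; cong₂; subst)
open import Relation.Nullary using (¬_)

open +-*-Solver using (solve; _:+_; _:*_; _:-_; :-_; _:=_)

IsCauchy : (ℕ → ℚ) → Set
IsCauchy x = ∀ ε → 0ℚ < ε → ∃[ N ] ∀ m n → N ℕ.≤ m → N ℕ.≤ n → ∣ x m - x n ∣ < ε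

-- Abstract, so that normal forms of reals do not contain these proofs.
private abstract

  0<½* : ∀ {ε} → 0ℚ < ε → 0ℚ < ½ * ε
  0<½* {ε} 0<ε = ℚ.positive⁻¹ (½ * ε) {{ℚ.pos*pos⇒pos ½ ε {{positive 0<ε}}}}

  ½+½ : ∀ ε → ½ * ε + ½ * ε ≡ ε
  ½+½ ε = trans (sym (ℚ.*-distribʳ-+ ε ½ ½)) (ℚ.*-identityˡ ε)

  m≤m⊔n⊔o : ∀ m n {o} → m ℕ.⊔ n ℕ.≤ o → m ℕ.≤ o
  m≤m⊔n⊔o m n = ℕ.≤-trans (ℕ.m≤m⊔n m n)

  n≤m⊔n⊔o : ∀ m n {o} → m ℕ.⊔ n ℕ.≤ o → n ℕ.≤ o
  n≤m⊔n⊔o m n = ℕ.≤-trans (ℕ.m≤n⊔m m n)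

  const-cauchy : ∀ q → IsCauchy (λ _ → q)
  const-cauchy q ε 0<ε = 0 , λ _ _ _ _ → subst (_< ε) (cong ∣_∣ (sym (ℚ.+-inverseʳ q))) 0<ε

  +-cauchy : ∀ x y → IsCauchy x → IsCauchy y → IsCauchy (λ n → x n + y n)
  +-cauchy x y cx cy ε 0<ε with cx (½ * ε) (0<½* 0<ε) | cy (½ * ε) (0<½* 0<ε)
  ... | M , px | N , py = M ℕ.⊔ N , λ m n p q → begin-strict
    ∣ (x m + y m) - (x n + y n) ∣
      ≡⟨ cong ∣_∣ (solve 4 (λ a b c d → (a :+ b) :- (c :+ d) := (a :- c) :+ (b :- d))
                         refl (x m) (y m) (x n) (y n)) ⟩
    ∣ (x m - x n) + (y m - y n) ∣
      ≤⟨ ℚ.∣p+q∣≤∣p∣+∣q∣ (x m - x n) (y m - y n) ⟩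
    ∣ x m - x n ∣ + ∣ y m - y n ∣
      <⟨ ℚ.+-mono-< (px m n (m≤m⊔n⊔o M N p) (m≤m⊔n⊔o M N q))
                    (py m n (n≤m⊔n⊔o M N p) (n≤m⊔n⊔o M N q)) ⟩
    ½ * ε + ½ * ε
      ≡⟨ ½+½ ε ⟩
    ε ∎
    where open ℚ.≤-Reasoning

  neg-cauchy : ∀ x → IsCauchy x → IsCauchy (λ n → - x n)
  neg-cauchy x cx ε 0<ε with cx ε 0<ε
  ... | N , px = N , λ m n p q →
    subst (_< ε)
      (trans (sym (ℚ.∣-p∣≡∣p∣ (x m - x n)))
             (cong ∣_∣ (solve 2 (λ a b → :- (a :- b) := :- a :- :- b) refl (x m) (x n))))
      (px m n p q)

  ∣p∣≤∣p-q∣+∣q∣ : ∀ p q → ∣ p ∣ ≤ ∣ p - q ∣ + ∣ q ∣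
  ∣p∣≤∣p-q∣+∣q∣ p q =
    subst (_≤ ∣ p - q ∣ + ∣ q ∣) (cong ∣_∣ (solve 2 (λ a b → (a :- b) :+ b := a) refl p q))
      (ℚ.∣p+q∣≤∣p∣+∣q∣ (p - q) q)

  ∣p∣-∣q∣≤∣p-q∣ : ∀ p q → ∣ p ∣ - ∣ q ∣ ≤ ∣ p - q ∣
  ∣p∣-∣q∣≤∣p-q∣ p q =
    subst (∣ p ∣ - ∣ q ∣ ≤_) (solve 2 (λ a b → (a :+ b) :- b := a) refl ∣ p - q ∣ ∣ q ∣)
      (ℚ.+-monoˡ-≤ (- ∣ q ∣) (∣p∣≤∣p-q∣+∣q∣ p q))

  ∣∣p∣-∣q∣∣≤∣p-q∣ : ∀ p q → ∣ ∣ p ∣ - ∣ q ∣ ∣ ≤ ∣ p - q ∣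
  ∣∣p∣-∣q∣∣≤∣p-q∣ p q with ℚ.∣p∣≡p∨∣p∣≡-p (∣ p ∣ - ∣ q ∣)
  ... | inj₁ eq = subst (_≤ ∣ p - q ∣) (sym eq) (∣p∣-∣q∣≤∣p-q∣ p q)
  ... | inj₂ eq = begin
    ∣ ∣ p ∣ - ∣ q ∣ ∣  ≡⟨ eq ⟩
    - (∣ p ∣ - ∣ q ∣)  ≡⟨ solve 2 (λ a b → :- (a :- b) := b :- a) refl ∣ p ∣ ∣ q ∣ ⟩
    ∣ q ∣ - ∣ p ∣      ≤⟨ ∣p∣-∣q∣≤∣p-q∣ q p ⟩
    ∣ q - p ∣          ≡⟨ sym (ℚ.∣-p∣≡∣p∣ (q - p)) ⟩
    ∣ - (q - p) ∣      ≡⟨ cong ∣_∣ (solve 2 (λ a b → :- (b :- a) := a :- b) refl p q) ⟩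
    ∣ p - q ∣          ∎
    where open ℚ.≤-Reasoning

  abs-cauchy : ∀ x → IsCauchy x → IsCauchy (λ n → ∣ x n ∣)
  abs-cauchy x cx ε 0<ε with cx ε 0<ε
  ... | N , px = N , λ m n p q → ℚ.≤-<-trans (∣∣p∣-∣q∣∣≤∣p-q∣ (x m) (x n)) (px m n p q)

  EventuallyBoundedBy : ℚ → (ℕ → ℚ) → Set
  EventuallyBoundedBy B x = ∃[ N ] ∀ n → N ℕ.≤ n → ∣ x n ∣ ≤ B

  bounded : ∀ x → IsCauchy x → ∃[ B ] 0ℚ < B × EventuallyBoundedBy B x
  bounded x cx with cx 1ℚ (ℚ.positive⁻¹ 1ℚ)
  ... | N , px = 1ℚ + ∣ x N ∣
               , ℚ.+-mono-<-≤ (ℚ.positive⁻¹ 1ℚ) (ℚ.0≤∣p∣ (x N))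
               , N
               , λ n p → ℚ.≤-trans (∣p∣≤∣p-q∣+∣q∣ (x n) (x N))
                           (ℚ.+-monoˡ-≤ ∣ x N ∣ (ℚ.<⇒≤ (px n N p ℕ.≤-refl)))

  1/-pos : ∀ {B} → 0ℚ < B → ∃[ C ] 0ℚ < C × B * C ≡ 1ℚ
  1/-pos {B} 0<B = (1/ B) {{≢0}} , ℚ.positive⁻¹ _ {{ℚ.1/pos⇒pos B {{positive 0<B}}}} , ℚ.*-inverseʳ B {{≢0}}
    where
    ≢0 : ℚ.NonZero B
    ≢0 = ℚ.pos⇒nonZero B {{positive 0<B}}

  split : ∀ {B ε} → 0ℚ < B → 0ℚ < ε → ∃[ δ ] 0ℚ < δ × B * δ ≡ ½ * ε
  split {B} {ε} 0<B 0<ε with 1/-pos 0<B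
  ... | C , 0<C , BC≡1 =
      C * (½ * ε)
    , ℚ.positive⁻¹ (C * (½ * ε))
        {{ℚ.pos*pos⇒pos C {{positive 0<C}} (½ * ε) {{positive (0<½* 0<ε)}}}}
    , trans (sym (ℚ.*-assoc B C (½ * ε)))
        (trans (cong (_* (½ * ε)) BC≡1) (ℚ.*-identityˡ (½ * ε)))

  ∣p*d∣<B*δ : ∀ {B δ} p d → 0ℚ < B → ∣ p ∣ ≤ B → ∣ d ∣ < δ → ∣ p * d ∣ < B * δ
  ∣p*d∣<B*δ {B} {δ} p d 0<B p≤B d<δ = begin-strict
    ∣ p * d ∣      ≡⟨ ℚ.∣p*q∣≡∣p∣*∣q∣ p d ⟩
    ∣ p ∣ * ∣ d ∣  ≤⟨ ℚ.*-monoʳ-≤-nonNeg ∣ d ∣ {{ℚ.∣-∣-nonNeg d}} p≤B ⟩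
    B * ∣ d ∣      <⟨ ℚ.*-monoʳ-<-pos B {{positive 0<B}} d<δ ⟩
    B * δ          ∎
    where open ℚ.≤-Reasoning

  *-difference : ∀ a b c d → a * b - c * d ≡ a * (b - d) + d * (a - c)
  *-difference = solve 4 (λ a b c d → a :* b :- c :* d := a :* (b :- d) :+ d :* (a :- c)) refl

  *-close : ∀ {A B α β ε} a b c d → 0ℚ < A → 0ℚ < B → A * α ≡ ½ * ε → B * β ≡ ½ * ε →
            ∣ a ∣ ≤ A → ∣ d ∣ ≤ B → ∣ b - d ∣ < α → ∣ a - c ∣ < β → ∣ a * b - c * d ∣ < ε
  *-close {A} {B} {α} {β} {ε} a b c d 0<A 0<B Aα Bβ a≤A d≤B b-d<α a-c<β = begin-strict
    ∣ a * b - c * d ∣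
      ≡⟨ cong ∣_∣ (*-difference a b c d) ⟩
    ∣ a * (b - d) + d * (a - c) ∣
      ≤⟨ ℚ.∣p+q∣≤∣p∣+∣q∣ (a * (b - d)) (d * (a - c)) ⟩
    ∣ a * (b - d) ∣ + ∣ d * (a - c) ∣
      <⟨ ℚ.+-mono-< (∣p*d∣<B*δ a (b - d) 0<A a≤A b-d<α) (∣p*d∣<B*δ d (a - c) 0<B d≤B a-c<β) ⟩
    A * α + B * β
      ≡⟨ cong₂ _+_ Aα Bβ ⟩
    ½ * ε + ½ * ε
      ≡⟨ ½+½ ε ⟩
    ε ∎
    where open ℚ.≤-Reasoning

  *-cauchy : ∀ x y → IsCauchy x → IsCauchy y → IsCauchy (λ n → x n * y n)
  *-cauchy x y cx cy ε 0<ε =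
    let A , 0<A , K , x≤A = bounded x cx
        B , 0<B , L , y≤B = bounded y cy
        α , 0<α , Aα      = split {A} {ε} 0<A 0<ε
        β , 0<β , Bβ      = split {B} {ε} 0<B 0<ε
        M , py            = cy α 0<α
        N , px            = cx β 0<β
    in (K ℕ.⊔ L) ℕ.⊔ (M ℕ.⊔ N) , λ m n p q →
      let KL≤m = m≤m⊔n⊔o (K ℕ.⊔ L) (M ℕ.⊔ N) p
          KL≤n = m≤m⊔n⊔o (K ℕ.⊔ L) (M ℕ.⊔ N) q
          MN≤m = n≤m⊔n⊔o (K ℕ.⊔ L) (M ℕ.⊔ N) p
          MN≤n = n≤m⊔n⊔o (K ℕ.⊔ L) (M ℕ.⊔ N) q
      in *-close (x m) (y m) (x n) (y n) 0<A 0<B Aα Bβ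
           (x≤A m (m≤m⊔n⊔o K L KL≤m)) (y≤B n (n≤m⊔n⊔o K L KL≤n))
           (py m n (m≤m⊔n⊔o M N MN≤m) (m≤m⊔n⊔o M N MN≤n))
           (px m n (n≤m⊔n⊔o M N MN≤m) (n≤m⊔n⊔o M N MN≤n))

infix  4 _≈ᴿ_ _≤ᴿ_ _⟶ᴿ_
infixl 6 _+ᴿ_ _-ᴿ_
infixl 7 _*ᴿ_
infix  8 -ᴿ_

record ℝ : Set where
  constructor mkℝ
  field
    seq    : ℕ → ℚ
    cauchy : IsCauchy seq

open ℝ public

record _≈ᴿ_ (x y : ℝ) : Set where
  constructor mk≈ᴿ
  field
    close : ∀ ε → 0ℚ < ε → ∃[ N ] ∀ n → N ℕ.≤ n → ∣ seq x n - seq y n ∣ < ε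

record _≤ᴿ_ (x y : ℝ) : Set where
  constructor mk≤ᴿ
  field
    below : ∀ ε → 0ℚ < ε → ∃[ N ] ∀ n → N ℕ.≤ n → seq x n < seq y n + ε

ℚ→ℝ : ℚ → ℝ
ℚ→ℝ q = mkℝ (λ _ → q) (const-cauchy q)

_+ᴿ_ : ℝ → ℝ → ℝ
x +ᴿ y = mkℝ (λ n → seq x n + seq y n) (+-cauchy (seq x) (seq y) (cauchy x) (cauchy y))

_*ᴿ_ : ℝ → ℝ → ℝ
x *ᴿ y = mkℝ (λ n → seq x n * seq y n) (*-cauchy (seq x) (seq y) (cauchy x) (cauchy y))

-ᴿ_ : ℝ → ℝ
-ᴿ x = mkℝ (λ n → - seq x n) (neg-cauchy (seq x) (cauchy x))

_-ᴿ_ : ℝ → ℝ → ℝ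
x -ᴿ y = x +ᴿ -ᴿ y

∣_∣ᴿ : ℝ → ℝ
∣ x ∣ᴿ = mkℝ (λ n → ∣ seq x n ∣) (abs-cauchy (seq x) (cauchy x))

record _⟶ᴿ_ (x : ℕ → ℝ) (l : ℝ) : Set where
  constructor mk⟶ᴿ
  field
    near : ∀ ε → 0ℚ < ε → ∃[ N ] ∀ n → N ℕ.≤ n → ∣ x n -ᴿ l ∣ᴿ ≤ᴿ ℚ→ℝ ε

infix  4 _≈_ _⟶_
infixl 6 _+ᶜ_
infixl 7 _*ᶜ_
infixr 8 _^_

record ℂ : Set where
  constructor _+i_
  field
    re im : ℝ

open ℂ public

record _≈_ (z w : ℂ) : Set where
  constructor _,_
  field
    re≈ : re z ≈ᴿ re w
    im≈ : im z ≈ᴿ im w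

ℝ→ℂ : ℝ → ℂ
ℝ→ℂ x = x +i ℚ→ℝ 0ℚ

ℚ→ℂ : ℚ → ℂ
ℚ→ℂ q = ℝ→ℂ (ℚ→ℝ q)

ℕ→ℚ : ℕ → ℚ
ℕ→ℚ n = + n / 1

0ℂ 1ℂ : ℂ
0ℂ = ℚ→ℂ 0ℚ
1ℂ = ℚ→ℂ 1ℚ

_+ᶜ_ : ℂ → ℂ → ℂ
z +ᶜ w = (re z +ᴿ re w) +i (im z +ᴿ im w)

_*ᶜ_ : ℂ → ℂ → ℂ
z *ᶜ w = (re z *ᴿ re w -ᴿ im z *ᴿ im w) +i (re z *ᴿ im w +ᴿ im z *ᴿ re w)

_^_ : ℂ → ℕ → ℂ
z ^ zero  = 1ℂ
z ^ suc n = z *ᶜ z ^ n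

record _⟶_ (z : ℕ → ℂ) (w : ℂ) : Set where
  constructor _,_
  field
    re⟶ : (λ n → re (z n)) ⟶ᴿ re w
    im⟶ : (λ n → im (z n)) ⟶ᴿ im w

sum< : ℕ → (ℕ → ℂ) → ℂ
sum< zero    f = 0ℂ
sum< (suc n) f = sum< n f +ᶜ f n

HasSum : (ℕ → ℂ) → ℂ → Set
HasSum f w = (λ n → sum< n f) ⟶ w

IsRational : ℂ → Set
IsRational z = ∃[ q ] z ≈ ℚ→ℂ q

-- Division, and everything below given by a limit, is treated as a relation
-- between arguments and value; the value is unique up to _≈_ where it exists.
-- (For division this presupposes ¬ (w ≈ 0ℂ).)
IsQuotient : ℂ → ℂ → ℂ → Set
IsQuotient z w t = t *ᶜ w ≈ z

recip! : ℕ → ℚ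
recip! n = (+ 1 / n !) {{n !≢0}}

-- w = exp z
IsExp : ℂ → ℂ → Set
IsExp z w = HasSum (λ k → ℚ→ℂ (recip! k) *ᶜ z ^ k) w

-- ℓ is some logarithm of z, not necessarily the principal one.
IsLog : ℂ → ℂ → Set
IsLog z ℓ = IsExp ℓ z

-- w = exp (ν ℓ), the power of order ν of the number with chosen logarithm ℓ
IsPower : ℂ → ℚ → ℂ → Set
IsPower ℓ ν w = IsExp (ℚ→ℂ ν *ᶜ ℓ) w

-- w = N ^ ν > 0, taken with the real logarithm of N
IsℕPower : ℕ → ℚ → ℂ → Set
IsℕPower N ν w = Σ[ ℓ ∈ ℝ ] IsLog (ℚ→ℂ (ℕ→ℚ N)) (ℝ→ℂ ℓ) × IsPower (ℝ→ℂ ℓ) ν w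

-- rising z n = z (z + 1) ⋯ (z + n - 1)
rising : ℚ → ℕ → ℚ
rising z zero    = 1ℚ
rising z (suc n) = rising z n * (z + ℕ→ℚ n)

-- a = N! N^z / (z (z + 1) ⋯ (z + N)); at a pole of Γ, no such a exists once
-- N is large.
IsΓApproximant : ℚ → ℕ → ℂ → Set
IsΓApproximant z N a =
  Σ[ p ∈ ℂ ] IsℕPower N z p × IsQuotient (ℚ→ℂ (ℕ→ℚ (N !)) *ᶜ p) (ℚ→ℂ (rising z (suc N))) a

-- Euler's definition Γ(z) = lim N! N^z / (z (z + 1) ⋯ (z + N)), along N = 1, 2, 3, …
IsΓ : ℚ → ℂ → Set
IsΓ z γ = Σ[ a ∈ (ℕ → ℂ) ] (∀ n → IsΓApproximant z (suc n) (a n)) × (a ⟶ γ)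

IsNonPositiveInteger : ℚ → Set
IsNonPositiveInteger z = ∃[ m ] z ≡ - ℕ→ℚ m

-- g = 1/Γ(z), extended by 0 to the poles of Γ
Is1/Γ : ℚ → ℂ → Set
Is1/Γ z g = (IsNonPositiveInteger z × g ≈ 0ℂ)
          ⊎ (¬ IsNonPositiveInteger z × Σ[ γ ∈ ℂ ] IsΓ z γ × IsQuotient 1ℂ γ g)

-[1]^_ : ℕ → ℚ
-[1]^ zero  = 1ℚ
-[1]^ suc k = - (-[1]^ k)

infixl 7 _/2
_/2 : ℂ → ℂ
z /2 = ℚ→ℂ ½ *ᶜ z

besselTerm : ℂ → (ℕ → ℂ) → ℂ → ℕ → ℂ
besselTerm r g p k = (ℚ→ℂ ((-[1]^ k) * recip! k) *ᶜ g k) *ᶜ ((r /2) ^ (2 ℕ.* k) *ᶜ p)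

-- j = J_ν(r), where ℓ is the logarithm of r/2 used for (r/2)^(ν + 2k) = (r/2)^(2k) (r/2)^ν
IsBesselJ : ℂ → ℚ → ℂ → ℂ → Set
IsBesselJ ℓ ν r j =
  Σ[ g ∈ (ℕ → ℂ) ] Σ[ p ∈ ℂ ]
    (∀ k → Is1/Γ (ν + ℕ→ℚ k + 1ℚ) (g k)) × IsPower ℓ ν p × HasSum (besselTerm r g p) j

module Submission where

-- Write J_{s+n}(r) = (r/2)^{s+n} f n with f n = Σ yᵏ/k! · 1/Γ(s+n+k+1) and
-- y = -r²/4 rational. Then f n = (s+n+1) f (n+1) + y f (n+2), so if
-- r J_{s+1}/J_s = -2y f 1/f 0 is rational, then f n = q n · f 0 with q n rational
-- and δⁿ q n an integer for a fixed δ. As f n = O(εⁿ) for every ε > 0 and no two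
-- consecutive q n vanish, |f 0| ≤ |δⁿ q n f 0| = O(2⁻ⁿ) for infinitely many n,
-- whence f 0 = 0.
--
-- The recurrence rests on Γ(z+1) = z Γ(z). With Euler's limit formula for Γ this
-- needs N^(z+1) = N · N^z, hence the addition theorem for exp and, since the
-- logarithm of N may be chosen afresh for each power, its injectivity on ℝ.

-- Reals are Cauchy sequences with no decidable comparison, and limits and quotients are given only
-- as relations. This shapes the argument in four ways. The rational ratio is used as an equation
-- `f 1 = κ · f 0`, and division by `r/2` becomes multiplication by `(r/2)/(r²/4)`, where only the
-- rational `r²/4` is inverted. Limits are handed over only for the orders `s` and `s + 1`. The
-- recurrence holds exactly for partial sums, so solving it for its last term, with `y` invertible,
-- yields the limits for all higher orders. Numerical case distinctions are made on rationals:
-- whether `q n` vanishes is decidable, and if it does, `q (n + 1)` takes its place. This gives a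
-- bound `C/2ⁿ` on the norm of the limit for every `n`, hence directly that it is zero. The equation
-- `1/Γ(z) = z · 1/Γ(z + 1)` persists across the poles of Γ, so integer orders run through the same
-- recurrence.

open import Defs
open import Data.Rational.Base using (ℚ; 1ℚ; _+_)
open import Relation.Nullary using (¬_)
open import Algebra.Bundles using (CommutativeRing)
open import Algebra.Structures using (IsCommutativeRing)
import Algebra.Solver.Ring as RingSolver
import Algebra.Solver.Ring.AlmostCommutativeRing as ACR
open import Data.Empty using (⊥-elim)
open import Data.Integer.Base as ℤ using (ℤ; +_; -[1+_])
import Data.Integer.Properties as ℤ
import Data.Maybe.Base as Maybe
open import Data.Nat.Base as ℕ using (ℕ; zero; suc; _!)
import Data.Nat.Properties as ℕ
open import Data.Product using (∃-syntax; _×_; _,_; proj₁; proj₂)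
open import Data.Rational.Base as ℚ
  using (0ℚ; ½; _*_; _-_; -_; _≤_; _<_; ∣_∣; 1/_; _/_; positive; nonNegative)
import Data.Rational.Properties as ℚ
open import Data.Rational.Solver using (module +-*-Solver)
import Data.Rational.Unnormalised.Base as ℚᵘ
import Data.Rational.Unnormalised.Properties as ℚᵘ
open import Data.Sum using (inj₁; inj₂)
open import Function.Base using (_∘_)
open import Level using (0ℓ)
import Relation.Binary.Reasoning.Setoid as SetoidReasoning
open import Relation.Binary.PropositionalEquality
  using (_≡_; _≢_; refl; sym; trans; cong; cong₂; subst; subst₂; module ≡-Reasoning)
open import Relation.Nullary using (Dec; yes; no)
open import Relation.Nullary.Decidable using (dec⇒maybe)

-- Rational numbers

0<½ : 0ℚ < ½
0<½ = ℚ.positive⁻¹ ½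

0<1 : 0ℚ < 1ℚ
0<1 = ℚ.positive⁻¹ 1ℚ

0≤1 : 0ℚ ≤ 1ℚ
0≤1 = ℚ.<⇒≤ 0<1

0<* : ∀ {p q} → 0ℚ < p → 0ℚ < q → 0ℚ < p * q
0<* {p} {q} 0<p 0<q = ℚ.positive⁻¹ (p * q) {{ℚ.pos*pos⇒pos p {{positive 0<p}} q {{positive 0<q}}}}

0≤* : ∀ {p q} → 0ℚ ≤ p → 0ℚ ≤ q → 0ℚ ≤ p * q
0≤* {p} {q} 0≤p 0≤q =
  ℚ.nonNegative⁻¹ (p * q) {{ℚ.nonNeg*nonNeg⇒nonNeg p {{nonNegative 0≤p}} q {{nonNegative 0≤q}}}}

0≤+ : ∀ {p q} → 0ℚ ≤ p → 0ℚ ≤ q → 0ℚ ≤ p + q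
0≤+ {p} {q} 0≤p 0≤q = subst (_≤ p + q) (ℚ.+-identityˡ 0ℚ) (ℚ.+-mono-≤ 0≤p 0≤q)

*-monoˡ-≤ : ∀ {r p q} → 0ℚ ≤ r → p ≤ q → r * p ≤ r * q
*-monoˡ-≤ {r} 0≤r = ℚ.*-monoˡ-≤-nonNeg r {{nonNegative 0≤r}}

*-monoʳ-≤ : ∀ {r p q} → 0ℚ ≤ r → p ≤ q → p * r ≤ q * r
*-monoʳ-≤ {r} 0≤r = ℚ.*-monoʳ-≤-nonNeg r {{nonNegative 0≤r}}

*-mono-≤ : ∀ {p q r s} → 0ℚ ≤ q → 0ℚ ≤ r → p ≤ q → r ≤ s → p * r ≤ q * s
*-mono-≤ 0≤q 0≤r p≤q r≤s = ℚ.≤-trans (*-monoʳ-≤ 0≤r p≤q) (*-monoˡ-≤ 0≤q r≤s)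

p≤p+q : ∀ {p q} → 0ℚ ≤ q → p ≤ p + q
p≤p+q {p} {q} 0≤q = subst (_≤ p + q) (ℚ.+-identityʳ p) (ℚ.+-monoʳ-≤ p 0≤q)

p≤q+p : ∀ {p q} → 0ℚ ≤ q → p ≤ q + p
p≤q+p {p} {q} 0≤q = subst (_≤ q + p) (ℚ.+-identityˡ p) (ℚ.+-monoˡ-≤ p 0≤q)

p≤∣p∣ : ∀ p → p ≤ ∣ p ∣
p≤∣p∣ p with ℚ.≤-total 0ℚ p
... | inj₁ 0≤p = ℚ.≤-reflexive (sym (ℚ.0≤p⇒∣p∣≡p 0≤p))
... | inj₂ p≤0 = ℚ.≤-trans p≤0 (ℚ.0≤∣p∣ p)

½*p+½*p≡p : ∀ p → ½ * p + ½ * p ≡ p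
½*p+½*p≡p = solve 1 (λ p → con ½ :* p :+ con ½ :* p := p) refl
  where open +-*-Solver

abstract
  inverse : ∀ {p} → p ≢ 0ℚ → ∃[ q ] p * q ≡ 1ℚ
  inverse {p} p≢0 = (1/ p) {{ℚ.≢-nonZero p≢0}} , ℚ.*-inverseʳ p {{ℚ.≢-nonZero p≢0}}

abstract
  inverse⁺ : ∀ {p} → 0ℚ < p → ∃[ q ] 0ℚ < q × p * q ≡ 1ℚ
  inverse⁺ {p} 0<p =
    (1/ p) {{p≢0}} , ℚ.positive⁻¹ _ {{ℚ.1/pos⇒pos p {{positive 0<p}}}} , ℚ.*-inverseʳ p {{p≢0}}
    where
    p≢0 : ℚ.NonZero p
    p≢0 = ℚ.pos⇒nonZero p {{positive 0<p}}

toℚᵘ-ℤ : ∀ i → ℚ.toℚᵘ (i / 1) ℚᵘ.≃ ℚᵘ.mkℚᵘ i 0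
toℚᵘ-ℤ i = ℚ.toℚᵘ-fromℚᵘ (ℚᵘ.mkℚᵘ i 0)

ℤ→ℚ-+ : ∀ i j → (i ℤ.+ j) / 1 ≡ i / 1 + j / 1
ℤ→ℚ-+ i j = ℚ.toℚᵘ-injective (begin
  ℚ.toℚᵘ ((i ℤ.+ j) / 1)                ≈⟨ toℚᵘ-ℤ (i ℤ.+ j) ⟩
  ℚᵘ.mkℚᵘ (i ℤ.+ j) 0                   ≈⟨ ℚᵘ.*≡* (cong (ℤ._* + 1) (cong₂ ℤ._+_ (sym (ℤ.*-identityʳ i)) (sym (ℤ.*-identityʳ j)))) ⟩
  ℚᵘ.mkℚᵘ i 0 ℚᵘ.+ ℚᵘ.mkℚᵘ j 0          ≈⟨ ℚᵘ.+-cong (toℚᵘ-ℤ i) (toℚᵘ-ℤ j) ⟨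
  ℚ.toℚᵘ (i / 1) ℚᵘ.+ ℚ.toℚᵘ (j / 1)    ≈⟨ ℚ.toℚᵘ-homo-+ (i / 1) (j / 1) ⟨
  ℚ.toℚᵘ (i / 1 + j / 1)                ∎)
  where open SetoidReasoning ℚᵘ.≃-setoid

ℤ→ℚ-* : ∀ i j → (i ℤ.* j) / 1 ≡ (i / 1) * (j / 1)
ℤ→ℚ-* i j = ℚ.toℚᵘ-injective (begin
  ℚ.toℚᵘ ((i ℤ.* j) / 1)                ≈⟨ toℚᵘ-ℤ (i ℤ.* j) ⟩
  ℚᵘ.mkℚᵘ i 0 ℚᵘ.* ℚᵘ.mkℚᵘ j 0          ≈⟨ ℚᵘ.*-cong (toℚᵘ-ℤ i) (toℚᵘ-ℤ j) ⟨
  ℚ.toℚᵘ (i / 1) ℚᵘ.* ℚ.toℚᵘ (j / 1)    ≈⟨ ℚ.toℚᵘ-homo-* (i / 1) (j / 1) ⟨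
  ℚ.toℚᵘ ((i / 1) * (j / 1))            ∎)
  where open SetoidReasoning ℚᵘ.≃-setoid

ℕ→ℚ-suc : ∀ n → ℕ→ℚ (suc n) ≡ ℕ→ℚ n + 1ℚ
ℕ→ℚ-suc n = trans (cong (λ m → + m / 1) (sym (ℕ.+-comm n 1))) (ℤ→ℚ-+ (+ n) (+ 1))

ℕ→ℚ-+ : ∀ m n → ℕ→ℚ (m ℕ.+ n) ≡ ℕ→ℚ m + ℕ→ℚ n
ℕ→ℚ-+ m n = ℤ→ℚ-+ (+ m) (+ n)

ℕ→ℚ-* : ∀ m n → ℕ→ℚ (m ℕ.* n) ≡ ℕ→ℚ m * ℕ→ℚ n
ℕ→ℚ-* m n = trans (cong (_/ 1) (ℤ.pos-* m n)) (ℤ→ℚ-* (+ m) (+ n))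

0≤ℕ→ℚ : ∀ n → 0ℚ ≤ ℕ→ℚ n
0≤ℕ→ℚ n = ℚ.nonNegative⁻¹ (ℕ→ℚ n) {{ℚ.normalize-nonNeg n 1}}

0<ℕ→ℚ : ∀ n → .{{ℕ.NonZero n}} → 0ℚ < ℕ→ℚ n
0<ℕ→ℚ n = ℚ.positive⁻¹ (ℕ→ℚ n) {{ℚ.normalize-pos n 1}}

ℕ→ℚ-suc≢0 : ∀ n → ℕ→ℚ (suc n) ≢ 0ℚ
ℕ→ℚ-suc≢0 n eq = ℚ.<⇒≢ (0<ℕ→ℚ (suc n)) (sym eq)

1≤ℕ→ℚ-suc : ∀ n → 1ℚ ≤ ℕ→ℚ (suc n)
1≤ℕ→ℚ-suc n = subst (1ℚ ≤_) (sym (ℕ→ℚ-suc n)) (p≤q+p (0≤ℕ→ℚ n))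

ℕ→ℚ-mono : ∀ {m n} → m ℕ.≤ n → ℕ→ℚ m ≤ ℕ→ℚ n
ℕ→ℚ-mono {m} {n} m≤n =
  subst (λ k → ℕ→ℚ m ≤ ℕ→ℚ k) (ℕ.m+[n∸m]≡n m≤n)
    (subst (ℕ→ℚ m ≤_) (sym (ℕ→ℚ-+ m (n ℕ.∸ m))) (p≤p+q (0≤ℕ→ℚ (n ℕ.∸ m))))

∣ℤ→ℚ∣ : ∀ i → ∣ i / 1 ∣ ≡ ℕ→ℚ ℤ.∣ i ∣
∣ℤ→ℚ∣ (+ n)    = ℚ.0≤p⇒∣p∣≡p (0≤ℕ→ℚ n)
∣ℤ→ℚ∣ -[1+ n ] = trans (ℚ.∣-p∣≡∣p∣ (ℕ→ℚ (suc n))) (ℚ.0≤p⇒∣p∣≡p (0≤ℕ→ℚ (suc n)))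

IsInteger : ℚ → Set
IsInteger q = ∃[ i ] q ≡ i / 1

int-ℕ : ∀ n → IsInteger (ℕ→ℚ n)
int-ℕ n = + n , refl

int-+ : ∀ {p q} → IsInteger p → IsInteger q → IsInteger (p + q)
int-+ (i , refl) (j , refl) = i ℤ.+ j , sym (ℤ→ℚ-+ i j)

int-* : ∀ {p q} → IsInteger p → IsInteger q → IsInteger (p * q)
int-* (i , refl) (j , refl) = i ℤ.* j , sym (ℤ→ℚ-* i j)

int-neg : ∀ {p} → IsInteger p → IsInteger (- p)
int-neg {p} int-p = subst IsInteger (solve 1 (λ p → con (- 1ℚ) :* p := :- p) refl p)
                      (int-* (ℤ.- + 1 , refl) int-p)
  where open +-*-Solver

int≢0⇒1≤∣∣ : ∀ {q} → IsInteger q → q ≢ 0ℚ → 1ℚ ≤ ∣ q ∣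
int≢0⇒1≤∣∣ (+ zero , refl)    q≢0 = ⊥-elim (q≢0 refl)
int≢0⇒1≤∣∣ (+ suc n , refl)   q≢0 = subst (1ℚ ≤_) (sym (∣ℤ→ℚ∣ (+ suc n))) (1≤ℕ→ℚ-suc n)
int≢0⇒1≤∣∣ (-[1+ n ] , refl) q≢0 = subst (1ℚ ≤_) (sym (∣ℤ→ℚ∣ -[1+ n ])) (1≤ℕ→ℚ-suc n)

*-denominator : ∀ q → q * ℕ→ℚ (ℚ.↧ₙ q) ≡ ℚ.↥ q / 1
*-denominator q@(ℚ.mkℚ i d _) = ℚ.toℚᵘ-injective (begin
  ℚ.toℚᵘ (q * ℕ→ℚ (suc d))                 ≈⟨ ℚ.toℚᵘ-homo-* q (ℕ→ℚ (suc d)) ⟩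
  ℚᵘ.mkℚᵘ i d ℚᵘ.* ℚ.toℚᵘ (ℕ→ℚ (suc d))    ≈⟨ ℚᵘ.*-congˡ {ℚᵘ.mkℚᵘ i d} (toℚᵘ-ℤ (+ suc d)) ⟩
  ℚᵘ.mkℚᵘ i d ℚᵘ.* ℚᵘ.mkℚᵘ (+ suc d) 0     ≈⟨ ℚᵘ.*≡* (trans (ℤ.*-identityʳ (i ℤ.* + suc d))
                                               (cong (i ℤ.*_) (cong +_ (cong suc (sym (ℕ.*-identityʳ d)))))) ⟩
  ℚᵘ.mkℚᵘ i 0                              ≈⟨ toℚᵘ-ℤ i ⟨
  ℚ.toℚᵘ (i / 1)                           ∎)
  where open SetoidReasoning ℚᵘ.≃-setoid

abstract
  archimedean : ∀ q → ∃[ n ] q ≤ ℕ→ℚ n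
  archimedean q = ℤ.∣ ℚ.↥ q ∣ , (begin
    q                            ≤⟨ p≤∣p∣ q ⟩
    ∣ q ∣                        ≡⟨ ℚ.*-identityʳ ∣ q ∣ ⟨
    ∣ q ∣ * 1ℚ                   ≤⟨ *-monoˡ-≤ (ℚ.0≤∣p∣ q) (1≤ℕ→ℚ-suc (ℚ.ℚ.denominator-1 q)) ⟩
    ∣ q ∣ * ℕ→ℚ (ℚ.↧ₙ q)         ≡⟨ cong (∣ q ∣ *_) (ℚ.0≤p⇒∣p∣≡p (0≤ℕ→ℚ (ℚ.↧ₙ q))) ⟨
    ∣ q ∣ * ∣ ℕ→ℚ (ℚ.↧ₙ q) ∣     ≡⟨ ℚ.∣p*q∣≡∣p∣*∣q∣ q (ℕ→ℚ (ℚ.↧ₙ q)) ⟨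
    ∣ q * ℕ→ℚ (ℚ.↧ₙ q) ∣         ≡⟨ cong ∣_∣ (*-denominator q) ⟩
    ∣ ℚ.↥ q / 1 ∣                ≡⟨ ∣ℤ→ℚ∣ (ℚ.↥ q) ⟩
    ℕ→ℚ ℤ.∣ ℚ.↥ q ∣              ∎)
    where open ℚ.≤-Reasoning

infixr 8 _^ℚ_

_^ℚ_ : ℚ → ℕ → ℚ
q ^ℚ zero  = 1ℚ
q ^ℚ suc n = q * q ^ℚ n

0<^ℚ : ∀ {q} n → 0ℚ < q → 0ℚ < q ^ℚ n
0<^ℚ zero    0<q = 0<1
0<^ℚ (suc n) 0<q = 0<* 0<q (0<^ℚ n 0<q)

0≤^ℚ : ∀ {q} n → 0ℚ < q → 0ℚ ≤ q ^ℚ n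
0≤^ℚ n 0<q = ℚ.<⇒≤ (0<^ℚ n 0<q)

^ℚ-*-commute : ∀ p q n → (p * q) ^ℚ n ≡ p ^ℚ n * q ^ℚ n
^ℚ-*-commute p q zero    = refl
^ℚ-*-commute p q (suc n) = trans (cong ((p * q) *_) (^ℚ-*-commute p q n))
  (solve 4 (λ p q a b → p :* q :* (a :* b) := p :* a :* (q :* b)) refl p q (p ^ℚ n) (q ^ℚ n))
  where open +-*-Solver

-- `(n + 1)/2ⁿ⁺¹` is half of `n/2ⁿ` plus half of `1/2ⁿ`, both at most 1. With the Archimedean
-- property this is the source of every explicit rate of convergence for `½ⁿ`.
n*½^n≤1 : ∀ n → ℕ→ℚ n * ½ ^ℚ n ≤ 1ℚ
n*½^n≤1 zero    = 0≤1
n*½^n≤1 (suc n) = begin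
  ℕ→ℚ (suc n) * (½ * ½ ^ℚ n)             ≡⟨ cong (_* (½ * ½ ^ℚ n)) (ℕ→ℚ-suc n) ⟩
  (ℕ→ℚ n + 1ℚ) * (½ * ½ ^ℚ n)            ≡⟨ solve 2 (λ m h → (m :+ con 1ℚ) :* (con ½ :* h) :=
                                              con ½ :* (m :* h) :+ con ½ :* h) refl (ℕ→ℚ n) (½ ^ℚ n) ⟩
  ½ * (ℕ→ℚ n * ½ ^ℚ n) + ½ * ½ ^ℚ n      ≤⟨ ℚ.+-mono-≤ (*-monoˡ-≤ (ℚ.<⇒≤ 0<½) (n*½^n≤1 n))
                                                       (*-monoˡ-≤ (ℚ.<⇒≤ 0<½) (½^n≤1 n)) ⟩
  ½ * 1ℚ + ½ * 1ℚ                        ≡⟨⟩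
  1ℚ                                     ∎
  where
  open ℚ.≤-Reasoning
  open +-*-Solver
  ½^n≤1 : ∀ n → ½ ^ℚ n ≤ 1ℚ
  ½^n≤1 zero    = ℚ.≤-refl
  ½^n≤1 (suc n) = ℚ.≤-trans (*-monoˡ-≤ (ℚ.<⇒≤ 0<½) (½^n≤1 n)) (ℚ.≤-trans (p≤p+q {½ * 1ℚ} (ℚ.<⇒≤ 0<½)) ℚ.≤-refl)

TendsTo∞ : (ℕ → ℚ) → Set
TendsTo∞ δ = ∀ K → ∃[ N ] ∀ n → N ℕ.≤ n → K ≤ δ n

abstract
  n+c→∞ : ∀ c → TendsTo∞ (λ n → c + ℕ→ℚ n)
  n+c→∞ c K with archimedean (K - c)
  ... | N , K-c≤N = N , λ n N≤n → begin
    K               ≡⟨ solve 2 (λ K c → K := c :+ (K :- c)) refl K c ⟩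
    c + (K - c)     ≤⟨ ℚ.+-monoʳ-≤ c K-c≤N ⟩
    c + ℕ→ℚ N       ≤⟨ ℚ.+-monoʳ-≤ c (ℕ→ℚ-mono N≤n) ⟩
    c + ℕ→ℚ n       ∎
    where
    open ℚ.≤-Reasoning
    open +-*-Solver

abstract
  -- For `n ≥ C/ε` the constant is at most `n ε`, and `n ½ⁿ ≤ 1` absorbs the factor `n`.
  C*½^n-small : ∀ C {ε} → 0ℚ < ε → ∃[ N ] ∀ n → N ℕ.≤ n → C * ½ ^ℚ n ≤ ε
  C*½^n-small C {ε} 0<ε with inverse⁺ 0<ε
  ... | κ , 0<κ , εκ≡1 with archimedean (C * κ)
  ... | N , Cκ≤N = N , λ n N≤n → begin
    C * ½ ^ℚ n              ≡⟨ cong (_* ½ ^ℚ n) (trans (sym (ℚ.*-identityʳ C)) (cong (C *_) (sym εκ≡1))) ⟩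
    C * (ε * κ) * ½ ^ℚ n    ≡⟨ solve 4 (λ C ε κ h → C :* (ε :* κ) :* h := C :* κ :* (ε :* h)) refl C ε κ (½ ^ℚ n) ⟩
    C * κ * (ε * ½ ^ℚ n)    ≤⟨ *-monoʳ-≤ (0≤* (ℚ.<⇒≤ 0<ε) (0≤^ℚ n 0<½)) (ℚ.≤-trans Cκ≤N (ℕ→ℚ-mono N≤n)) ⟩
    ℕ→ℚ n * (ε * ½ ^ℚ n)    ≡⟨ solve 3 (λ m ε h → m :* (ε :* h) := ε :* (m :* h)) refl (ℕ→ℚ n) ε (½ ^ℚ n) ⟩
    ε * (ℕ→ℚ n * ½ ^ℚ n)    ≤⟨ *-monoˡ-≤ (ℚ.<⇒≤ 0<ε) (n*½^n≤1 n) ⟩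
    ε * 1ℚ                  ≡⟨ ℚ.*-identityʳ ε ⟩
    ε                       ∎
    where
    open ℚ.≤-Reasoning
    open +-*-Solver

recip-* : ∀ m → .{{_ : ℕ.NonZero m}} → ℕ→ℚ m * (+ 1 / m) ≡ 1ℚ
recip-* m@(suc k) = ℚ.toℚᵘ-injective (begin
  ℚ.toℚᵘ (ℕ→ℚ m * (+ 1 / m))                ≈⟨ ℚ.toℚᵘ-homo-* (ℕ→ℚ m) (+ 1 / m) ⟩
  ℚ.toℚᵘ (ℕ→ℚ m) ℚᵘ.* ℚ.toℚᵘ (+ 1 / m)      ≈⟨ ℚᵘ.*-cong (toℚᵘ-ℤ (+ m)) (ℚ.toℚᵘ-fromℚᵘ (ℚᵘ.mkℚᵘ (+ 1) k)) ⟩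
  ℚᵘ.mkℚᵘ (+ m) 0 ℚᵘ.* ℚᵘ.mkℚᵘ (+ 1) k      ≈⟨ ℚᵘ.*≡* (trans (ℤ.*-identityʳ (+ m ℤ.* + 1)) (trans (ℤ.*-identityʳ (+ m))
                                                (trans (cong (λ j → + suc j) (sym (ℕ.+-identityʳ k)))
                                                       (sym (ℤ.*-identityˡ (+ suc (k ℕ.+ 0))))))) ⟩
  ℚᵘ.1ℚᵘ                                    ∎)
  where open SetoidReasoning ℚᵘ.≃-setoid

recip!-suc : ∀ n → ℕ→ℚ (suc n) * recip! (suc n) ≡ recip! n
recip!-suc n = begin
  N * r′                          ≡⟨ solve 2 (λ N r′ → N :* r′ := con 1ℚ :* (N :* r′)) refl N r′ ⟩
  1ℚ * (N * r′)                   ≡⟨ cong (_* (N * r′)) (sym (recip-* (n !) {{n ℕ.!≢0}})) ⟩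
  F * r * (N * r′)                ≡⟨ solve 4 (λ F r N r′ → F :* r :* (N :* r′) := r :* (N :* F :* r′)) refl F r N r′ ⟩
  r * (N * F * r′)                ≡⟨ cong (λ x → r * (x * r′)) (sym (ℕ→ℚ-* (suc n) (n !))) ⟩
  r * (ℕ→ℚ (suc n !) * r′)        ≡⟨ cong (r *_) (recip-* (suc n !) {{suc n ℕ.!≢0}}) ⟩
  r * 1ℚ                          ≡⟨ ℚ.*-identityʳ r ⟩
  r                               ∎
  where
  open ≡-Reasoning
  open +-*-Solver
  N = ℕ→ℚ (suc n)
  F = ℕ→ℚ (n !)
  r = recip! n
  r′ = recip! (suc n)

-- Series in a ring with a rational-valued norm bound

-- `Bd x p` reads: the norm of `x` is at most `p`. It is a relation because the norm of a complex
-- number is a real and need not be rational. The analysis of series uses only these laws, and over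
-- an abstract carrier no term contains a Cauchy sequence that could unfold.
record NormedRing : Set₁ where
  infixl 6 _⊝_
  field
    commutativeRing : CommutativeRing 0ℓ 0ℓ
  open CommutativeRing commutativeRing public
    using (Carrier; setoid)
    renaming ( _≈_ to _≋_; _+_ to _⊕_; _*_ to _⊗_; -_ to ⊖_
             ; refl to ≋-refl; sym to ≋-sym; trans to ≋-trans
             ; +-cong to ⊕-cong; +-congˡ to ⊕-congˡ; +-congʳ to ⊕-congʳ
             ; *-cong to ⊗-cong; *-congˡ to ⊗-congˡ; *-congʳ to ⊗-congʳ; -‿cong to ⊖-cong )
  field
    ι      : ℚ → Carrier
    ι-+    : ∀ p q → ι (p + q) ≋ ι p ⊕ ι q
    ι-*    : ∀ p q → ι (p * q) ≋ ι p ⊗ ι q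
    ι-neg  : ∀ p → ι (- p) ≋ ⊖ ι p
    ι-zero : ι 0ℚ ≋ CommutativeRing.0# commutativeRing
    ι-one  : ι 1ℚ ≋ CommutativeRing.1# commutativeRing
    Bd        : Carrier → ℚ → Set
    Bd-resp   : ∀ {x y p} → x ≋ y → Bd x p → Bd y p
    Bd-mono   : ∀ {x p q} → p ≤ q → Bd x p → Bd x q
    Bd-⊕      : ∀ {x y p q} → Bd x p → Bd y q → Bd (x ⊕ y) (p + q)
    Bd-⊗      : ∀ {x y p q} → Bd x p → Bd y q → Bd (x ⊗ y) (p * q)
    Bd-ι      : ∀ q → Bd (ι q) ∣ q ∣
    Bd-nonneg : ∀ {x p} → Bd x p → 0ℚ ≤ p
    Bd-closed : ∀ {x p} → (∀ ε → 0ℚ < ε → Bd x (p + ε)) → Bd x p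
    Bd-zero   : ∀ {x} → Bd x 0ℚ → x ≋ ι 0ℚ
    Bd-exists : ∀ x → ∃[ p ] Bd x p

  _⊝_ : Carrier → Carrier → Carrier
  x ⊝ y = x ⊕ ⊖ y

  ι-cong : ∀ {p q} → p ≡ q → ι p ≋ ι q
  ι-cong refl = ≋-refl

  ι-morphism : ℚ.+-*-rawRing ACR.-Raw-AlmostCommutative⟶ ACR.fromCommutativeRing commutativeRing
  ι-morphism = record
    { ⟦_⟧ = ι ; +-homo = ι-+ ; *-homo = ι-* ; -‿homo = ι-neg ; 0-homo = ι-zero ; 1-homo = ι-one }

  ι-≟ : ∀ p q → Maybe.Maybe (ι p ≋ ι q)
  ι-≟ p q = Maybe.map ι-cong (dec⇒maybe (p ℚ.≟ q))

  module ≋-Solver = RingSolver ℚ.+-*-rawRing (ACR.fromCommutativeRing commutativeRing) ι-morphism ι-≟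

  ⊝-cong : ∀ {x y x′ y′} → x ≋ x′ → y ≋ y′ → x ⊝ y ≋ x′ ⊝ y′
  ⊝-cong x≋x′ y≋y′ = ⊕-cong x≋x′ (⊖-cong y≋y′)

  Bd-scale : ∀ q {x p} → Bd x p → Bd (ι q ⊗ x) (∣ q ∣ * p)
  Bd-scale q = Bd-⊗ (Bd-ι q)

  Bd-⊖ : ∀ {x p} → Bd x p → Bd (⊖ x) p
  Bd-⊖ {x} {p} x≤p = Bd-resp (solve 1 (λ x → con (- 1ℚ) :* x := :- x) ≋-refl x)
                       (Bd-mono (ℚ.≤-reflexive (ℚ.*-identityˡ p)) (Bd-scale (- 1ℚ) x≤p))
    where open ≋-Solver

  Bd-⊝ : ∀ {x y p q} → Bd x p → Bd y q → Bd (x ⊝ y) (p + q)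
  Bd-⊝ x≤p y≤q = Bd-⊕ x≤p (Bd-⊖ y≤q)

  Bd-ι0 : ∀ {p} → 0ℚ ≤ p → Bd (ι 0ℚ) p
  Bd-ι0 0≤p = Bd-mono 0≤p (Bd-ι 0ℚ)

  ⊝≋0⇒≋ : ∀ {x y} → x ⊝ y ≋ ι 0ℚ → x ≋ y
  ⊝≋0⇒≋ {x} {y} eq = begin
    x             ≈⟨ solve 2 (λ x y → x := (x :- y) :+ y) ≋-refl x y ⟩
    x ⊝ y ⊕ y     ≈⟨ ⊕-congʳ eq ⟩
    ι 0ℚ ⊕ y      ≈⟨ solve 1 (λ y → con 0ℚ :+ y := y) ≋-refl y ⟩
    y             ∎
    where
    open ≋-Solver
    open SetoidReasoning setoid

  ι-cancel : ∀ {p x y} → p ≢ 0ℚ → ι p ⊗ x ≋ ι p ⊗ y → x ≋ y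
  ι-cancel {p} {x} {y} p≢0 eq with inverse p≢0
  ... | q , pq≡1 = begin
    x                  ≈⟨ unit x ⟩
    ι q ⊗ (ι p ⊗ x)    ≈⟨ ⊗-congˡ eq ⟩
    ι q ⊗ (ι p ⊗ y)    ≈⟨ unit y ⟨
    y                  ∎
    where
    open SetoidReasoning setoid
    open ≋-Solver
    unit : ∀ z → z ≋ ι q ⊗ (ι p ⊗ z)
    unit z = begin
      z                  ≈⟨ solve 1 (λ z → z := con 1ℚ :* z) ≋-refl z ⟩
      ι 1ℚ ⊗ z           ≈⟨ ⊗-congʳ (ι-cong (sym pq≡1)) ⟩
      ι (p * q) ⊗ z      ≈⟨ ⊗-congʳ (ι-* p q) ⟩
      ι p ⊗ ι q ⊗ z      ≈⟨ solve 3 (λ p q z → p :* q :* z := q :* (p :* z)) ≋-refl (ι p) (ι q) z ⟩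
      ι q ⊗ (ι p ⊗ z)    ∎

module NullSequences (A : NormedRing) where
  open NormedRing A

  Null : (ℕ → Carrier) → Set
  Null f = ∀ ε → 0ℚ < ε → ∃[ N ] ∀ n → N ℕ.≤ n → Bd (f n) ε

  EventuallyBounded : (ℕ → Carrier) → Set
  EventuallyBounded f = ∃[ B ] ∃[ N ] ∀ n → N ℕ.≤ n → Bd (f n) B

  null-cong : ∀ {f g} → (∀ n → f n ≋ g n) → Null f → Null g
  null-cong f≋g null-f ε 0<ε =
    let N , f≤ε = null-f ε 0<ε in N , λ n N≤n → Bd-resp (f≋g n) (f≤ε n N≤n)

  null-suc : ∀ {f} → Null f → Null (f ∘ suc)
  null-suc null-f ε 0<ε =
    let N , f≤ε = null-f ε 0<ε in N , λ n N≤n → f≤ε (suc n) (ℕ.m≤n⇒m≤1+n N≤n)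

  null-⊕ : ∀ {f g} → Null f → Null g → Null (λ n → f n ⊕ g n)
  null-⊕ null-f null-g ε 0<ε =
    let M , f≤ = null-f (½ * ε) (0<* 0<½ 0<ε)
        N , g≤ = null-g (½ * ε) (0<* 0<½ 0<ε)
    in M ℕ.⊔ N , λ n MN≤n → Bd-mono (ℚ.≤-reflexive (½*p+½*p≡p ε))
         (Bd-⊕ (f≤ n (ℕ.m⊔n≤o⇒m≤o M N MN≤n)) (g≤ n (ℕ.m⊔n≤o⇒n≤o M N MN≤n)))

  null-⊖ : ∀ {f} → Null f → Null (λ n → ⊖ f n)
  null-⊖ null-f ε 0<ε =
    let N , f≤ε = null-f ε 0<ε in N , λ n N≤n → Bd-⊖ (f≤ε n N≤n)

  null-⊗ : ∀ {f g} → EventuallyBounded f → Null g → Null (λ n → f n ⊗ g n)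
  null-⊗ (B , M , f≤B) null-g ε 0<ε =
    let 0≤B = Bd-nonneg (f≤B M ℕ.≤-refl)
        -- `B` may be zero, so `B + 1` is inverted instead.
        C , 0<C , [B+1]C≡1 = inverse⁺ (ℚ.<-≤-trans 0<1 (p≤q+p {1ℚ} 0≤B))
        N , g≤ = null-g (C * ε) (0<* 0<C 0<ε)
        0≤Cε = ℚ.<⇒≤ (0<* 0<C 0<ε)
        BCε≤ε = ℚ.≤-trans (*-monoʳ-≤ 0≤Cε (p≤p+q {B} 0≤1))
          (ℚ.≤-reflexive (trans (sym (ℚ.*-assoc (B + 1ℚ) C ε))
            (trans (cong (_* ε) [B+1]C≡1) (ℚ.*-identityˡ ε))))
    in M ℕ.⊔ N , λ n MN≤n → Bd-mono BCε≤ε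
         (Bd-⊗ (f≤B n (ℕ.m⊔n≤o⇒m≤o M N MN≤n)) (g≤ n (ℕ.m⊔n≤o⇒n≤o M N MN≤n)))

  null-scale : ∀ x {f} → Null f → Null (λ n → x ⊗ f n)
  null-scale x = null-⊗ (let p , x≤p = Bd-exists x in p , 0 , λ _ _ → x≤p)

  null-const⇒≋0 : ∀ {x} → Null (λ _ → x) → x ≋ ι 0ℚ
  null-const⇒≋0 null-x = Bd-zero (Bd-closed (λ ε 0<ε →
    let N , x≤ε = null-x ε 0<ε in Bd-mono (ℚ.≤-reflexive (sym (ℚ.+-identityˡ ε))) (x≤ε N ℕ.≤-refl)))

  infix 4 _⇒_

  _⇒_ : (ℕ → Carrier) → Carrier → Set
  f ⇒ x = Null (λ n → f n ⊝ x)

  ⇒-eventuallyBounded : ∀ {f x} → f ⇒ x → EventuallyBounded f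
  ⇒-eventuallyBounded {f} {x} f⇒x =
    let p , x≤p  = Bd-exists x
        N , fx≤1 = f⇒x 1ℚ 0<1
    in 1ℚ + p , N , λ n N≤n →
         Bd-resp (solve 2 (λ f x → (f :- x) :+ x := f) ≋-refl (f n) x) (Bd-⊕ (fx≤1 n N≤n) x≤p)
    where open ≋-Solver

  Bd-lim : ∀ {f x p} → (∀ n → Bd (f n) p) → f ⇒ x → Bd x p
  Bd-lim {f} {x} f≤p f⇒x = Bd-closed (λ ε 0<ε →
    let N , fx≤ε = f⇒x ε 0<ε
    in Bd-resp (solve 2 (λ f x → f :- (f :- x) := x) ≋-refl (f N) x) (Bd-⊝ (f≤p N) (fx≤ε N ℕ.≤-refl)))
    where open ≋-Solver

module Series (A : NormedRing) where
  open NormedRing A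
  open NullSequences A

  sum : ℕ → (ℕ → Carrier) → Carrier
  sum zero    f = ι 0ℚ
  sum (suc n) f = sum n f ⊕ f n

  sum-cong : ∀ {f g} → (∀ k → f k ≋ g k) → ∀ n → sum n f ≋ sum n g
  sum-cong f≋g zero    = ≋-refl
  sum-cong f≋g (suc n) = ⊕-cong (sum-cong f≋g n) (f≋g n)

  sum-suc : ∀ f n → sum (suc n) f ≋ f 0 ⊕ sum n (f ∘ suc)
  sum-suc f zero    = solve 1 (λ x → con 0ℚ :+ x := x :+ con 0ℚ) ≋-refl (f 0)
    where open ≋-Solver
  sum-suc f (suc n) = ≋-trans (⊕-congʳ (sum-suc f n))
    (solve 3 (λ x y z → x :+ y :+ z := x :+ (y :+ z)) ≋-refl (f 0) (sum n (f ∘ suc)) (f (suc n)))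
    where open ≋-Solver

  sum-scale : ∀ x f n → sum n (λ k → x ⊗ f k) ≋ x ⊗ sum n f
  sum-scale x f zero    = solve 1 (λ x → con 0ℚ := x :* con 0ℚ) ≋-refl x
    where open ≋-Solver
  sum-scale x f (suc n) = ≋-trans (⊕-congʳ (sum-scale x f n))
    (solve 3 (λ x y z → x :* y :+ x :* z := x :* (y :+ z)) ≋-refl x (sum n f) (f n))
    where open ≋-Solver

  record Geometric (C q : ℚ) (f : ℕ → Carrier) : Set where
    constructor geometric
    field
      bound : ∀ n → Bd (f n) (C * q ^ℚ n)

  open Geometric public

  geometric-nonneg : ∀ {C q f} → Geometric C q f → 0ℚ ≤ C
  geometric-nonneg {C} f≤ = subst (0ℚ ≤_) (ℚ.*-identityʳ C) (Bd-nonneg (bound f≤ 0))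

  geometric-suc : ∀ {C q f} → Geometric C q f → Geometric (C * q) q (f ∘ suc)
  geometric-suc {C} {q} f≤ = geometric λ n →
    Bd-mono (ℚ.≤-reflexive (sym (ℚ.*-assoc C q (q ^ℚ n)))) (bound f≤ (suc n))

  -- Without its first term the series has constant `C/2`, and `C + (C/2 + C/2) = C + C`, so the
  -- bound reproduces itself uniformly in `n`.
  geometric-sum : ∀ {C f} → Geometric C ½ f → ∀ n → Bd (sum n f) (C + C)
  geometric-sum f≤ zero = Bd-ι0 (0≤+ (geometric-nonneg f≤) (geometric-nonneg f≤))
  geometric-sum {C} {f} f≤ (suc n) = Bd-resp (≋-sym (sum-suc f n))
    (Bd-mono (ℚ.≤-reflexive (solve 1 (λ C → C :* con 1ℚ :+ (C :* con ½ :+ C :* con ½) := C :+ C) refl C))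
      (Bd-⊕ (bound f≤ 0) (geometric-sum (geometric-suc f≤) n)))
    where open +-*-Solver

  Rapid : (ℕ → Carrier) → Set
  Rapid f = ∀ q → 0ℚ < q → ∃[ C ] Geometric C q f

  -- Induction on the threshold `N` of the ratio test: the constant `C′` of the tail is divided by
  -- `q` to account for the shift, and the bound on the first term is added.
  geometric-ratio : ∀ {q} → 0ℚ < q → ∀ N f →
                    (∀ n → N ℕ.≤ n → ∀ p → Bd (f n) p → Bd (f (suc n)) (q * p)) → ∃[ C ] Geometric C q f
  geometric-ratio {q} 0<q zero f ratio = C , geometric f≤
    where
    C = proj₁ (Bd-exists (f 0))
    f≤ : ∀ n → Bd (f n) (C * q ^ℚ n)
    f≤ zero    = Bd-mono (ℚ.≤-reflexive (sym (ℚ.*-identityʳ C))) (proj₂ (Bd-exists (f 0)))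
    f≤ (suc n) = Bd-mono (ℚ.≤-reflexive (solve 3 (λ q C r → q :* (C :* r) := C :* (q :* r)) refl q C (q ^ℚ n)))
                   (ratio n ℕ.z≤n _ (f≤ n))
      where open +-*-Solver
  geometric-ratio {q} 0<q (suc N) f ratio
    with geometric-ratio 0<q N (f ∘ suc) (λ n N≤n → ratio (suc n) (ℕ.s≤s N≤n)) | inverse⁺ 0<q
  ... | C′ , f′≤ | κ , 0<κ , qκ≡1 = C + C′ * κ , geometric f≤
    where
    open ℚ.≤-Reasoning
    open +-*-Solver
    C = proj₁ (Bd-exists (f 0))
    0≤C = Bd-nonneg (proj₂ (Bd-exists (f 0)))
    0≤C′κ = 0≤* (geometric-nonneg f′≤) (ℚ.<⇒≤ 0<κ)
    f≤ : ∀ n → Bd (f n) ((C + C′ * κ) * q ^ℚ n)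
    f≤ zero    = Bd-mono (ℚ.≤-trans (p≤p+q 0≤C′κ) (ℚ.≤-reflexive (sym (ℚ.*-identityʳ (C + C′ * κ)))))
                   (proj₂ (Bd-exists (f 0)))
    f≤ (suc n) = Bd-mono (begin
      C′ * q ^ℚ n                     ≡⟨ cong (_* q ^ℚ n) (trans (sym (ℚ.*-identityʳ C′)) (cong (C′ *_) (sym qκ≡1))) ⟩
      C′ * (q * κ) * q ^ℚ n           ≡⟨ solve 4 (λ C′ q κ r → C′ :* (q :* κ) :* r := C′ :* κ :* (q :* r)) refl
                                           C′ q κ (q ^ℚ n) ⟩
      C′ * κ * q ^ℚ suc n             ≤⟨ *-monoʳ-≤ (0≤^ℚ (suc n) 0<q) (p≤q+p {C′ * κ} 0≤C) ⟩
      (C + C′ * κ) * q ^ℚ suc n       ∎) (bound f′≤ n)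

  abstract
    -- As soon as `δ n ≥ α/q`, dividing the recurrence by `δ n` shows that each step shrinks the
    -- bound by the factor `q`. The division happens only for large `n`; early values of `δ` may
    -- vanish or be negative.
    rapid-ratio : ∀ {δ} → TendsTo∞ δ → ∀ a f → (∀ n → ι (δ n) ⊗ f (suc n) ≋ a ⊗ f n) → Rapid f
    rapid-ratio {δ} δ→∞ a f rec q 0<q with Bd-exists a | inverse⁺ 0<q
    -- The summand 1 keeps `δ n` positive, hence invertible, also when `α = 0`.
    ... | α , a≤α | κ , 0<κ , qκ≡1 with δ→∞ (α * κ + 1ℚ)
    ... | N , K≤δ = geometric-ratio 0<q N f ratio
      where
      0≤α : 0ℚ ≤ α
      0≤α = Bd-nonneg a≤α
      ratio : ∀ n → N ℕ.≤ n → ∀ p → Bd (f n) p → Bd (f (suc n)) (q * p)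
      ratio n N≤n p f≤p with inverse⁺ {δ n} (ℚ.<-≤-trans 0<1
                               (ℚ.≤-trans (p≤q+p (0≤* 0≤α (ℚ.<⇒≤ 0<κ))) (K≤δ n N≤n)))
      ... | ρ , 0<ρ , δρ≡1 = Bd-resp
              (ι-cancel (λ ρ≡0 → ℚ.<⇒≢ 0<δ (sym ρ≡0)) (≋-trans unit (≋-sym (rec n))))
              (Bd-mono αρ≤q (Bd-scale ρ (Bd-⊗ a≤α f≤p)))
        where
        0<δ : 0ℚ < δ n
        0<δ = ℚ.<-≤-trans 0<1 (ℚ.≤-trans (p≤q+p (0≤* 0≤α (ℚ.<⇒≤ 0<κ))) (K≤δ n N≤n))
        unit : ι (δ n) ⊗ (ι ρ ⊗ (a ⊗ f n)) ≋ a ⊗ f n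
        unit = begin
          ι (δ n) ⊗ (ι ρ ⊗ (a ⊗ f n))    ≈⟨ solve 3 (λ d r x → d :* (r :* x) := d :* r :* x) ≋-refl (ι (δ n)) (ι ρ) (a ⊗ f n) ⟩
          ι (δ n) ⊗ ι ρ ⊗ (a ⊗ f n)      ≈⟨ ⊗-congʳ (ι-* (δ n) ρ) ⟨
          ι (δ n * ρ) ⊗ (a ⊗ f n)        ≈⟨ ⊗-congʳ (ι-cong δρ≡1) ⟩
          ι 1ℚ ⊗ (a ⊗ f n)               ≈⟨ solve 1 (λ x → con 1ℚ :* x := x) ≋-refl (a ⊗ f n) ⟩
          a ⊗ f n                        ∎
          where
          open SetoidReasoning setoid
          open ≋-Solver
        αρ≤q : ∣ ρ ∣ * (α * p) ≤ q * p
        αρ≤q = begin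
          ∣ ρ ∣ * (α * p)                   ≡⟨ cong (_* (α * p)) (ℚ.0≤p⇒∣p∣≡p (ℚ.<⇒≤ 0<ρ)) ⟩
          ρ * (α * p)                       ≡⟨ cong (λ x → ρ * (x * p)) (trans (sym (ℚ.*-identityʳ α)) (cong (α *_) (sym qκ≡1))) ⟩
          ρ * (α * (q * κ) * p)             ≡⟨ solve 5 (λ ρ α q κ p → ρ :* (α :* (q :* κ) :* p) := ρ :* (q :* p) :* (α :* κ)) refl ρ α q κ p ⟩
          ρ * (q * p) * (α * κ)             ≤⟨ *-monoˡ-≤ (0≤* (ℚ.<⇒≤ 0<ρ) (0≤* (ℚ.<⇒≤ 0<q) (Bd-nonneg f≤p)))
                                                 (ℚ.≤-trans (p≤p+q 0≤1) (K≤δ n N≤n)) ⟩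
          ρ * (q * p) * δ n                 ≡⟨ solve 4 (λ ρ q p d → ρ :* (q :* p) :* d := d :* ρ :* (q :* p)) refl ρ q p (δ n) ⟩
          δ n * ρ * (q * p)                 ≡⟨ trans (cong (_* (q * p)) δρ≡1) (ℚ.*-identityˡ (q * p)) ⟩
          q * p                             ∎
          where
          open ℚ.≤-Reasoning
          open +-*-Solver

-- The exponential series

module CauchyProduct (A : NormedRing) where
  open NormedRing A
  open Series A

  conv : (ℕ → Carrier) → (ℕ → Carrier) → ℕ → Carrier
  conv f g zero    = f 0 ⊗ g 0
  conv f g (suc n) = f 0 ⊗ g (suc n) ⊕ conv (f ∘ suc) g n

  conv-cong : ∀ {f f′ g g′} → (∀ k → f k ≋ f′ k) → (∀ k → g k ≋ g′ k) → ∀ n → conv f g n ≋ conv f′ g′ n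
  conv-cong f≋ g≋ zero    = ⊗-cong (f≋ 0) (g≋ 0)
  conv-cong f≋ g≋ (suc n) = ⊕-cong (⊗-cong (f≋ 0) (g≋ (suc n))) (conv-cong (f≋ ∘ suc) g≋ n)

  conv-⊕ˡ : ∀ f f′ g n → conv (λ k → f k ⊕ f′ k) g n ≋ conv f g n ⊕ conv f′ g n
  conv-⊕ˡ f f′ g zero    = solve 3 (λ x y z → (x :+ y) :* z := x :* z :+ y :* z) ≋-refl (f 0) (f′ 0) (g 0)
    where open ≋-Solver
  conv-⊕ˡ f f′ g (suc n) = ≋-trans (⊕-congˡ (conv-⊕ˡ (f ∘ suc) (f′ ∘ suc) g n))
    (solve 5 (λ x y z u v → (x :+ y) :* z :+ (u :+ v) := x :* z :+ u :+ (y :* z :+ v)) ≋-refl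
      (f 0) (f′ 0) (g (suc n)) (conv (f ∘ suc) g n) (conv (f′ ∘ suc) g n))
    where open ≋-Solver

  conv-scaleˡ : ∀ a f g n → conv (λ k → a ⊗ f k) g n ≋ a ⊗ conv f g n
  conv-scaleˡ a f g zero    = solve 3 (λ a x y → a :* x :* y := a :* (x :* y)) ≋-refl a (f 0) (g 0)
    where open ≋-Solver
  conv-scaleˡ a f g (suc n) = ≋-trans (⊕-congˡ (conv-scaleˡ a (f ∘ suc) g n))
    (solve 4 (λ a x y u → a :* x :* y :+ a :* u := a :* (x :* y :+ u)) ≋-refl
      a (f 0) (g (suc n)) (conv (f ∘ suc) g n))
    where open ≋-Solver

  conv-scaleʳ : ∀ a f g n → conv f (λ k → a ⊗ g k) n ≋ a ⊗ conv f g n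
  conv-scaleʳ a f g zero    = solve 3 (λ a x y → x :* (a :* y) := a :* (x :* y)) ≋-refl a (f 0) (g 0)
    where open ≋-Solver
  conv-scaleʳ a f g (suc n) = ≋-trans (⊕-congˡ (conv-scaleʳ a (f ∘ suc) g n))
    (solve 4 (λ a x y u → x :* (a :* y) :+ a :* u := a :* (x :* y :+ u)) ≋-refl
      a (f 0) (g (suc n)) (conv (f ∘ suc) g n))
    where open ≋-Solver

  -- The triangle of products `f i ⊗ g j` with `i + j ≤ n` splits into the row `i = 0` and the
  -- triangle of the shifted sequence.
  sum-conv : ∀ f g n → sum (suc n) (conv f g) ≋ f 0 ⊗ sum (suc n) g ⊕ sum n (conv (f ∘ suc) g)
  sum-conv f g zero    = solve 2 (λ x y → con 0ℚ :+ x :* y := x :* (con 0ℚ :+ y) :+ con 0ℚ) ≋-refl (f 0) (g 0)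
    where open ≋-Solver
  sum-conv f g (suc n) = ≋-trans (⊕-congʳ (sum-conv f g n))
    (solve 5 (λ x u v y w → x :* u :+ v :+ (x :* y :+ w) := x :* (u :+ y) :+ (v :+ w)) ≋-refl
      (f 0) (sum (suc n) g) (sum n (conv (f ∘ suc) g)) (g (suc n)) (conv (f ∘ suc) g n))
    where open ≋-Solver

  -- The part of the square `i, j < n` that lies outside the triangle `i + j < n`.
  defect : (ℕ → Carrier) → (ℕ → Carrier) → ℕ → Carrier
  defect f g n = sum n f ⊗ sum n g ⊝ sum n (conv f g)

  -- In the larger square only pairs with `i ≥ 1` lie outside the triangle. After shifting `i`, they
  -- are the full column `j = n` and the defect of the shifted sequence.
  defect-suc : ∀ f g n → defect f g (suc n) ≋ sum n (f ∘ suc) ⊗ g n ⊕ defect (f ∘ suc) g n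
  defect-suc f g n = ≋-trans (⊝-cong (⊗-congʳ (sum-suc f n)) (sum-conv f g n))
    (solve 5 (λ x u v y w → (x :+ u) :* (v :+ y) :- (x :* (v :+ y) :+ w) := u :* y :+ (u :* v :- w)) ≋-refl
      (f 0) (sum n (f ∘ suc)) (sum n g) (g n) (sum n (conv (f ∘ suc) g)))
    where open ≋-Solver

  geometric-¼⇒½ : ∀ {C f} → Geometric C (½ * ½) f → Geometric C ½ f
  geometric-¼⇒½ {C} f≤ = geometric λ n →
    Bd-mono (*-monoˡ-≤ (geometric-nonneg f≤) (¼^n≤½^n n)) (bound f≤ n)
    where
    ¼≤½ : ½ * ½ ≤ ½
    ¼≤½ = p≤p+q {½ * ½} {½ * ½} (ℚ.<⇒≤ (0<* 0<½ 0<½))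
    ¼^n≤½^n : ∀ n → (½ * ½) ^ℚ n ≤ ½ ^ℚ n
    ¼^n≤½^n zero    = ℚ.≤-refl
    ¼^n≤½^n (suc n) = *-mono-≤ (ℚ.<⇒≤ 0<½) (0≤^ℚ n (0<* 0<½ 0<½)) ¼≤½ (¼^n≤½^n n)

  -- The different ratios make the recursion defect-suc contract without an
  -- extra factor n.
  defect-bound : ∀ {C D f g} → Geometric C (½ * ½) f → Geometric D ½ g →
                 ∀ n → Bd (defect f g n) ((C + C) * D * ½ ^ℚ n)
  defect-bound {C} {D} f≤ g≤ zero = Bd-resp
    (solve 0 (con 0ℚ := con 0ℚ :* con 0ℚ :- con 0ℚ) ≋-refl)
    (Bd-ι0 (0≤* (0≤* (0≤+ 0≤C 0≤C) (geometric-nonneg g≤)) 0≤1))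
    where
    open ≋-Solver
    0≤C = geometric-nonneg f≤
  defect-bound {C} {D} {f} {g} f≤ g≤ (suc n) = Bd-resp (≋-sym (defect-suc f g n))
    (Bd-mono (ℚ.≤-reflexive (solve 3 (λ C D h →
        (C :* (con ½ :* con ½) :+ C :* (con ½ :* con ½)) :* (D :* h) :+
        (C :* (con ½ :* con ½) :+ C :* (con ½ :* con ½)) :* D :* h := (C :+ C) :* D :* (con ½ :* h)) refl C D (½ ^ℚ n)))
      (Bd-⊕ (Bd-⊗ (geometric-sum (geometric-¼⇒½ f′≤) n) (bound g≤ n)) (defect-bound f′≤ g≤ n)))
    where
    open +-*-Solver
    f′≤ = geometric-suc f≤

  -- The formal derivative of the power series with coefficients `f`.
  ∂ : (ℕ → Carrier) → ℕ → Carrier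
  ∂ f k = ι (ℕ→ℚ (suc k)) ⊗ f (suc k)

  ι-suc : ∀ n → ι (ℕ→ℚ (suc n)) ≋ ι (ℕ→ℚ n) ⊕ ι 1ℚ
  ι-suc n = ≋-trans (ι-cong (ℕ→ℚ-suc n)) (ι-+ (ℕ→ℚ n) 1ℚ)

  -- The Leibniz rule. It allows the addition theorem for exp to be read off from a differential
  -- equation, without binomial coefficients.
  ∂-conv : ∀ f g n → ∂ (conv f g) n ≋ conv (∂ f) g n ⊕ conv f (∂ g) n
  ∂-conv f g zero    = solve 4 (λ x₀ x₁ y₀ y₁ → con 1ℚ :* (x₀ :* y₁ :+ x₁ :* y₀) :=
                         con 1ℚ :* x₁ :* y₀ :+ x₀ :* (con 1ℚ :* y₁)) ≋-refl (f 0) (f 1) (g 0) (g 1)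
    where open ≋-Solver
  ∂-conv f g (suc n) = begin
    m ⊗ (f 0 ⊗ y₂ ⊕ conv f′ g (suc n))
      ≈⟨ solve 4 (λ m x y u → m :* (x :* y :+ u) := m :* x :* y :+ m :* u) ≋-refl m (f 0) y₂ (conv f′ g (suc n)) ⟩
    m ⊗ f 0 ⊗ y₂ ⊕ m ⊗ conv f′ g (suc n)
      -- `n + 2 = (n + 1) + 1`: the first part forms `∂ (conv f′ g) n` for the induction hypothesis,
      -- the second is what `∂ f ∘ suc` has in excess of `∂ f′`.
      ≈⟨ ⊕-congˡ (≋-trans (⊗-congʳ (ι-suc (suc n)))
           (solve 2 (λ m u → (m :+ con 1ℚ) :* u := m :* u :+ u) ≋-refl (ι (ℕ→ℚ (suc n))) (conv f′ g (suc n)))) ⟩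
    m ⊗ f 0 ⊗ y₂ ⊕ (∂ (conv f′ g) n ⊕ (f 1 ⊗ y₁ ⊕ conv f″ g n))
      ≈⟨ ⊕-congˡ (⊕-congʳ (∂-conv f′ g n)) ⟩
    m ⊗ f 0 ⊗ y₂ ⊕ (conv (∂ f′) g n ⊕ conv f′ (∂ g) n ⊕ (f 1 ⊗ y₁ ⊕ conv f″ g n))
      ≈⟨ solve 8 (λ m x₀ y₂ u v x₁ y₁ w → m :* x₀ :* y₂ :+ (u :+ v :+ (x₁ :* y₁ :+ w)) :=
           con 1ℚ :* x₁ :* y₁ :+ (u :+ w) :+ (x₀ :* (m :* y₂) :+ v)) ≋-refl
           m (f 0) y₂ (conv (∂ f′) g n) (conv f′ (∂ g) n) (f 1) y₁ (conv f″ g n) ⟩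
    ι 1ℚ ⊗ f 1 ⊗ y₁ ⊕ (conv (∂ f′) g n ⊕ conv f″ g n) ⊕ conv f (∂ g) (suc n)
      ≈⟨ ⊕-congʳ (⊕-congˡ (conv-⊕ˡ (∂ f′) f″ g n)) ⟨
    ι 1ℚ ⊗ f 1 ⊗ y₁ ⊕ conv (λ k → ∂ f′ k ⊕ f″ k) g n ⊕ conv f (∂ g) (suc n)
      ≈⟨ ⊕-congʳ (⊕-congˡ (conv-cong ∂-suc (λ _ → ≋-refl) n)) ⟨
    conv (∂ f) g (suc n) ⊕ conv f (∂ g) (suc n)
      ∎
    where
    open SetoidReasoning setoid
    open ≋-Solver
    f′ = f ∘ suc
    f″ = f′ ∘ suc
    m  = ι (ℕ→ℚ (suc (suc n)))
    y₁ = g (suc n)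
    y₂ = g (suc (suc n))
    ∂-suc : ∀ k → ∂ f (suc k) ≋ ∂ f′ k ⊕ f″ k
    ∂-suc k = ≋-trans (⊗-congʳ (ι-suc (suc k)))
      (solve 2 (λ m u → (m :+ con 1ℚ) :* u := m :* u :+ u) ≋-refl (ι (ℕ→ℚ (suc k))) (f″ k))

module Exponential (A : NormedRing) where
  open NormedRing A
  open NullSequences A
  open Series A
  open CauchyProduct A

  pow : Carrier → ℕ → Carrier
  pow x zero    = ι 1ℚ
  pow x (suc n) = x ⊗ pow x n

  expTerm : Carrier → ℕ → Carrier
  expTerm x k = ι (recip! k) ⊗ pow x k

  expSum : Carrier → ℕ → Carrier
  expSum x n = sum n (expTerm x)

  IsExponential : Carrier → Carrier → Set
  IsExponential x y = expSum x ⇒ y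

  -- The differential equation of `X ↦ exp (x X)` on coefficients. It governs both the decay of the
  -- terms and the addition theorem.
  ∂-expTerm : ∀ x n → ∂ (expTerm x) n ≋ x ⊗ expTerm x n
  ∂-expTerm x n = begin
    ι (ℕ→ℚ (suc n)) ⊗ (ι (recip! (suc n)) ⊗ (x ⊗ pow x n))
      ≈⟨ solve 4 (λ m r x p → m :* (r :* (x :* p)) := x :* (m :* r :* p)) ≋-refl
           (ι (ℕ→ℚ (suc n))) (ι (recip! (suc n))) x (pow x n) ⟩
    x ⊗ (ι (ℕ→ℚ (suc n)) ⊗ ι (recip! (suc n)) ⊗ pow x n)
      ≈⟨ ⊗-congˡ (⊗-congʳ (ι-* (ℕ→ℚ (suc n)) (recip! (suc n)))) ⟨
    x ⊗ (ι (ℕ→ℚ (suc n) * recip! (suc n)) ⊗ pow x n)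
      ≈⟨ ⊗-congˡ (⊗-congʳ (ι-cong (recip!-suc n))) ⟩
    x ⊗ expTerm x n
      ∎
    where
    open SetoidReasoning setoid
    open ≋-Solver

  ℕ→ℚ-suc→∞ : TendsTo∞ (λ n → ℕ→ℚ (suc n))
  ℕ→ℚ-suc→∞ K = let N , K≤ = n+c→∞ 1ℚ K in
    N , λ n N≤n → subst (K ≤_) (trans (ℚ.+-comm 1ℚ (ℕ→ℚ n)) (sym (ℕ→ℚ-suc n))) (K≤ n N≤n)

  expTerm-rapid : ∀ x → Rapid (expTerm x)
  expTerm-rapid x = rapid-ratio ℕ→ℚ-suc→∞ x (expTerm x) (∂-expTerm x)

  -- Both sides satisfy (n + 1) c (n + 1) = (x + y) c n.
  conv-expTerm : ∀ x y n → conv (expTerm x) (expTerm y) n ≋ expTerm (x ⊕ y) n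
  conv-expTerm x y zero    = solve 0 (con 1ℚ :* con 1ℚ :* (con 1ℚ :* con 1ℚ) := con 1ℚ :* con 1ℚ) ≋-refl
    where open ≋-Solver
  conv-expTerm x y (suc n) = ι-cancel (ℕ→ℚ-suc≢0 n) (begin
    ∂ (conv e f) n                                          ≈⟨ ∂-conv e f n ⟩
    conv (∂ e) f n ⊕ conv e (∂ f) n                         ≈⟨ ⊕-cong (conv-cong (∂-expTerm x) (λ _ → ≋-refl) n)
                                                                      (conv-cong (λ _ → ≋-refl) (∂-expTerm y) n) ⟩
    conv (λ k → x ⊗ e k) f n ⊕ conv e (λ k → y ⊗ f k) n     ≈⟨ ⊕-cong (conv-scaleˡ x e f n) (conv-scaleʳ y e f n) ⟩
    x ⊗ conv e f n ⊕ y ⊗ conv e f n                         ≈⟨ solve 3 (λ x y c → x :* c :+ y :* c := (x :+ y) :* c) ≋-refl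
                                                                 x y (conv e f n) ⟩
    (x ⊕ y) ⊗ conv e f n                                    ≈⟨ ⊗-congˡ (conv-expTerm x y n) ⟩
    (x ⊕ y) ⊗ expTerm (x ⊕ y) n                             ≈⟨ ∂-expTerm (x ⊕ y) n ⟨
    ∂ (expTerm (x ⊕ y)) n                                   ∎)
    where
    open SetoidReasoning setoid
    open ≋-Solver
    e = expTerm x
    f = expTerm y

  pow-cong : ∀ {x y} → x ≋ y → ∀ n → pow x n ≋ pow y n
  pow-cong x≋y zero    = ≋-refl
  pow-cong x≋y (suc n) = ⊗-cong x≋y (pow-cong x≋y n)

  expSum-cong : ∀ {x y} → x ≋ y → ∀ n → expSum x n ≋ expSum y n
  expSum-cong x≋y = sum-cong (λ k → ⊗-congˡ (pow-cong x≋y k))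

  expSum-bounded : ∀ x → EventuallyBounded (expSum x)
  expSum-bounded x = let C , e≤ = expTerm-rapid x ½ 0<½ in C + C , 0 , λ n _ → geometric-sum e≤ n

  -- Stated for partial sums, because `exponential-injective` applies it to a difference of
  -- logarithms, whose exponential is not given as a limit.
  expSum-⊕ : ∀ {x y z} → z ≋ x ⊕ y → Null (λ n → expSum x n ⊗ expSum y n ⊝ expSum z n)
  expSum-⊕ {x} {y} {z} z≋x⊕y ε 0<ε =
    let C , e≤    = expTerm-rapid x (½ * ½) (0<* 0<½ 0<½)
        D , f≤    = expTerm-rapid y ½ 0<½
        N , small = C*½^n-small ((C + C) * D) 0<ε
    in N , λ n N≤n → Bd-mono (small n N≤n)
         (Bd-resp (⊝-cong ≋-refl (≋-trans (sum-cong (conv-expTerm x y) n) (≋-sym (expSum-cong z≋x⊕y n))))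
           (defect-bound e≤ f≤ n))

  exponential-⊕ : ∀ {x y z u v w} → IsExponential x u → IsExponential y v → IsExponential z w →
                  z ≋ x ⊕ y → w ≋ u ⊗ v
  exponential-⊕ {x} {y} {z} {u} {v} {w} x⇒u y⇒v z⇒w z≋x⊕y =
    ≋-sym (⊝≋0⇒≋ (null-const⇒≋0 (null-cong
      (λ n → solve 6 (λ a b c u v w → (a :* b :- c) :+ (c :- w) :- (a :* (b :- v) :+ v :* (a :- u)) := u :* v :- w)
        ≋-refl (expSum x n) (expSum y n) (expSum z n) u v w)
      (null-⊕ (null-⊕ (expSum-⊕ z≋x⊕y) z⇒w)
        (null-⊖ (null-⊕ (null-⊗ (expSum-bounded x) y⇒v) (null-scale v x⇒u)))))))
    where open ≋-Solver

  -- The law `v^(ν+1) = v^ν · v`, where `v` is the number with logarithm `ℓ′`. Two logarithms occur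
  -- because each real power of `N` comes with its own.
  exponential-suc : ∀ {ν ℓ ℓ′ u v w} → ℓ ≋ ℓ′ → IsExponential (ι ν ⊗ ℓ) u → IsExponential ℓ′ v →
                    IsExponential (ι (ν + 1ℚ) ⊗ ℓ′) w → w ≋ u ⊗ v
  exponential-suc {ν} {ℓ} {ℓ′} ℓ≋ℓ′ νℓ⇒u ℓ′⇒v ⇒w = exponential-⊕ νℓ⇒u ℓ′⇒v ⇒w (begin
    ι (ν + 1ℚ) ⊗ ℓ′            ≈⟨ ⊗-congʳ (ι-+ ν 1ℚ) ⟩
    (ι ν ⊕ ι 1ℚ) ⊗ ℓ′          ≈⟨ solve 2 (λ ν ℓ → (ν :+ con 1ℚ) :* ℓ := ν :* ℓ :+ ℓ) ≋-refl (ι ν) ℓ′ ⟩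
    ι ν ⊗ ℓ′ ⊕ ℓ′              ≈⟨ ⊕-congʳ (⊗-congˡ ℓ≋ℓ′) ⟨
    ι ν ⊗ ℓ ⊕ ℓ′               ∎)
    where
    open SetoidReasoning setoid
    open ≋-Solver

-- Positivity and injectivity of the real exponential

record Cone (A : NormedRing) : Set₁ where
  open NormedRing A
  field
    NonNeg      : Carrier → Set
    nonNeg-resp : ∀ {x y} → x ≋ y → NonNeg x → NonNeg y
    nonNeg-⊕    : ∀ {x y} → NonNeg x → NonNeg y → NonNeg (x ⊕ y)
    nonNeg-⊗    : ∀ {x y} → NonNeg x → NonNeg y → NonNeg (x ⊗ y)
    nonNeg-ι    : ∀ {q} → 0ℚ ≤ q → NonNeg (ι q)
    nonNeg-Bd   : ∀ {x p q} → NonNeg (x ⊝ ι p) → Bd x q → p ≤ q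

module OrderedExponential (A : NormedRing) (P : Cone A) where
  open NormedRing A
  open Cone P
  open NullSequences A
  open Series A
  open Exponential A

  0≤recip! : ∀ n → 0ℚ ≤ recip! n
  0≤recip! n = ℚ.nonNegative⁻¹ (recip! n) {{ℚ.normalize-nonNeg 1 (n !) {{n ℕ.!≢0}}}}

  nonNeg-expTerm : ∀ {x} → NonNeg x → ∀ n → NonNeg (expTerm x n)
  nonNeg-expTerm {x} 0≤x n = nonNeg-⊗ (nonNeg-ι (0≤recip! n)) (nonNeg-pow n)
    where
    nonNeg-pow : ∀ n → NonNeg (pow x n)
    nonNeg-pow zero    = nonNeg-ι 0≤1
    nonNeg-pow (suc n) = nonNeg-⊗ 0≤x (nonNeg-pow n)

  -- The first two terms are exactly `1` and `x`, which is why the index starts at 2; all further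
  -- terms are non-negative.
  1+x≤expSum : ∀ {x} → NonNeg x → ∀ n → NonNeg (expSum x (2 ℕ.+ n) ⊝ (ι 1ℚ ⊕ x))
  1+x≤expSum {x} 0≤x zero = nonNeg-resp
    (solve 1 (λ x → con 0ℚ := con 0ℚ :+ con 1ℚ :* con 1ℚ :+ con 1ℚ :* (x :* con 1ℚ) :- (con 1ℚ :+ x)) ≋-refl x)
    (nonNeg-ι ℚ.≤-refl)
    where open ≋-Solver
  1+x≤expSum {x} 0≤x (suc n) = nonNeg-resp
    (solve 3 (λ e x t → e :- (con 1ℚ :+ x) :+ t := e :+ t :- (con 1ℚ :+ x)) ≋-refl
      (expSum x (2 ℕ.+ n)) x (expTerm x (2 ℕ.+ n)))
    (nonNeg-⊕ (1+x≤expSum 0≤x n) (nonNeg-expTerm 0≤x (2 ℕ.+ n)))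
    where open ≋-Solver

  -- Let `d = y - x`. By the addition theorem for partial sums, `q (exp d - 1)` is null; yet if
  -- `d ≥ c`, then it is at least `q d ≥ c`, because `exp d ≥ 1 + d` and `q ≥ 1`.
  exponential-injective : ∀ {x y q c} → 1ℚ ≤ q → IsExponential x (ι q) → IsExponential y (ι q) →
                          0ℚ < c → ¬ NonNeg (y ⊝ x ⊝ ι c)
  exponential-injective {x} {y} {q} {c} 1≤q x⇒q y⇒q 0<c c≤y-x =
    ℚ.<⇒≢ (ℚ.<-≤-trans ½c<c c≤½c) refl
    where
    open ≋-Solver
    d = y ⊝ x
    0≤d : NonNeg d
    0≤d = nonNeg-resp (solve 2 (λ d c → d :- c :+ c := d) ≋-refl d (ι c))
            (nonNeg-⊕ c≤y-x (nonNeg-ι (ℚ.<⇒≤ 0<c)))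
    null : Null (λ n → ι q ⊗ (expSum d n ⊝ ι 1ℚ))
    null = null-cong
      (λ n → solve 4 (λ a b e q → a :* e :- b :+ (b :- q) :- e :* (a :- q) := q :* (e :- con 1ℚ)) ≋-refl
        (expSum x n) (expSum y n) (expSum d n) (ι q))
      (null-⊕ (null-⊕ (expSum-⊕ (solve 2 (λ x y → y := x :+ (y :- x)) ≋-refl x y)) y⇒q)
        (null-⊖ (null-⊗ (expSum-bounded d) x⇒q)))
    c≤ : ∀ n → NonNeg (ι q ⊗ (expSum d (2 ℕ.+ n) ⊝ ι 1ℚ) ⊝ ι c)
    -- With `e` the partial sum at `d`: `q (e - 1) - c = q (d - c) + (q - 1) c + q (e - 1 - d)`, a
    -- sum of non-negative products.
    c≤ n = nonNeg-resp
      (≋-trans (⊕-congʳ (⊕-congˡ (⊗-congʳ (≋-trans (ι-+ q (- 1ℚ)) (⊕-congˡ (ι-neg 1ℚ))))))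
        (solve 4 (λ e d q c → q :* (d :- c) :+ (q :+ :- con 1ℚ) :* c :+ q :* (e :- (con 1ℚ :+ d)) := q :* (e :- con 1ℚ) :- c)
          ≋-refl (expSum d (2 ℕ.+ n)) d (ι q) (ι c)))
      (nonNeg-⊕
        (nonNeg-⊕ (nonNeg-⊗ 0≤q c≤y-x) (nonNeg-⊗ (nonNeg-ι (subst (_≤ q - 1ℚ) (ℚ.+-inverseʳ 1ℚ) (ℚ.+-monoˡ-≤ (- 1ℚ) 1≤q))) (nonNeg-ι (ℚ.<⇒≤ 0<c))))
        (nonNeg-⊗ 0≤q (1+x≤expSum 0≤d n)))
      where
      0≤q = nonNeg-ι (ℚ.≤-trans 0≤1 1≤q)
    ½c<c : ½ * c < c
    ½c<c = subst₂ _<_ (ℚ.+-identityʳ (½ * c)) (½*p+½*p≡p c) (ℚ.+-monoʳ-< (½ * c) (0<* 0<½ 0<c))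
    c≤½c : c ≤ ½ * c
    c≤½c = let N , ≤½c = null (½ * c) (0<* 0<½ 0<c)
           in nonNeg-Bd (c≤ N) (≤½c (2 ℕ.+ N) (ℕ.m≤n+m N 2))

-- The three-term recurrence

-- Exactly what one step of the recurrence for `ratio` consumes: `δⁿ⁺² ratio (n + 2)` combines its
-- two scaled predecessors with the integer coefficients `δ · δw` and `δws + δw (n + 1)`, while `δκ`
-- starts the induction.
record CommonDenominator (κ w s : ℚ) : Set where
  field
    δ       : ℚ
    0<δ     : 0ℚ < δ
    int-δ   : IsInteger δ
    int-δκ  : IsInteger (δ * κ)
    int-δw  : IsInteger (δ * w)
    int-δws : IsInteger (δ * w * s)

commonDenominator : ∀ κ w s → CommonDenominator κ w s
commonDenominator κ w s = record
  { δ       = dκ * (dw * ds)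
  ; 0<δ     = 0<* (0<ℕ→ℚ (ℚ.↧ₙ κ)) (0<* (0<ℕ→ℚ (ℚ.↧ₙ w)) (0<ℕ→ℚ (ℚ.↧ₙ s)))
  ; int-δ   = int-* int-dκ (int-* int-dw int-ds)
  ; int-δκ  = subst IsInteger
      (solve 4 (λ κ a b c → κ :* a :* (b :* c) := a :* (b :* c) :* κ) refl κ dκ dw ds)
      (int-* (int-numerator κ) (int-* int-dw int-ds))
  ; int-δw  = subst IsInteger
      (solve 4 (λ w a b c → w :* b :* (a :* c) := a :* (b :* c) :* w) refl w dκ dw ds)
      (int-* (int-numerator w) (int-* int-dκ int-ds))
  ; int-δws = subst IsInteger
      (solve 5 (λ w s a b c → w :* b :* (s :* c) :* a := a :* (b :* c) :* w :* s) refl w s dκ dw ds)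
      (int-* (int-* (int-numerator w) (int-numerator s)) int-dκ)
  }
  where
  open +-*-Solver
  dκ dw ds : ℚ
  dκ = ℕ→ℚ (ℚ.↧ₙ κ)
  dw = ℕ→ℚ (ℚ.↧ₙ w)
  ds = ℕ→ℚ (ℚ.↧ₙ s)
  int-dκ : IsInteger dκ
  int-dκ = int-ℕ (ℚ.↧ₙ κ)
  int-dw : IsInteger dw
  int-dw = int-ℕ (ℚ.↧ₙ w)
  int-ds : IsInteger ds
  int-ds = int-ℕ (ℚ.↧ₙ s)
  int-numerator : ∀ q → IsInteger (q * ℕ→ℚ (ℚ.↧ₙ q))
  int-numerator q = ℚ.↥ q , *-denominator q

-- The sequence G satisfies the functional equation of k ↦ 1/Γ(s + k + 1), and
-- S n is the sequence of partial sums of Σ yᵏ/k! · G (n + k), which is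
-- (r/2)^(-s-n) J_{s+n}(r) for y = -(r/2)².
module BesselRecurrence (A : NormedRing) (s y : ℚ) where
  open NormedRing A
  open NullSequences A
  open Series A

  coefficient : ℕ → ℚ
  coefficient k = y ^ℚ k * recip! k

  module _ (G : ℕ → Carrier) (G-rec : ∀ k → G k ≋ ι (s + ℕ→ℚ k + 1ℚ) ⊗ G (suc k)) where

    term : ℕ → ℕ → Carrier
    term n k = ι (coefficient k) ⊗ G (n ℕ.+ k)

    S : ℕ → ℕ → Carrier
    S n K = sum K (term n)

    -- Split `s + n + (k + 1) + 1` into `s + n + 1` and `k + 1`; the latter cancels against the
    -- factorial and leaves `y` times the preceding coefficient.
    coefficient-rec : ∀ n k → coefficient (suc k) * (s + ℕ→ℚ (n ℕ.+ suc k) + 1ℚ) ≡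
                      (s + ℕ→ℚ n + 1ℚ) * coefficient (suc k) + y * coefficient k
    coefficient-rec n k = begin
      y * Y * r′ * (s + ℕ→ℚ (n ℕ.+ suc k) + 1ℚ)
        ≡⟨ cong (λ m → y * Y * r′ * (s + m + 1ℚ)) (ℕ→ℚ-+ n (suc k)) ⟩
      y * Y * r′ * (s + (ℕ→ℚ n + ℕ→ℚ (suc k)) + 1ℚ)
        ≡⟨ solve 6 (λ y Y r′ s n k → y :* Y :* r′ :* (s :+ (n :+ k) :+ con 1ℚ) :=
             (s :+ n :+ con 1ℚ) :* (y :* Y :* r′) :+ y :* (Y :* (k :* r′))) refl y Y r′ s (ℕ→ℚ n) (ℕ→ℚ (suc k)) ⟩
      (s + ℕ→ℚ n + 1ℚ) * (y * Y * r′) + y * (Y * (ℕ→ℚ (suc k) * r′))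
        ≡⟨ cong (λ r → (s + ℕ→ℚ n + 1ℚ) * (y * Y * r′) + y * (Y * r)) (recip!-suc k) ⟩
      (s + ℕ→ℚ n + 1ℚ) * (y * Y * r′) + y * (Y * recip! k)
        ∎
      where
      open ≡-Reasoning
      open +-*-Solver
      Y = y ^ℚ k
      r′ = recip! (suc k)

    term-rec : ∀ n k → term n (suc k) ≋ ι (s + ℕ→ℚ n + 1ℚ) ⊗ term (suc n) (suc k) ⊕ ι y ⊗ term (2 ℕ.+ n) k
    term-rec n k = begin
      ι c′ ⊗ G (n ℕ.+ suc k)
        ≈⟨ ⊗-congˡ (G-rec (n ℕ.+ suc k)) ⟩
      ι c′ ⊗ (ι (s + ℕ→ℚ (n ℕ.+ suc k) + 1ℚ) ⊗ g)
        ≈⟨ solve 3 (λ c d g → c :* (d :* g) := c :* d :* g) ≋-refl (ι c′) (ι (s + ℕ→ℚ (n ℕ.+ suc k) + 1ℚ)) g ⟩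
      ι c′ ⊗ ι (s + ℕ→ℚ (n ℕ.+ suc k) + 1ℚ) ⊗ g
        ≈⟨ ⊗-congʳ (ι-* c′ (s + ℕ→ℚ (n ℕ.+ suc k) + 1ℚ)) ⟨
      ι (c′ * (s + ℕ→ℚ (n ℕ.+ suc k) + 1ℚ)) ⊗ g
        ≈⟨ ⊗-congʳ (≋-trans (ι-cong (coefficient-rec n k)) (≋-trans (ι-+ (d * c′) (y * c)) (⊕-cong (ι-* d c′) (ι-* y c)))) ⟩
      (ι d ⊗ ι c′ ⊕ ι y ⊗ ι c) ⊗ g
        ≈⟨ solve 5 (λ d c′ y c g → (d :* c′ :+ y :* c) :* g := d :* (c′ :* g) :+ y :* (c :* g)) ≋-refl
             (ι d) (ι c′) (ι y) (ι c) g ⟩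
      ι d ⊗ term (suc n) (suc k) ⊕ ι y ⊗ (ι c ⊗ g)
        ≡⟨ cong (λ j → ι d ⊗ term (suc n) (suc k) ⊕ ι y ⊗ (ι c ⊗ G (suc j))) (ℕ.+-suc n k) ⟩
      ι d ⊗ term (suc n) (suc k) ⊕ ι y ⊗ term (2 ℕ.+ n) k
        ∎
      where
      open SetoidReasoning setoid
      open ≋-Solver
      c = coefficient k
      c′ = coefficient (suc k)
      d = s + ℕ→ℚ n + 1ℚ
      g = G (suc (n ℕ.+ suc k))

    -- An exact identity of partial sums. The last sum is one term shorter because its summand `k`
    -- arises from the summand `k + 1` on the left.
    S-rec : ∀ n K → S n (suc K) ≋ ι (s + ℕ→ℚ n + 1ℚ) ⊗ S (suc n) (suc K) ⊕ ι y ⊗ S (2 ℕ.+ n) K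
    S-rec n zero    = begin
      ι 0ℚ ⊕ ι 1ℚ ⊗ G (n ℕ.+ 0)
        ≈⟨ ⊕-congˡ (⊗-congˡ (≋-trans (G-rec (n ℕ.+ 0)) (⊗-congʳ (ι-cong (cong (λ m → s + ℕ→ℚ m + 1ℚ) (ℕ.+-identityʳ n)))))) ⟩
      ι 0ℚ ⊕ ι 1ℚ ⊗ (ι d ⊗ G (suc (n ℕ.+ 0)))
        ≈⟨ solve 3 (λ d g y → con 0ℚ :+ con 1ℚ :* (d :* g) := d :* (con 0ℚ :+ con 1ℚ :* g) :+ y :* con 0ℚ) ≋-refl
             (ι d) (G (suc (n ℕ.+ 0))) (ι y) ⟩
      ι d ⊗ S (suc n) 1 ⊕ ι y ⊗ ι 0ℚ
        ∎
      where
      open SetoidReasoning setoid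
      open ≋-Solver
      d = s + ℕ→ℚ n + 1ℚ
    S-rec n (suc K) = ≋-trans (⊕-cong (S-rec n K) (term-rec n K))
      (solve 6 (λ d a y b u v → d :* a :+ y :* b :+ (d :* u :+ y :* v) := d :* (a :+ u) :+ y :* (b :+ v)) ≋-refl
        (ι (s + ℕ→ℚ n + 1ℚ)) (S (suc n) (suc K)) (ι y) (S (2 ℕ.+ n) K) (term (suc n) (suc K)) (term (2 ℕ.+ n) K))
      where open ≋-Solver

    -- The functional equation read forwards divides by `s + k + 1`, which tends to infinity.
    G-rapid : Rapid G
    G-rapid = rapid-ratio {λ k → s + ℕ→ℚ k + 1ℚ} δ→∞ (ι 1ℚ) G
      (λ k → ≋-trans (≋-sym (G-rec k)) (solve 1 (λ g → g := con 1ℚ :* g) ≋-refl (G k)))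
      where
      open ≋-Solver
      δ→∞ : TendsTo∞ (λ k → s + ℕ→ℚ k + 1ℚ)
      δ→∞ K = let N , K≤ = n+c→∞ s K in N , λ k N≤k → ℚ.≤-trans (K≤ k N≤k) (p≤p+q 0≤1)

    coefficient-rapid : Rapid (λ k → ι (coefficient k))
    coefficient-rapid = rapid-ratio (n+c→∞ 1ℚ) (ι y) (λ k → ι (coefficient k)) λ k → begin
      ι (1ℚ + ℕ→ℚ k) ⊗ ι (coefficient (suc k))    ≈⟨ ι-* (1ℚ + ℕ→ℚ k) (coefficient (suc k)) ⟨
      ι ((1ℚ + ℕ→ℚ k) * coefficient (suc k))      ≈⟨ ι-cong (eq k) ⟩
      ι (y * coefficient k)                       ≈⟨ ι-* y (coefficient k) ⟩
      ι y ⊗ ι (coefficient k)                     ∎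
      where
      open SetoidReasoning setoid
      eq : ∀ k → (1ℚ + ℕ→ℚ k) * coefficient (suc k) ≡ y * coefficient k
      eq k = trans (cong (_* coefficient (suc k)) (trans (ℚ.+-comm 1ℚ (ℕ→ℚ k)) (sym (ℕ→ℚ-suc k))))
        (trans (solve 4 (λ m y Y r → m :* (y :* Y :* r) := y :* (Y :* (m :* r))) refl (ℕ→ℚ (suc k)) y (y ^ℚ k) (recip! (suc k)))
               (cong (λ r → y * (y ^ℚ k * r)) (recip!-suc k)))
        where open +-*-Solver

    ^ℚ-+ : ∀ q m n → q ^ℚ (m ℕ.+ n) ≡ q ^ℚ m * q ^ℚ n
    ^ℚ-+ q zero    n = sym (ℚ.*-identityˡ (q ^ℚ n))
    ^ℚ-+ q (suc m) n = trans (cong (q *_) (^ℚ-+ q m n)) (sym (ℚ.*-assoc q (q ^ℚ m) (q ^ℚ n)))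

    ^ℚ≤1 : ∀ {q} n → 0ℚ < q → q ≤ 1ℚ → q ^ℚ n ≤ 1ℚ
    ^ℚ≤1 zero    0<q q≤1 = ℚ.≤-refl
    ^ℚ≤1 (suc n) 0<q q≤1 = *-mono-≤ {q = 1ℚ} {s = 1ℚ} 0≤1 (0≤^ℚ n 0<q) q≤1 (^ℚ≤1 n 0<q q≤1)

    -- `G (n + k)` contributes `qⁿ qᵏ`. The factor `qⁿ` is the decay in the order, `qᵏ ≤ 1` is
    -- dropped, and summability over `k` comes from the coefficients alone. The bound is uniform in
    -- `K`.
    S-geometric : ∀ {q C D} → 0ℚ < q → q ≤ 1ℚ → Geometric C q G → Geometric D ½ (λ k → ι (coefficient k)) →
                  ∀ n K → Bd (S n K) ((D * C + D * C) * q ^ℚ n)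
    S-geometric {q} {C} {D} 0<q q≤1 G≤ c≤ n K =
      Bd-mono (ℚ.≤-reflexive (sym (ℚ.*-distribʳ-+ (q ^ℚ n) (D * C) (D * C)))) (geometric-sum (term≤ n) K)
      where
      0≤C = geometric-nonneg G≤
      0≤D = geometric-nonneg c≤
      term≤ : ∀ n → Geometric (D * C * q ^ℚ n) ½ (term n)
      term≤ n = geometric λ k → Bd-mono (begin
        D * ½ ^ℚ k * (C * q ^ℚ (n ℕ.+ k))          ≡⟨ cong (λ x → D * ½ ^ℚ k * (C * x)) (^ℚ-+ q n k) ⟩
        D * ½ ^ℚ k * (C * (q ^ℚ n * q ^ℚ k))       ≡⟨ solve 5 (λ D h C a b → D :* h :* (C :* (a :* b)) := D :* C :* a :* h :* b)
                                                        refl D (½ ^ℚ k) C (q ^ℚ n) (q ^ℚ k) ⟩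
        D * C * q ^ℚ n * ½ ^ℚ k * q ^ℚ k           ≤⟨ *-monoˡ-≤ (0≤* (0≤* (0≤* 0≤D 0≤C) (0≤^ℚ n 0<q)) (0≤^ℚ k 0<½)) (^ℚ≤1 k 0<q q≤1) ⟩
        D * C * q ^ℚ n * ½ ^ℚ k * 1ℚ               ≡⟨ ℚ.*-identityʳ (D * C * q ^ℚ n * ½ ^ℚ k) ⟩
        D * C * q ^ℚ n * ½ ^ℚ k                    ∎)
        (Bd-⊗ (bound c≤ k) (bound G≤ (n ℕ.+ k)))
        where
        open ℚ.≤-Reasoning
        open +-*-Solver

    abstract
      S-rapid : ∀ q → 0ℚ < q → q ≤ 1ℚ → ∃[ C ] ∀ n K → Bd (S n K) (C * q ^ℚ n)
      S-rapid q 0<q q≤1 =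
        let C , G≤ = G-rapid q 0<q
            D , c≤ = coefficient-rapid ½ 0<½
        in D * C + D * C , S-geometric 0<q q≤1 G≤ c≤

    module _ {w : ℚ} (yw≡1 : y * w ≡ 1ℚ) (κ : ℚ) where

      -- The `q n` of the overview: the recurrence solved for its last term, with `w = 1/y`.
      ratio : ℕ → ℚ
      ratio zero          = 1ℚ
      ratio (suc zero)    = κ
      ratio (suc (suc n)) = w * (ratio n - (s + ℕ→ℚ n + 1ℚ) * ratio (suc n))

      ratio-rec : ∀ n → ratio n ≡ (s + ℕ→ℚ n + 1ℚ) * ratio (suc n) + y * ratio (suc (suc n))
      ratio-rec n = begin
        a                                ≡⟨ solve 2 (λ a db → a := db :+ con 1ℚ :* (a :- db)) refl a (d * b) ⟩
        d * b + 1ℚ * (a - d * b)         ≡⟨ cong (λ x → d * b + x * (a - d * b)) (sym yw≡1) ⟩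
        d * b + y * w * (a - d * b)      ≡⟨ cong (λ x → d * b + x) (ℚ.*-assoc y w (a - d * b)) ⟩
        d * b + y * (w * (a - d * b))    ∎
        where
        open ≡-Reasoning
        open +-*-Solver
        a = ratio n
        b = ratio (suc n)
        d = s + ℕ→ℚ n + 1ℚ

      -- Read downwards the recurrence involves no division, so two consecutive zeros would descend
      -- to `ratio 0 = 1`.
      ratio≢0 : ∀ n → ratio n ≡ 0ℚ → ratio (suc n) ≢ 0ℚ
      ratio≢0 zero    ()
      ratio≢0 (suc n) r₁≡0 r₂≡0 = ratio≢0 n (begin
        ratio n                                                            ≡⟨ ratio-rec n ⟩
        (s + ℕ→ℚ n + 1ℚ) * ratio (suc n) + y * ratio (suc (suc n))         ≡⟨ cong₂ (λ b c → (s + ℕ→ℚ n + 1ℚ) * b + y * c) r₁≡0 r₂≡0 ⟩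
        (s + ℕ→ℚ n + 1ℚ) * 0ℚ + y * 0ℚ                                     ≡⟨ solve 2 (λ d y → d :* con 0ℚ :+ y :* con 0ℚ := con 0ℚ)
                                                                                refl (s + ℕ→ℚ n + 1ℚ) y ⟩
        0ℚ                                                                 ∎) r₁≡0
        where
        open ≡-Reasoning
        open +-*-Solver

      module _ {F : Carrier} (S₀⇒ : S 0 ⇒ F) (S₁⇒ : S 1 ⇒ ι κ ⊗ F) where

        -- Convergence for `n ≥ 2` is not assumed: `S (n + 2)` equals `w` times a combination of
        -- `S n` and `S (n + 1)`, taken one index further, and inherits its limit from them.
        S⇒ : ∀ n → S n ⇒ ι (ratio n) ⊗ F
        S⇒ zero          = null-cong (λ K → ⊝-cong ≋-refl (solve 1 (λ F → F := con 1ℚ :* F) ≋-refl F)) S₀⇒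
          where open ≋-Solver
        S⇒ (suc zero)    = S₁⇒
        S⇒ (suc (suc n)) = null-cong eq (null-scale (ι w)
            (null-⊕ (null-suc (S⇒ n)) (null-⊖ (null-scale (ι d) (null-suc (S⇒ (suc n)))))))
          where
          open SetoidReasoning setoid
          open ≋-Solver
          a = ratio n
          b = ratio (suc n)
          d = s + ℕ→ℚ n + 1ℚ
          ι-ratio : ι (w * (a - d * b)) ≋ ι w ⊗ (ι a ⊝ ι d ⊗ ι b)
          ι-ratio = begin
            ι (w * (a - d * b))             ≈⟨ ι-* w (a - d * b) ⟩
            ι w ⊗ ι (a - d * b)             ≈⟨ ⊗-congˡ (≋-trans (ι-+ a (- (d * b))) (⊕-congˡ (ι-neg (d * b)))) ⟩
            ι w ⊗ (ι a ⊝ ι (d * b))         ≈⟨ ⊗-congˡ (⊝-cong ≋-refl (ι-* d b)) ⟩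
            ι w ⊗ (ι a ⊝ ι d ⊗ ι b)         ∎
          wy : ι w ⊗ ι y ≋ ι 1ℚ
          wy = ≋-trans (≋-sym (ι-* w y)) (ι-cong (trans (ℚ.*-comm w y) yw≡1))
          eq : ∀ K → ι w ⊗ (S n (suc K) ⊝ ι a ⊗ F ⊝ ι d ⊗ (S (suc n) (suc K) ⊝ ι b ⊗ F)) ≋
                     S (2 ℕ.+ n) K ⊝ ι (w * (a - d * b)) ⊗ F
          eq K = begin
            ι w ⊗ (S n (suc K) ⊝ ι a ⊗ F ⊝ ι d ⊗ (T ⊝ ι b ⊗ F))
              ≈⟨ ⊗-congˡ (⊝-cong (⊝-cong (S-rec n K) ≋-refl) ≋-refl) ⟩
            ι w ⊗ (ι d ⊗ T ⊕ ι y ⊗ U ⊝ ι a ⊗ F ⊝ ι d ⊗ (T ⊝ ι b ⊗ F))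
              ≈⟨ solve 8 (λ w d T y U a F b → w :* (d :* T :+ y :* U :- a :* F :- d :* (T :- b :* F)) :=
                   w :* y :* U :- w :* (a :- d :* b) :* F) ≋-refl (ι w) (ι d) T (ι y) U (ι a) F (ι b) ⟩
            ι w ⊗ ι y ⊗ U ⊝ ι w ⊗ (ι a ⊝ ι d ⊗ ι b) ⊗ F
              ≈⟨ ⊝-cong (≋-trans (⊗-congʳ wy) (solve 1 (λ U → con 1ℚ :* U := U) ≋-refl U)) (⊗-congʳ (≋-sym ι-ratio)) ⟩
            U ⊝ ι (w * (a - d * b)) ⊗ F
              ∎
            where
            T = S (suc n) (suc K)
            U = S (2 ℕ.+ n) K

      module _ (den : CommonDenominator κ w s) where
        open CommonDenominator den

        -- The recurrence has order two, so the induction carries two neighbours.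
        int-ratio : ∀ n → IsInteger (δ ^ℚ n * ratio n) × IsInteger (δ ^ℚ suc n * ratio (suc n))
        int-ratio zero    = int-ℕ 1 , subst IsInteger (cong (_* κ) (sym (ℚ.*-identityʳ δ))) int-δκ
        int-ratio (suc n) with int-ratio n
        ... | int-a , int-b = int-b , subst IsInteger
          (solve 7 (λ δ w s m p a b →
             δ :* (δ :* w) :* (p :* a) :+ :- ((δ :* w :* s :+ δ :* w :* (m :+ con 1ℚ)) :* (δ :* p :* b)) :=
             δ :* (δ :* p) :* (w :* (a :- (s :+ m :+ con 1ℚ) :* b))) refl
             δ w s (ℕ→ℚ n) (δ ^ℚ n) (ratio n) (ratio (suc n)))
          (int-+ (int-* (int-* int-δ int-δw) int-a)
            (int-neg (int-* (int-+ int-δws (int-* int-δw (int-+ (int-ℕ n) (int-ℕ 1)))) int-b)))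
          where open +-*-Solver

        scaled≢0 : ∀ n → ratio n ≢ 0ℚ → δ ^ℚ n * ratio n ≢ 0ℚ
        scaled≢0 n r≢0 N≡0 =
          let ρ , _ , δⁿρ≡1 = inverse⁺ (0<^ℚ n 0<δ)
          in r≢0 (begin
            ratio n                          ≡⟨ ℚ.*-identityˡ (ratio n) ⟨
            1ℚ * ratio n                     ≡⟨ cong (_* ratio n) δⁿρ≡1 ⟨
            δ ^ℚ n * ρ * ratio n             ≡⟨ solve 3 (λ a b c → a :* b :* c := b :* (a :* c)) refl (δ ^ℚ n) ρ (ratio n) ⟩
            ρ * (δ ^ℚ n * ratio n)           ≡⟨ cong (ρ *_) N≡0 ⟩
            ρ * 0ℚ                           ≡⟨ ℚ.*-zeroʳ ρ ⟩
            0ℚ                               ∎)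
          where
          open ≡-Reasoning
          open +-*-Solver

        -- Non-zero integers have absolute value at least 1, so F inherits the
        -- bound on δⁿ ratio n F.
        Bd-limit : ∀ {F ε C} n m → δ ^ℚ n * ratio n * m ≡ 1ℚ → 0ℚ ≤ C → ratio n ≢ 0ℚ → δ * ε ≡ ½ →
                   Bd (ι (ratio n) ⊗ F) (C * ε ^ℚ n) → Bd F (C * ½ ^ℚ n)
        Bd-limit {F} {ε} {C} n m Nm≡1 0≤C r≢0 δε≡½ r≤ = Bd-resp F≋ (Bd-mono ≤½ⁿ (Bd-scale m (Bd-scale (δ ^ℚ n) r≤)))
          where
          N = δ ^ℚ n * ratio n
          F≋ : ι m ⊗ (ι (δ ^ℚ n) ⊗ (ι (ratio n) ⊗ F)) ≋ F
          F≋ = begin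
            ι m ⊗ (ι (δ ^ℚ n) ⊗ (ι (ratio n) ⊗ F))      ≈⟨ solve 4 (λ m a b F → m :* (a :* (b :* F)) := a :* b :* m :* F) ≋-refl
                                                             (ι m) (ι (δ ^ℚ n)) (ι (ratio n)) F ⟩
            ι (δ ^ℚ n) ⊗ ι (ratio n) ⊗ ι m ⊗ F          ≈⟨ ⊗-congʳ (≋-trans (ι-* N m) (⊗-congʳ (ι-* (δ ^ℚ n) (ratio n)))) ⟨
            ι (N * m) ⊗ F                               ≈⟨ ⊗-congʳ (ι-cong Nm≡1) ⟩
            ι 1ℚ ⊗ F                                    ≈⟨ solve 1 (λ F → con 1ℚ :* F := F) ≋-refl F ⟩
            F                                           ∎
            where
            open SetoidReasoning setoid
            open ≋-Solver
          ∣m∣≤1 : ∣ m ∣ ≤ 1ℚ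
          ∣m∣≤1 = begin
            ∣ m ∣              ≡⟨ ℚ.*-identityˡ ∣ m ∣ ⟨
            1ℚ * ∣ m ∣         ≤⟨ *-monoʳ-≤ (ℚ.0≤∣p∣ m) (int≢0⇒1≤∣∣ (proj₁ (int-ratio n)) (scaled≢0 n r≢0)) ⟩
            ∣ N ∣ * ∣ m ∣      ≡⟨ ℚ.∣p*q∣≡∣p∣*∣q∣ N m ⟨
            ∣ N * m ∣          ≡⟨ cong ∣_∣ Nm≡1 ⟩
            1ℚ                 ∎
            where open ℚ.≤-Reasoning
          0≤½ⁿC : 0ℚ ≤ C * ½ ^ℚ n
          0≤½ⁿC = 0≤* 0≤C (0≤^ℚ n 0<½)
          ≤½ⁿ : ∣ m ∣ * (∣ δ ^ℚ n ∣ * (C * ε ^ℚ n)) ≤ C * ½ ^ℚ n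
          ≤½ⁿ = begin
            ∣ m ∣ * (∣ δ ^ℚ n ∣ * (C * ε ^ℚ n))       ≡⟨ cong (λ x → ∣ m ∣ * (x * (C * ε ^ℚ n))) (ℚ.0≤p⇒∣p∣≡p (0≤^ℚ n 0<δ)) ⟩
            ∣ m ∣ * (δ ^ℚ n * (C * ε ^ℚ n))           ≡⟨ cong (∣ m ∣ *_) (solve 3 (λ a C b → a :* (C :* b) := C :* (a :* b)) refl (δ ^ℚ n) C (ε ^ℚ n)) ⟩
            ∣ m ∣ * (C * (δ ^ℚ n * ε ^ℚ n))           ≡⟨ cong (λ x → ∣ m ∣ * (C * x)) (trans (sym (^ℚ-*-commute δ ε n)) (cong (_^ℚ n) δε≡½)) ⟩
            ∣ m ∣ * (C * ½ ^ℚ n)                      ≤⟨ *-monoʳ-≤ 0≤½ⁿC ∣m∣≤1 ⟩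
            1ℚ * (C * ½ ^ℚ n)                         ≡⟨ ℚ.*-identityˡ (C * ½ ^ℚ n) ⟩
            C * ½ ^ℚ n                                ∎
            where
            open ℚ.≤-Reasoning
            open +-*-Solver

        -- A vanishing `ratio n` gives no information, but then `ratio (n + 1)` does not vanish, and
        -- the bound it yields is even smaller.
        Bd-limit-½ : ∀ {F ε C} → 0ℚ ≤ C → δ * ε ≡ ½ → (∀ n → Bd (ι (ratio n) ⊗ F) (C * ε ^ℚ n)) →
                     ∀ n → Dec (ratio n ≡ 0ℚ) → Bd F (C * ½ ^ℚ n)
        Bd-limit-½ 0≤C δε≡½ F≤ n (no r≢0) =
          let m , Nm≡1 = inverse (scaled≢0 n r≢0) in Bd-limit n m Nm≡1 0≤C r≢0 δε≡½ (F≤ n)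
        Bd-limit-½ 0≤C δε≡½ F≤ n (yes r≡0) =
          let m , Nm≡1 = inverse (scaled≢0 (suc n) (ratio≢0 n r≡0)) in
          Bd-mono (*-monoˡ-≤ 0≤C ½ⁿ⁺¹≤½ⁿ) (Bd-limit (suc n) m Nm≡1 0≤C (ratio≢0 n r≡0) δε≡½ (F≤ (suc n)))
          where
          ½ⁿ⁺¹≤½ⁿ : ½ * ½ ^ℚ n ≤ ½ ^ℚ n
          ½ⁿ⁺¹≤½ⁿ = subst (½ * ½ ^ℚ n ≤_) (½*p+½*p≡p (½ ^ℚ n)) (p≤p+q {½ * ½ ^ℚ n} (0≤* (ℚ.<⇒≤ 0<½) (0≤^ℚ n 0<½)))

        limit≋0′ : ∀ {F q C} → δ * q ≡ ½ → (∀ n K → Bd (S n K) (C * q ^ℚ n)) → (∀ n → S n ⇒ ι (ratio n) ⊗ F) → F ≋ ι 0ℚ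
        limit≋0′ {F} {q} {C} δq≡½ S≤ S⇒F = null-const⇒≋0 (λ ε 0<ε → let N , small = C*½^n-small C 0<ε in
            N , λ n N≤n → Bd-mono (small n N≤n) (Bd-limit-½ 0≤C δq≡½ limit≤ n (ratio n ℚ.≟ 0ℚ)))
          where
          limit≤ : ∀ n → Bd (ι (ratio n) ⊗ F) (C * q ^ℚ n)
          limit≤ n = Bd-lim (S≤ n) (S⇒F n)
          0≤C : 0ℚ ≤ C
          0≤C = subst (0ℚ ≤_) (ℚ.*-identityʳ C) (Bd-nonneg (limit≤ 0))

        -- A positive integer `δ` is at least 1, so `q ≤ δ q = ½`.
        δq≡½⇒q≤1 : ∀ {q} → 0ℚ < q → δ * q ≡ ½ → q ≤ 1ℚ
        δq≡½⇒q≤1 {q} 0<q δq≡½ = begin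
          q          ≡⟨ ℚ.*-identityˡ q ⟨
          1ℚ * q     ≤⟨ *-monoʳ-≤ (ℚ.<⇒≤ 0<q) (subst (1ℚ ≤_) (ℚ.0≤p⇒∣p∣≡p (ℚ.<⇒≤ 0<δ))
                          (int≢0⇒1≤∣∣ int-δ (λ δ≡0 → ℚ.<⇒≢ 0<δ (sym δ≡0)))) ⟩
          δ * q      ≡⟨ δq≡½ ⟩
          ½          ≤⟨ p≤p+q {½} (ℚ.<⇒≤ 0<½) ⟩
          1ℚ         ∎
          where open ℚ.≤-Reasoning

        limit≋0 : ∀ {F} → (∀ n → S n ⇒ ι (ratio n) ⊗ F) → F ≋ ι 0ℚ
        limit≋0 S⇒F =
          -- The decay rate `q = 1/(2δ)` outweighs the growth `δⁿ` of the denominators and leaves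
          -- `(δ q)ⁿ = ½ⁿ`.
          let ρ , 0<ρ , δρ≡1 = inverse⁺ 0<δ
              0<q = 0<* 0<½ 0<ρ
              δq≡½ = trans (solve 2 (λ δ ρ → δ :* (con ½ :* ρ) := con ½ :* (δ :* ρ)) refl δ ρ) (cong (½ *_) δρ≡1)
              C , S≤ = S-rapid (½ * ρ) 0<q (δq≡½⇒q≤1 0<q δq≡½)
          in limit≋0′ {C = C} δq≡½ S≤ S⇒F
          where open +-*-Solver

    bessel-irrational : ∀ {F κ} → y ≢ 0ℚ → S 0 ⇒ F → S 1 ⇒ ι κ ⊗ F → F ≋ ι 0ℚ
    bessel-irrational {F} {κ} y≢0 S₀⇒ S₁⇒ =
      let w , yw≡1 = inverse y≢0
      in limit≋0 yw≡1 κ (commonDenominator κ w s) (S⇒ yw≡1 κ S₀⇒ S₁⇒)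

-- Complex numbers as a normed ring

-- The 1-norm is rational on rational approximations and still submultiplicative; the modulus would
-- bring in square roots.
norm : ℂ → ℕ → ℚ
norm z n = ∣ seq (re z) n ∣ + ∣ seq (im z) n ∣

-- The 1-norm of z is at most p.
record Bdᶜ (z : ℂ) (p : ℚ) : Set where
  constructor bdᶜ
  field
    within : ∀ ε → 0ℚ < ε → ∃[ N ] ∀ n → N ℕ.≤ n → norm z n < p + ε

open Bdᶜ

infix 4 _≐_

-- The ring laws hold even term by term between the approximating sequences, where they are
-- identities of rationals within reach of the solver.
_≐_ : ℂ → ℂ → Set
z ≐ w = (∀ n → seq (re z) n ≡ seq (re w) n) × (∀ n → seq (im z) n ≡ seq (im w) n)

-ᶜ_ : ℂ → ℂ
-ᶜ z = (-ᴿ re z) +i (-ᴿ im z)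

infixl 6 _-ᶜ_

_-ᶜ_ : ℂ → ℂ → ℂ
z -ᶜ w = z +ᶜ -ᶜ w

abstract

  0≤norm : ∀ z n → 0ℚ ≤ norm z n
  0≤norm z n = 0≤+ (ℚ.0≤∣p∣ (seq (re z) n)) (ℚ.0≤∣p∣ (seq (im z) n))

  norm-+ : ∀ z w n → norm (z +ᶜ w) n ≤ norm z n + norm w n
  norm-+ z w n = begin
    ∣ a + c ∣ + ∣ b + d ∣                      ≤⟨ ℚ.+-mono-≤ (ℚ.∣p+q∣≤∣p∣+∣q∣ a c) (ℚ.∣p+q∣≤∣p∣+∣q∣ b d) ⟩
    (∣ a ∣ + ∣ c ∣) + (∣ b ∣ + ∣ d ∣)          ≡⟨ solve 4 (λ a b c d → a :+ c :+ (b :+ d) := a :+ b :+ (c :+ d)) refl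
                                                    (∣ a ∣) (∣ b ∣) (∣ c ∣) (∣ d ∣) ⟩
    (∣ a ∣ + ∣ b ∣) + (∣ c ∣ + ∣ d ∣)          ∎
    where
    open ℚ.≤-Reasoning
    open +-*-Solver
    a b c d : ℚ
    a = seq (re z) n
    b = seq (im z) n
    c = seq (re w) n
    d = seq (im w) n

  norm-* : ∀ z w n → norm (z *ᶜ w) n ≤ norm z n * norm w n
  norm-* z w n = begin
    ∣ a * c - b * d ∣ + ∣ a * d + b * c ∣
      ≤⟨ ℚ.+-mono-≤ (ℚ.∣p-q∣≤∣p∣+∣q∣ (a * c) (b * d)) (ℚ.∣p+q∣≤∣p∣+∣q∣ (a * d) (b * c)) ⟩
    (∣ a * c ∣ + ∣ b * d ∣) + (∣ a * d ∣ + ∣ b * c ∣)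
      ≡⟨ cong₂ _+_ (cong₂ _+_ (ℚ.∣p*q∣≡∣p∣*∣q∣ a c) (ℚ.∣p*q∣≡∣p∣*∣q∣ b d))
                   (cong₂ _+_ (ℚ.∣p*q∣≡∣p∣*∣q∣ a d) (ℚ.∣p*q∣≡∣p∣*∣q∣ b c)) ⟩
    (∣ a ∣ * ∣ c ∣ + ∣ b ∣ * ∣ d ∣) + (∣ a ∣ * ∣ d ∣ + ∣ b ∣ * ∣ c ∣)
      ≡⟨ solve 4 (λ a b c d → a :* c :+ b :* d :+ (a :* d :+ b :* c) := (a :+ b) :* (c :+ d)) refl
           (∣ a ∣) (∣ b ∣) (∣ c ∣) (∣ d ∣) ⟩
    (∣ a ∣ + ∣ b ∣) * (∣ c ∣ + ∣ d ∣)
      ∎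
    where
    open ℚ.≤-Reasoning
    open +-*-Solver
    a b c d : ℚ
    a = seq (re z) n
    b = seq (im z) n
    c = seq (re w) n
    d = seq (im w) n

  norm-neg : ∀ z n → norm (-ᶜ z) n ≡ norm z n
  norm-neg z n = cong₂ _+_ (ℚ.∣-p∣≡∣p∣ (seq (re z) n)) (ℚ.∣-p∣≡∣p∣ (seq (im z) n))

  Bdᶜ-≐ : ∀ {z w p} → z ≐ w → Bdᶜ z p → Bdᶜ w p
  Bdᶜ-≐ {z} {w} {p} (re≐ , im≐) z≤p = bdᶜ λ ε 0<ε → let N , z< = within z≤p ε 0<ε in
    N , λ n N≤n → subst (_< p + ε) (cong₂ (λ a b → ∣ a ∣ + ∣ b ∣) (re≐ n) (im≐ n)) (z< n N≤n)

  Bdᶜ-+ : ∀ {z w p q} → Bdᶜ z p → Bdᶜ w q → Bdᶜ (z +ᶜ w) (p + q)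
  Bdᶜ-+ {z} {w} {p} {q} z≤p w≤q = bdᶜ λ ε 0<ε →
    let M , z< = within z≤p (½ * ε) (0<* 0<½ 0<ε)
        N , w< = within w≤q (½ * ε) (0<* 0<½ 0<ε)
        eq = solve 3 (λ p q ε → p :+ con ½ :* ε :+ (q :+ con ½ :* ε) := p :+ q :+ ε) refl p q ε
    in M ℕ.⊔ N , λ n MN≤n → ℚ.≤-<-trans (norm-+ z w n)
         (subst (norm z n + norm w n <_) eq
           (ℚ.+-mono-< (z< n (ℕ.m⊔n≤o⇒m≤o M N MN≤n)) (w< n (ℕ.m⊔n≤o⇒n≤o M N MN≤n))))
    where open +-*-Solver

  Bdᶜ-neg : ∀ {z p} → Bdᶜ z p → Bdᶜ (-ᶜ z) p
  Bdᶜ-neg {z} {p} z≤p = bdᶜ λ ε 0<ε → let N , z< = within z≤p ε 0<ε in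
    N , λ n N≤n → subst (_< p + ε) (sym (norm-neg z n)) (z< n N≤n)

  Bdᶜ-nonneg : ∀ {z p} → Bdᶜ z p → 0ℚ ≤ p
  Bdᶜ-nonneg {z} {p} z≤p = ℚ.≮⇒≥ λ p<0 →
    let N , z< = within z≤p (- p) (ℚ.neg-antimono-< p<0)
    in ℚ.<⇒≢ (ℚ.≤-<-trans (0≤norm z N) (z< N ℕ.≤-refl)) (sym (ℚ.+-inverseʳ p))

  Bdᶜ-* : ∀ {z w p q} → Bdᶜ z p → Bdᶜ w q → Bdᶜ (z *ᶜ w) (p * q)
  Bdᶜ-* {z} {w} {p} {q} z≤p w≤q = bdᶜ small
    where
    open +-*-Solver
    0≤p : 0ℚ ≤ p
    0≤p = Bdᶜ-nonneg z≤p
    0≤q : 0ℚ ≤ q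
    0≤q = Bdᶜ-nonneg w≤q
    small : ∀ ε → 0ℚ < ε → ∃[ N ] ∀ n → N ℕ.≤ n → norm (z *ᶜ w) n < p * q + ε
    -- Take `η = ε/T` with `T = p + q + 1 + ε`. The summand `ε` in `T` forces `η ≤ 1`, so that the
    -- error `η (p + q + η)` is at most `η T = ε`.
    small ε 0<ε with inverse⁺ {p + q + 1ℚ + ε} (ℚ.<-≤-trans 0<ε (p≤q+p (0≤+ (0≤+ 0≤p 0≤q) 0≤1)))
    ... | τ , 0<τ , Tτ≡1 =
      let M , z< = within z≤p η 0<η
          N , w< = within w≤q η 0<η
      in M ℕ.⊔ N , λ n MN≤n → bound (z< n (ℕ.m⊔n≤o⇒m≤o M N MN≤n)) (w< n (ℕ.m⊔n≤o⇒n≤o M N MN≤n))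
      where
      open ℚ.≤-Reasoning
      T η : ℚ
      T = p + q + 1ℚ + ε
      η = ε * τ
      0<η : 0ℚ < η
      0<η = 0<* 0<ε 0<τ
      0≤η : 0ℚ ≤ η
      0≤η = ℚ.<⇒≤ 0<η
      η≤1 : η ≤ 1ℚ
      η≤1 = ℚ.≤-trans (*-monoʳ-≤ (ℚ.<⇒≤ 0<τ) (p≤q+p (0≤+ (0≤+ 0≤p 0≤q) 0≤1))) (ℚ.≤-reflexive Tτ≡1)
      0<q+η : 0ℚ < q + η
      0<q+η = ℚ.<-≤-trans 0<η (p≤q+p 0≤q)
      bound : ∀ {n} → norm z n < p + η → norm w n < q + η → norm (z *ᶜ w) n < p * q + ε
      bound {n} z< w< = begin-strict
        norm (z *ᶜ w) n                ≤⟨ norm-* z w n ⟩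
        norm z n * norm w n            ≤⟨ *-monoˡ-≤ (0≤norm z n) (ℚ.<⇒≤ w<) ⟩
        norm z n * (q + η)             <⟨ ℚ.*-monoˡ-<-pos (q + η) {{positive 0<q+η}} z< ⟩
        (p + η) * (q + η)              ≡⟨ solve 3 (λ p q η → (p :+ η) :* (q :+ η) := p :* q :+ η :* (p :+ q :+ η)) refl p q η ⟩
        p * q + η * (p + q + η)        ≤⟨ ℚ.+-monoʳ-≤ (p * q) (*-monoˡ-≤ 0≤η (ℚ.≤-trans (ℚ.+-monoʳ-≤ (p + q) η≤1) (p≤p+q (ℚ.<⇒≤ 0<ε)))) ⟩
        p * q + η * T                  ≡⟨ cong (λ x → p * q + x) (solve 3 (λ ε τ T → ε :* τ :* T := ε :* (T :* τ)) refl ε τ T) ⟩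
        p * q + ε * (T * τ)            ≡⟨ cong (λ x → p * q + ε * x) Tτ≡1 ⟩
        p * q + ε * 1ℚ                 ≡⟨ cong (λ x → p * q + x) (ℚ.*-identityʳ ε) ⟩
        p * q + ε                      ∎

  Bdᶜ-mono : ∀ {z p q} → p ≤ q → Bdᶜ z p → Bdᶜ z q
  Bdᶜ-mono p≤q z≤p = bdᶜ λ ε 0<ε → let N , z< = within z≤p ε 0<ε in
    N , λ n N≤n → ℚ.<-≤-trans (z< n N≤n) (ℚ.+-monoˡ-≤ ε p≤q)

  Bdᶜ-closed : ∀ {z p} → (∀ ε → 0ℚ < ε → Bdᶜ z (p + ε)) → Bdᶜ z p
  Bdᶜ-closed {z} {p} z≤ = bdᶜ λ ε 0<ε →
    let 0<½ε = 0<* 0<½ 0<ε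
        N , z< = within (z≤ (½ * ε) 0<½ε) (½ * ε) 0<½ε
    in N , λ n N≤n → subst (norm z n <_) (trans (ℚ.+-assoc p (½ * ε) (½ * ε)) (cong (λ x → p + x) (½*p+½*p≡p ε))) (z< n N≤n)

  Bdᶜ-ℚ : ∀ q → Bdᶜ (ℚ→ℂ q) ∣ q ∣
  Bdᶜ-ℚ q = bdᶜ λ ε 0<ε → 0 , λ n _ → ℚ.+-monoʳ-< ∣ q ∣ 0<ε

  cauchy-bounded : ∀ x → ∃[ B ] ∃[ N ] ∀ n → N ℕ.≤ n → ∣ seq x n ∣ ≤ B
  cauchy-bounded x =
    let N , x< = cauchy x 1ℚ 0<1
    in 1ℚ + ∣ seq x N ∣ , N , λ n N≤n → begin
         ∣ seq x n ∣                            ≡⟨ cong ∣_∣ (solve 2 (λ a b → a := a :- b :+ b) refl (seq x n) (seq x N)) ⟩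
         ∣ (seq x n - seq x N) + seq x N ∣      ≤⟨ ℚ.∣p+q∣≤∣p∣+∣q∣ (seq x n - seq x N) (seq x N) ⟩
         ∣ seq x n - seq x N ∣ + ∣ seq x N ∣    ≤⟨ ℚ.+-monoˡ-≤ ∣ seq x N ∣ (ℚ.<⇒≤ (x< n N N≤n ℕ.≤-refl)) ⟩
         1ℚ + ∣ seq x N ∣                       ∎
    where
    open ℚ.≤-Reasoning
    open +-*-Solver

  Bdᶜ-exists : ∀ z → ∃[ p ] Bdᶜ z p
  Bdᶜ-exists z =
    let A , M , re≤ = cauchy-bounded (re z)
        B , N , im≤ = cauchy-bounded (im z)
    in A + B , bdᶜ λ ε 0<ε → M ℕ.⊔ N , λ n MN≤n →
         ℚ.≤-<-trans (ℚ.+-mono-≤ (re≤ n (ℕ.m⊔n≤o⇒m≤o M N MN≤n)) (im≤ n (ℕ.m⊔n≤o⇒n≤o M N MN≤n)))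
           (subst (_< A + B + ε) (ℚ.+-identityʳ (A + B)) (ℚ.+-monoʳ-< (A + B) 0<ε))

  Bdᶜ-zero : ∀ {z w} → Bdᶜ (z -ᶜ w) 0ℚ → z ≈ w
  Bdᶜ-zero {z} {w} z-w≤0 = mk≈ᴿ (λ ε 0<ε → let N , < = within z-w≤0 ε 0<ε in N , λ n N≤n →
                               ℚ.≤-<-trans (p≤p+q (ℚ.0≤∣p∣ (seq (im (z -ᶜ w)) n))) (subst (norm (z -ᶜ w) n <_) (ℚ.+-identityˡ ε) (< n N≤n)))
                         , mk≈ᴿ (λ ε 0<ε → let N , < = within z-w≤0 ε 0<ε in N , λ n N≤n →
                               ℚ.≤-<-trans (p≤q+p (ℚ.0≤∣p∣ (seq (re (z -ᶜ w)) n))) (subst (norm (z -ᶜ w) n <_) (ℚ.+-identityˡ ε) (< n N≤n)))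

  -- With `Bdᶜ-zero` this turns `≈` into a norm bound 0 on the difference, so each congruence below
  -- reduces to the laws of `Bdᶜ` and a termwise identity.
  ≈⇒Bdᶜ : ∀ {z w} → z ≈ w → Bdᶜ (z -ᶜ w) 0ℚ
  ≈⇒Bdᶜ {z} {w} (mk≈ᴿ re≈ , mk≈ᴿ im≈) = bdᶜ λ ε 0<ε →
    let M , re< = re≈ (½ * ε) (0<* 0<½ 0<ε)
        N , im< = im≈ (½ * ε) (0<* 0<½ 0<ε)
    in M ℕ.⊔ N , λ n MN≤n → subst (norm (z -ᶜ w) n <_) (trans (½*p+½*p≡p ε) (sym (ℚ.+-identityˡ ε)))
         (ℚ.+-mono-< (re< n (ℕ.m⊔n≤o⇒m≤o M N MN≤n)) (im< n (ℕ.m⊔n≤o⇒n≤o M N MN≤n)))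

  ≐⇒≈ : ∀ {z w} → z ≐ w → z ≈ w
  ≐⇒≈ {z} {w} (re≐ , im≐) = Bdᶜ-zero (Bdᶜ-≐ {0ℂ}
    ((λ n → trans (sym (ℚ.+-inverseʳ (seq (re z) n))) (cong (λ x → seq (re z) n - x) (re≐ n))) ,
     (λ n → trans (sym (ℚ.+-inverseʳ (seq (im z) n))) (cong (λ x → seq (im z) n - x) (im≐ n))))
    (Bdᶜ-ℚ 0ℚ))

  ≈-refl : ∀ {z} → z ≈ z
  ≈-refl = ≐⇒≈ ((λ _ → refl) , (λ _ → refl))

  ≈-sym : ∀ {z w} → z ≈ w → w ≈ z
  ≈-sym {z} {w} z≈w = Bdᶜ-zero (Bdᶜ-≐ ((λ n → flip (seq (re z) n) (seq (re w) n)) , (λ n → flip (seq (im z) n) (seq (im w) n)))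
                        (Bdᶜ-neg (≈⇒Bdᶜ z≈w)))
    where
    open +-*-Solver
    flip : ∀ a b → - (a - b) ≡ b - a
    flip = solve 2 (λ a b → :- (a :- b) := b :- a) refl

  ≈-trans : ∀ {z w v} → z ≈ w → w ≈ v → z ≈ v
  ≈-trans {z} {w} {v} z≈w w≈v = Bdᶜ-zero (Bdᶜ-≐
    ((λ n → chain (seq (re z) n) (seq (re w) n) (seq (re v) n)) , (λ n → chain (seq (im z) n) (seq (im w) n) (seq (im v) n)))
    (Bdᶜ-+ (≈⇒Bdᶜ z≈w) (≈⇒Bdᶜ w≈v)))
    where
    open +-*-Solver
    chain : ∀ a b c → (a - b) + (b - c) ≡ a - c
    chain = solve 3 (λ a b c → a :- b :+ (b :- c) := a :- c) refl

  +ᶜ-cong : ∀ {z z′ w w′} → z ≈ z′ → w ≈ w′ → z +ᶜ w ≈ z′ +ᶜ w′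
  +ᶜ-cong {z} {z′} {w} {w′} z≈z′ w≈w′ = Bdᶜ-zero (Bdᶜ-≐
    ((λ n → swap (seq (re z) n) (seq (re z′) n) (seq (re w) n) (seq (re w′) n)) ,
     (λ n → swap (seq (im z) n) (seq (im z′) n) (seq (im w) n) (seq (im w′) n)))
    (Bdᶜ-+ (≈⇒Bdᶜ z≈z′) (≈⇒Bdᶜ w≈w′)))
    where
    open +-*-Solver
    swap : ∀ a a′ b b′ → (a - a′) + (b - b′) ≡ (a + b) - (a′ + b′)
    swap = solve 4 (λ a a′ b b′ → a :- a′ :+ (b :- b′) := a :+ b :- (a′ :+ b′)) refl

  -ᶜ-cong : ∀ {z w} → z ≈ w → -ᶜ z ≈ -ᶜ w
  -ᶜ-cong {z} {w} z≈w = Bdᶜ-zero (Bdᶜ-≐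
    ((λ n → ℚ.neg-distrib-+ (seq (re z) n) (- seq (re w) n)) , (λ n → ℚ.neg-distrib-+ (seq (im z) n) (- seq (im w) n)))
    (Bdᶜ-neg (≈⇒Bdᶜ z≈w)))

  -- `z w - z′ w′ = z (w - w′) + (z - z′) w′`, and each summand is a bounded number times one of
  -- norm 0.
  *ᶜ-cong : ∀ {z z′ w w′} → z ≈ z′ → w ≈ w′ → z *ᶜ w ≈ z′ *ᶜ w′
  *ᶜ-cong {z} {z′} {w} {w′} z≈z′ w≈w′ =
    let p , z≤p  = Bdᶜ-exists z
        q , w′≤q = Bdᶜ-exists w′
    in Bdᶜ-zero (Bdᶜ-≐
      ((λ n → solve 8 (λ a b a′ b′ c d c′ d′ →
          a :* (c :- c′) :- b :* (d :- d′) :+ ((a :- a′) :* c′ :- (b :- b′) :* d′) := a :* c :- b :* d :- (a′ :* c′ :- b′ :* d′)) refl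
          (seq (re z) n) (seq (im z) n) (seq (re z′) n) (seq (im z′) n) (seq (re w) n) (seq (im w) n) (seq (re w′) n) (seq (im w′) n)) ,
       (λ n → solve 8 (λ a b a′ b′ c d c′ d′ →
          a :* (d :- d′) :+ b :* (c :- c′) :+ ((a :- a′) :* d′ :+ (b :- b′) :* c′) := a :* d :+ b :* c :- (a′ :* d′ :+ b′ :* c′)) refl
          (seq (re z) n) (seq (im z) n) (seq (re z′) n) (seq (im z′) n) (seq (re w) n) (seq (im w) n) (seq (re w′) n) (seq (im w′) n)))
      (Bdᶜ-mono (ℚ.≤-reflexive (solve 2 (λ p q → p :* con 0ℚ :+ con 0ℚ :* q := con 0ℚ) refl p q))
        (Bdᶜ-+ (Bdᶜ-* z≤p (≈⇒Bdᶜ w≈w′)) (Bdᶜ-* (≈⇒Bdᶜ z≈z′) w′≤q))))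
    where open +-*-Solver

  +ᶜ-assoc : ∀ z w v → (z +ᶜ w) +ᶜ v ≈ z +ᶜ (w +ᶜ v)
  +ᶜ-assoc z w v = ≐⇒≈ ((λ n → ℚ.+-assoc (seq (re z) n) (seq (re w) n) (seq (re v) n)) ,
                        (λ n → ℚ.+-assoc (seq (im z) n) (seq (im w) n) (seq (im v) n)))

  +ᶜ-comm : ∀ z w → z +ᶜ w ≈ w +ᶜ z
  +ᶜ-comm z w = ≐⇒≈ ((λ n → ℚ.+-comm (seq (re z) n) (seq (re w) n)) , (λ n → ℚ.+-comm (seq (im z) n) (seq (im w) n)))

  +ᶜ-identityˡ : ∀ z → 0ℂ +ᶜ z ≈ z
  +ᶜ-identityˡ z = ≐⇒≈ ((λ n → ℚ.+-identityˡ (seq (re z) n)) , (λ n → ℚ.+-identityˡ (seq (im z) n)))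

  +ᶜ-inverseˡ : ∀ z → (-ᶜ z) +ᶜ z ≈ 0ℂ
  +ᶜ-inverseˡ z = ≐⇒≈ ((λ n → ℚ.+-inverseˡ (seq (re z) n)) , (λ n → ℚ.+-inverseˡ (seq (im z) n)))

  *ᶜ-assoc : ∀ z w v → (z *ᶜ w) *ᶜ v ≈ z *ᶜ (w *ᶜ v)
  *ᶜ-assoc z w v = ≐⇒≈
    ((λ n → solve 6 (λ a b c d e f → (a :* c :- b :* d) :* e :- (a :* d :+ b :* c) :* f :=
       a :* (c :* e :- d :* f) :- b :* (c :* f :+ d :* e)) refl
       (seq (re z) n) (seq (im z) n) (seq (re w) n) (seq (im w) n) (seq (re v) n) (seq (im v) n)) ,
     (λ n → solve 6 (λ a b c d e f → (a :* c :- b :* d) :* f :+ (a :* d :+ b :* c) :* e :=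
       a :* (c :* f :+ d :* e) :+ b :* (c :* e :- d :* f)) refl
       (seq (re z) n) (seq (im z) n) (seq (re w) n) (seq (im w) n) (seq (re v) n) (seq (im v) n)))
    where open +-*-Solver

  *ᶜ-comm : ∀ z w → z *ᶜ w ≈ w *ᶜ z
  *ᶜ-comm z w = ≐⇒≈
    ((λ n → solve 4 (λ a b c d → a :* c :- b :* d := c :* a :- d :* b) refl
       (seq (re z) n) (seq (im z) n) (seq (re w) n) (seq (im w) n)) ,
     (λ n → solve 4 (λ a b c d → a :* d :+ b :* c := c :* b :+ d :* a) refl
       (seq (re z) n) (seq (im z) n) (seq (re w) n) (seq (im w) n)))
    where open +-*-Solver

  *ᶜ-identityˡ : ∀ z → 1ℂ *ᶜ z ≈ z
  *ᶜ-identityˡ z = ≐⇒≈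
    ((λ n → solve 2 (λ a b → con 1ℚ :* a :- con 0ℚ :* b := a) refl (seq (re z) n) (seq (im z) n)) ,
     (λ n → solve 2 (λ a b → con 1ℚ :* b :+ con 0ℚ :* a := b) refl (seq (re z) n) (seq (im z) n)))
    where open +-*-Solver

  *ᶜ-distribˡ-+ᶜ : ∀ z w v → z *ᶜ (w +ᶜ v) ≈ z *ᶜ w +ᶜ z *ᶜ v
  *ᶜ-distribˡ-+ᶜ z w v = ≐⇒≈
    ((λ n → solve 6 (λ a b c d e f → a :* (c :+ e) :- b :* (d :+ f) := a :* c :- b :* d :+ (a :* e :- b :* f)) refl
       (seq (re z) n) (seq (im z) n) (seq (re w) n) (seq (im w) n) (seq (re v) n) (seq (im v) n)) ,
     (λ n → solve 6 (λ a b c d e f → a :* (d :+ f) :+ b :* (c :+ e) := a :* d :+ b :* c :+ (a :* f :+ b :* e)) refl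
       (seq (re z) n) (seq (im z) n) (seq (re w) n) (seq (im w) n) (seq (re v) n) (seq (im v) n)))
    where open +-*-Solver

  +ᶜ-*ᶜ-isCommutativeRing : IsCommutativeRing _≈_ _+ᶜ_ _*ᶜ_ -ᶜ_ 0ℂ 1ℂ
  +ᶜ-*ᶜ-isCommutativeRing = record
    { isRing = record
      { +-isAbelianGroup = record
        { isGroup = record
          { isMonoid = record
            { isSemigroup = record
              { isMagma = record
                { isEquivalence = record { refl = ≈-refl ; sym = ≈-sym ; trans = ≈-trans }
                ; ∙-cong = +ᶜ-cong }
              ; assoc = +ᶜ-assoc }
            ; identity = +ᶜ-identityˡ , λ z → ≈-trans (+ᶜ-comm z 0ℂ) (+ᶜ-identityˡ z) }
          ; inverse = +ᶜ-inverseˡ , λ z → ≈-trans (+ᶜ-comm z (-ᶜ z)) (+ᶜ-inverseˡ z)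
          ; ⁻¹-cong = -ᶜ-cong }
        ; comm = +ᶜ-comm }
      ; *-cong = *ᶜ-cong
      ; *-assoc = *ᶜ-assoc
      ; *-identity = *ᶜ-identityˡ , λ z → ≈-trans (*ᶜ-comm z 1ℂ) (*ᶜ-identityˡ z)
      ; distrib = *ᶜ-distribˡ-+ᶜ , λ z w v →
          ≈-trans (*ᶜ-comm (w +ᶜ v) z) (≈-trans (*ᶜ-distribˡ-+ᶜ z w v) (+ᶜ-cong (*ᶜ-comm z w) (*ᶜ-comm z v))) }
    ; *-comm = *ᶜ-comm }

  ℚ→ℂ-+ : ∀ p q → ℚ→ℂ (p + q) ≈ ℚ→ℂ p +ᶜ ℚ→ℂ q
  ℚ→ℂ-+ p q = ≐⇒≈ ((λ _ → refl) , (λ _ → refl))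

  ℚ→ℂ-* : ∀ p q → ℚ→ℂ (p * q) ≈ ℚ→ℂ p *ᶜ ℚ→ℂ q
  ℚ→ℂ-* p q = ≐⇒≈ ((λ _ → solve 2 (λ p q → p :* q := p :* q :- con 0ℚ :* con 0ℚ) refl p q) ,
                   (λ _ → solve 2 (λ p q → con 0ℚ := p :* con 0ℚ :+ con 0ℚ :* q) refl p q))
    where open +-*-Solver

  ℚ→ℂ-neg : ∀ p → ℚ→ℂ (- p) ≈ -ᶜ ℚ→ℂ p
  ℚ→ℂ-neg p = ≐⇒≈ ((λ _ → refl) , (λ _ → refl))

  Bdᶜ-resp : ∀ {z w p} → z ≈ w → Bdᶜ z p → Bdᶜ w p
  Bdᶜ-resp {z} {w} {p} z≈w z≤p = Bdᶜ-mono (ℚ.≤-reflexive (ℚ.+-identityʳ p)) (Bdᶜ-≐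
    ((λ n → cancel (seq (re z) n) (seq (re w) n)) , (λ n → cancel (seq (im z) n) (seq (im w) n)))
    (Bdᶜ-+ z≤p (Bdᶜ-neg (≈⇒Bdᶜ z≈w))))
    where
    open +-*-Solver
    cancel : ∀ a b → a + - (a - b) ≡ b
    cancel = solve 2 (λ a b → a :+ :- (a :- b) := b) refl

  Bdᶜ-zero′ : ∀ {z} → Bdᶜ z 0ℚ → z ≈ 0ℂ
  Bdᶜ-zero′ {z} z≤0 = Bdᶜ-zero (Bdᶜ-≐ ((λ n → sym (ℚ.+-identityʳ (seq (re z) n))) , (λ n → sym (ℚ.+-identityʳ (seq (im z) n)))) z≤0)

ℂ-normedRing : NormedRing
ℂ-normedRing = record
  { commutativeRing = record { isCommutativeRing = +ᶜ-*ᶜ-isCommutativeRing }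
  ; ι = ℚ→ℂ
  ; ι-+ = ℚ→ℂ-+
  ; ι-* = ℚ→ℂ-*
  ; ι-neg = ℚ→ℂ-neg
  ; ι-zero = ≈-refl
  ; ι-one = ≈-refl
  ; Bd = Bdᶜ
  ; Bd-resp = Bdᶜ-resp
  ; Bd-mono = Bdᶜ-mono
  ; Bd-⊕ = Bdᶜ-+
  ; Bd-⊗ = Bdᶜ-*
  ; Bd-ι = Bdᶜ-ℚ
  ; Bd-nonneg = Bdᶜ-nonneg
  ; Bd-closed = Bdᶜ-closed
  ; Bd-zero = Bdᶜ-zero′
  ; Bd-exists = Bdᶜ-exists
  }

-- A real sequence that is only eventually non-negative is replaced by an
-- equal real with non-negative terms.
record NonNegᶜ (z : ℂ) : Set where
  constructor nonNegᶜ
  field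
    {representative} : ℝ
    equal   : z ≈ ℝ→ℂ representative
    0≤terms : ∀ n → 0ℚ ≤ seq representative n

abstract

  NonNegᶜ-Bdᶜ : ∀ {z p q} → NonNegᶜ (z -ᶜ ℚ→ℂ p) → Bdᶜ z q → p ≤ q
  NonNegᶜ-Bdᶜ {z} {p} {q} (nonNegᶜ {x} z-p≈x 0≤x) z≤q = ℚ.≮⇒≥ λ q<p →
    let N , x+p< = within x+p≤q (p - q) (subst (_< p - q) (ℚ.+-inverseʳ q) (ℚ.+-monoˡ-< (- q) q<p))
    in ℚ.<⇒≢ (ℚ.≤-<-trans (begin
      p                                     ≤⟨ p≤q+p (0≤x N) ⟩
      seq x N + p                           ≤⟨ p≤∣p∣ (seq x N + p) ⟩
      ∣ seq x N + p ∣                       ≤⟨ p≤p+q ℚ.≤-refl ⟩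
      norm (ℝ→ℂ x +ᶜ ℚ→ℂ p) N               ∎) (x+p< N ℕ.≤-refl))
      (solve 2 (λ p q → p := q :+ (p :- q)) refl p q)
    where
    open ℚ.≤-Reasoning
    open +-*-Solver
    x+p≤q : Bdᶜ (ℝ→ℂ x +ᶜ ℚ→ℂ p) q
    x+p≤q = Bdᶜ-resp (≈-trans (≐⇒≈
      ((λ n → solve 2 (λ z p → z := z :- p :+ p) refl (seq (re z) n) p) , (λ n → solve 1 (λ z → z := z :- con 0ℚ :+ con 0ℚ) refl (seq (im z) n))))
      (+ᶜ-cong z-p≈x (≈-refl {ℚ→ℂ p}))) z≤q

  NonNegᶜ-* : ∀ {z w} → NonNegᶜ z → NonNegᶜ w → NonNegᶜ (z *ᶜ w)
  NonNegᶜ-* (nonNegᶜ {x} z≈x 0≤x) (nonNegᶜ {y} w≈y 0≤y) = nonNegᶜ {representative = x *ᴿ y}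
    (≈-trans (*ᶜ-cong z≈x w≈y) (≐⇒≈
      ((λ n → solve 2 (λ x y → x :* y :- con 0ℚ :* con 0ℚ := x :* y) refl (seq x n) (seq y n)) ,
       (λ n → solve 2 (λ x y → x :* con 0ℚ :+ con 0ℚ :* y := con 0ℚ) refl (seq x n) (seq y n)))))
    (λ n → 0≤* (0≤x n) (0≤y n))
    where open +-*-Solver

  NonNegᶜ-+ : ∀ {z w} → NonNegᶜ z → NonNegᶜ w → NonNegᶜ (z +ᶜ w)
  NonNegᶜ-+ (nonNegᶜ {x} z≈x 0≤x) (nonNegᶜ {y} w≈y 0≤y) = nonNegᶜ {representative = x +ᴿ y}
    (≈-trans (+ᶜ-cong z≈x w≈y) (≐⇒≈ ((λ _ → refl) , (λ _ → refl))))
    (λ n → 0≤+ (0≤x n) (0≤y n))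

ℂ-cone : Cone ℂ-normedRing
ℂ-cone = record
  { NonNeg      = NonNegᶜ
  ; nonNeg-resp = λ { z≈w (nonNegᶜ z≈x 0≤x) → nonNegᶜ (≈-trans (≈-sym z≈w) z≈x) 0≤x }
  ; nonNeg-⊕    = NonNegᶜ-+
  ; nonNeg-⊗    = NonNegᶜ-*
  ; nonNeg-ι    = λ {q} 0≤q → nonNegᶜ {representative = ℚ→ℝ q} ≈-refl (λ _ → 0≤q)
  ; nonNeg-Bd   = NonNegᶜ-Bdᶜ
  }

-- The functional equation of Γ and the quotient of Bessel functions

p*q≢0 : ∀ {p q} → p ≢ 0ℚ → q ≢ 0ℚ → p * q ≢ 0ℚ
p*q≢0 {p} {q} p≢0 q≢0 pq≡0 =
  let κ , pκ≡1 = inverse p≢0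
  in q≢0 (begin
    q              ≡⟨ ℚ.*-identityˡ q ⟨
    1ℚ * q         ≡⟨ cong (_* q) pκ≡1 ⟨
    p * κ * q      ≡⟨ solve 3 (λ p κ q → p :* κ :* q := κ :* (p :* q)) refl p κ q ⟩
    κ * (p * q)    ≡⟨ cong (κ *_) pq≡0 ⟩
    κ * 0ℚ         ≡⟨ ℚ.*-zeroʳ κ ⟩
    0ℚ             ∎)
  where
  open ≡-Reasoning
  open +-*-Solver

rising≢0 : ∀ {z} → ¬ IsNonPositiveInteger z → ∀ n → rising z n ≢ 0ℚ
rising≢0 {z} z∉ zero    = λ ()
rising≢0 {z} z∉ (suc n) = p*q≢0 (rising≢0 z∉ n) λ z+n≡0 → z∉ (n , (begin
  z                        ≡⟨ solve 2 (λ z n → z := z :+ n :+ :- n) refl z (ℕ→ℚ n) ⟩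
  z + ℕ→ℚ n + - ℕ→ℚ n      ≡⟨ cong (_+ (- ℕ→ℚ n)) z+n≡0 ⟩
  0ℚ + - ℕ→ℚ n             ≡⟨ ℚ.+-identityˡ (- ℕ→ℚ n) ⟩
  - ℕ→ℚ n                  ∎))
  where
  open ≡-Reasoning
  open +-*-Solver

rising-suc : ∀ z n → rising z (suc n) ≡ z * rising (z + 1ℚ) n
rising-suc z zero    = solve 1 (λ z → con 1ℚ :* (z :+ con 0ℚ) := z :* con 1ℚ) refl z
  where open +-*-Solver
rising-suc z (suc n) = begin
  rising z (suc n) * (z + ℕ→ℚ (suc n))              ≡⟨ cong₂ (λ a b → a * (z + b)) (rising-suc z n) (ℕ→ℚ-suc n) ⟩
  z * rising (z + 1ℚ) n * (z + (ℕ→ℚ n + 1ℚ))        ≡⟨ solve 3 (λ z r n → z :* r :* (z :+ (n :+ con 1ℚ)) := z :* (r :* (z :+ con 1ℚ :+ n)))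
                                                        refl z (rising (z + 1ℚ) n) (ℕ→ℚ n) ⟩
  z * (rising (z + 1ℚ) n * (z + 1ℚ + ℕ→ℚ n))        ∎
  where
  open ≡-Reasoning
  open +-*-Solver

-- With `N = n + 1`, the product `N (1 + (z + 1)/N) = z + N + 1` is the next factor of the rising
-- factorial of `z`; taking out its first factor `z` leaves that of `z + 1`.
rising-ratio : ∀ z n → rising z (suc (suc n)) * ℕ→ℚ (suc n) * (1ℚ + (z + 1ℚ) * (+ 1 / suc n)) ≡
               z * rising (z + 1ℚ) (suc (suc n))
rising-ratio z n = begin
  R * m * (1ℚ + (z + 1ℚ) * ν)       ≡⟨ solve 4 (λ R m z ν → R :* m :* (con 1ℚ :+ (z :+ con 1ℚ) :* ν) :=
                                         R :* (m :+ (z :+ con 1ℚ) :* (m :* ν))) refl R m z ν ⟩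
  R * (m + (z + 1ℚ) * (m * ν))      ≡⟨ cong (λ x → R * (m + (z + 1ℚ) * x)) (recip-* (suc n)) ⟩
  R * (m + (z + 1ℚ) * 1ℚ)           ≡⟨ solve 3 (λ R m z → R :* (m :+ (z :+ con 1ℚ) :* con 1ℚ) := R :* (z :+ (m :+ con 1ℚ)))
                                         refl R m z ⟩
  R * (z + (m + 1ℚ))                ≡⟨ cong (λ x → R * (z + x)) (sym (ℕ→ℚ-suc (suc n))) ⟩
  rising z (suc (suc (suc n)))      ≡⟨ rising-suc z (suc (suc n)) ⟩
  z * rising (z + 1ℚ) (suc (suc n)) ∎
  where
  open ≡-Reasoning
  open +-*-Solver
  m = ℕ→ℚ (suc n)
  ν = + 1 / suc n
  R = rising z (suc (suc n))

neg-^ℚ : ∀ x k → (- x) ^ℚ k ≡ (-[1]^ k) * x ^ℚ k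
neg-^ℚ x zero    = refl
neg-^ℚ x (suc k) = trans (cong ((- x) *_) (neg-^ℚ x k))
  (solve 3 (λ x s a → :- x :* (s :* a) := :- s :* (x :* a)) refl x (-[1]^ k) (x ^ℚ k))
  where open +-*-Solver

neg-^ℚ-recip! : ∀ x k → (-[1]^ k) * recip! k * x ^ℚ k ≡ (- x) ^ℚ k * recip! k
neg-^ℚ-recip! x k =
  trans (solve 3 (λ σ r x → σ :* r :* x := σ :* x :* r) refl (-[1]^ k) (recip! k) (x ^ℚ k))
        (cong (_* recip! k) (sym (neg-^ℚ x k)))
  where open +-*-Solver

module GammaFunctionalEquation (A : NormedRing) where
  open NormedRing A
  open NullSequences A

  abstract
    null-1/n : ∀ c → Null (λ n → ι (c * (+ 1 / suc n)))
    null-1/n c ε 0<ε =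
      let κ , 0<κ , εκ≡1 = inverse⁺ 0<ε
          N , cκ≤N = archimedean (∣ c ∣ * κ)
      in N , λ n N≤n → Bd-mono (begin
        ∣ c * ν n ∣                        ≡⟨ ℚ.∣p*q∣≡∣p∣*∣q∣ c (ν n) ⟩
        ∣ c ∣ * ∣ ν n ∣                    ≡⟨ cong (∣ c ∣ *_) (ℚ.0≤p⇒∣p∣≡p (0≤ν n)) ⟩
        ∣ c ∣ * ν n                        ≡⟨ cong (_* ν n) (trans (sym (ℚ.*-identityʳ ∣ c ∣)) (cong (∣ c ∣ *_) (sym εκ≡1))) ⟩
        ∣ c ∣ * (ε * κ) * ν n              ≡⟨ solve 4 (λ c ε κ ν → c :* (ε :* κ) :* ν := ε :* ν :* (c :* κ)) refl (∣ c ∣) ε κ (ν n) ⟩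
        ε * ν n * (∣ c ∣ * κ)              ≤⟨ *-monoˡ-≤ (0≤* (ℚ.<⇒≤ 0<ε) (0≤ν n)) (ℚ.≤-trans cκ≤N (ℕ→ℚ-mono (ℕ.m≤n⇒m≤1+n N≤n))) ⟩
        ε * ν n * ℕ→ℚ (suc n)              ≡⟨ solve 3 (λ ε ν m → ε :* ν :* m := ε :* (m :* ν)) refl ε (ν n) (ℕ→ℚ (suc n)) ⟩
        ε * (ℕ→ℚ (suc n) * ν n)            ≡⟨ cong (ε *_) (recip-* (suc n)) ⟩
        ε * 1ℚ                             ≡⟨ ℚ.*-identityʳ ε ⟩
        ε                                  ∎) (Bd-ι (c * ν n))
      where
      open ℚ.≤-Reasoning
      open +-*-Solver
      ν : ℕ → ℚ
      ν n = + 1 / suc n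
      0≤ν : ∀ n → 0ℚ ≤ ν n
      0≤ν n = ℚ.nonNegative⁻¹ (ν n) {{ℚ.normalize-nonNeg 1 (suc n)}}

  module _ {z : ℚ} (z∉ : ¬ IsNonPositiveInteger z) where

    -- At a fixed `N`, Euler's approximants satisfy the functional equation up to the factor
    -- `1 + (z + 1)/N`. It is expanded on the left so that the correction is a separate summand
    -- tending to 0.
    approximant-suc : ∀ n {a a′ p p′} →
      a ⊗ ι (rising z (suc (suc n))) ≋ ι (ℕ→ℚ (suc n !)) ⊗ p →
      a′ ⊗ ι (rising (z + 1ℚ) (suc (suc n))) ≋ ι (ℕ→ℚ (suc n !)) ⊗ p′ →
      p′ ≋ ι (ℕ→ℚ (suc n)) ⊗ p →
      a′ ⊕ a′ ⊗ ι ((z + 1ℚ) * (+ 1 / suc n)) ≋ ι z ⊗ a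
    approximant-suc n {a} {a′} {p} {p′} a≋ a′≋ p′≋ = ι-cancel (p*q≢0 R≢0 (ℕ→ℚ-suc≢0 n)) (begin
      ι (R * m) ⊗ (a′ ⊕ a′ ⊗ ι ((z + 1ℚ) * ν))
        ≈⟨ ⊗-congˡ (≋-trans (solve 2 (λ a x → a :+ a :* x := a :* (con 1ℚ :+ x)) ≋-refl a′ (ι ((z + 1ℚ) * ν)))
             (⊗-congˡ (≋-sym (ι-+ 1ℚ ((z + 1ℚ) * ν))))) ⟩
      ι (R * m) ⊗ (a′ ⊗ ι (1ℚ + (z + 1ℚ) * ν))
        ≈⟨ solve 3 (λ x a y → x :* (a :* y) := a :* (x :* y)) ≋-refl (ι (R * m)) a′ (ι (1ℚ + (z + 1ℚ) * ν)) ⟩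
      a′ ⊗ (ι (R * m) ⊗ ι (1ℚ + (z + 1ℚ) * ν))
        ≈⟨ ⊗-congˡ (≋-trans (≋-sym (ι-* (R * m) (1ℚ + (z + 1ℚ) * ν))) (≋-trans (ι-cong (rising-ratio z n)) (ι-* z R′))) ⟩
      a′ ⊗ (ι z ⊗ ι R′)
        ≈⟨ solve 3 (λ a z r → a :* (z :* r) := z :* (a :* r)) ≋-refl a′ (ι z) (ι R′) ⟩
      ι z ⊗ (a′ ⊗ ι R′)
        ≈⟨ ⊗-congˡ (≋-trans a′≋ (⊗-congˡ p′≋)) ⟩
      ι z ⊗ (ι F ⊗ (ι m ⊗ p))
        ≈⟨ solve 4 (λ z f m p → z :* (f :* (m :* p)) := m :* z :* (f :* p)) ≋-refl (ι z) (ι F) (ι m) p ⟩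
      ι m ⊗ ι z ⊗ (ι F ⊗ p)
        ≈⟨ ⊗-congˡ a≋ ⟨
      ι m ⊗ ι z ⊗ (a ⊗ ι R)
        ≈⟨ solve 4 (λ m z a r → m :* z :* (a :* r) := r :* m :* (z :* a)) ≋-refl (ι m) (ι z) a (ι R) ⟩
      ι R ⊗ ι m ⊗ (ι z ⊗ a)
        ≈⟨ ⊗-congʳ (ι-* R m) ⟨
      ι (R * m) ⊗ (ι z ⊗ a)
        ∎)
      where
      open SetoidReasoning setoid
      open ≋-Solver
      m = ℕ→ℚ (suc n)
      ν = + 1 / suc n
      F = ℕ→ℚ (suc n !)
      R = rising z (suc (suc n))
      R′ = rising (z + 1ℚ) (suc (suc n))
      R≢0 = rising≢0 z∉ (suc (suc n))

    -- The correction is a convergent, hence eventually bounded, sequence times the null sequence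
    -- `(z + 1)/N`.
    Γ-suc : ∀ {a a′ γ γ′} →
            (∀ n → a′ n ⊕ a′ n ⊗ ι ((z + 1ℚ) * (+ 1 / suc n)) ≋ ι z ⊗ a n) →
            a ⇒ γ → a′ ⇒ γ′ → γ′ ≋ ι z ⊗ γ
    Γ-suc {a} {a′} {γ} {γ′} eq a⇒γ a′⇒γ′ = ⊝≋0⇒≋ (null-const⇒≋0 (null-cong
      expand
      (null-⊕ (null-⊕ (null-⊖ a′⇒γ′) (null-scale (ι z) a⇒γ))
        (null-⊖ (null-⊗ (⇒-eventuallyBounded a′⇒γ′) (null-1/n (z + 1ℚ)))))))
      where
      open SetoidReasoning setoid
      open ≋-Solver
      expand : ∀ n → ⊖ (a′ n ⊝ γ′) ⊕ ι z ⊗ (a n ⊝ γ) ⊝ a′ n ⊗ ι ((z + 1ℚ) * (+ 1 / suc n)) ≋ γ′ ⊝ ι z ⊗ γ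
      expand n = begin
        ⊖ (a′ n ⊝ γ′) ⊕ ι z ⊗ (a n ⊝ γ) ⊝ a′ n ⊗ c
          ≈⟨ solve 6 (λ a′ γ′ z a γ c → :- (a′ :- γ′) :+ z :* (a :- γ) :- a′ :* c :=
               γ′ :- z :* γ :+ (z :* a :- (a′ :+ a′ :* c))) ≋-refl (a′ n) γ′ (ι z) (a n) γ c ⟩
        γ′ ⊝ ι z ⊗ γ ⊕ (ι z ⊗ a n ⊝ (a′ n ⊕ a′ n ⊗ c))
          ≈⟨ ⊕-congˡ (⊝-cong ≋-refl (eq n)) ⟩
        γ′ ⊝ ι z ⊗ γ ⊕ (ι z ⊗ a n ⊝ ι z ⊗ a n)
          ≈⟨ solve 2 (λ x y → x :+ (y :- y) := x) ≋-refl (γ′ ⊝ ι z ⊗ γ) (ι z ⊗ a n) ⟩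
        γ′ ⊝ ι z ⊗ γ
          ∎
        where c = ι ((z + 1ℚ) * (+ 1 / suc n))

  -- Insert `1 = g′ γ′ = g′ z γ` after `g` and cancel `g γ = 1`.
  reciprocal-suc : ∀ {z g g′ γ γ′} → g ⊗ γ ≋ ι 1ℚ → g′ ⊗ γ′ ≋ ι 1ℚ → γ′ ≋ ι z ⊗ γ → g ≋ ι z ⊗ g′
  reciprocal-suc {z} {g} {g′} {γ} {γ′} gγ≋1 g′γ′≋1 γ′≋zγ = begin
    g                           ≈⟨ solve 1 (λ g → g := g :* con 1ℚ) ≋-refl g ⟩
    g ⊗ ι 1ℚ                    ≈⟨ ⊗-congˡ (≋-trans (⊗-congˡ (≋-sym γ′≋zγ)) g′γ′≋1) ⟨
    g ⊗ (g′ ⊗ (ι z ⊗ γ))        ≈⟨ solve 4 (λ g g′ z γ → g :* (g′ :* (z :* γ)) := z :* g′ :* (g :* γ)) ≋-refl g g′ (ι z) γ ⟩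
    ι z ⊗ g′ ⊗ (g ⊗ γ)          ≈⟨ ⊗-congˡ gγ≋1 ⟩
    ι z ⊗ g′ ⊗ ι 1ℚ             ≈⟨ solve 1 (λ x → x :* con 1ℚ := x) ≋-refl (ι z ⊗ g′) ⟩
    ι z ⊗ g′                    ∎
    where
    open SetoidReasoning setoid
    open ≋-Solver

module BesselQuotient (A : NormedRing) where
  open NormedRing A
  open NullSequences A
  open Series A
  open Exponential A
  open BesselRecurrence A

  bessel : Carrier → (ℕ → Carrier) → Carrier → ℕ → Carrier
  bessel r g p k = (ι ((-[1]^ k) * recip! k) ⊗ g k) ⊗ (pow (ι ½ ⊗ r) (2 ℕ.* k) ⊗ p)

  pow-2* : ∀ {u x} → u ⊗ u ≋ ι x → ∀ k → pow u (2 ℕ.* k) ≋ ι (x ^ℚ k)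
  pow-2* {u} {x} u²≋x zero    = ≋-refl
  pow-2* {u} {x} u²≋x (suc k) = begin
    u ⊗ pow u (k ℕ.+ suc (k ℕ.+ 0))      ≡⟨ cong (λ j → u ⊗ pow u j) (ℕ.+-suc k (k ℕ.+ 0)) ⟩
    u ⊗ (u ⊗ pow u (2 ℕ.* k))            ≈⟨ solve 2 (λ u p → u :* (u :* p) := u :* u :* p) ≋-refl u (pow u (2 ℕ.* k)) ⟩
    u ⊗ u ⊗ pow u (2 ℕ.* k)              ≈⟨ ⊗-cong u²≋x (pow-2* u²≋x k) ⟩
    ι x ⊗ ι (x ^ℚ k)                     ≈⟨ ι-* x (x ^ℚ k) ⟨
    ι (x ^ℚ suc k)                       ∎
    where
    open SetoidReasoning setoid
    open ≋-Solver

  bessel-coefficient : ∀ {s r x} g p → (ι ½ ⊗ r) ⊗ (ι ½ ⊗ r) ≋ ι x → ∀ k →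
                       bessel r g p k ≋ ι (coefficient s (- x) k) ⊗ (g k ⊗ p)
  bessel-coefficient {s} {r} {x} g p u²≋x k = begin
    (ι (σ * recip! k) ⊗ g k) ⊗ (pow (ι ½ ⊗ r) (2 ℕ.* k) ⊗ p)
      ≈⟨ ⊗-congˡ (⊗-congʳ (pow-2* u²≋x k)) ⟩
    (ι (σ * recip! k) ⊗ g k) ⊗ (ι (x ^ℚ k) ⊗ p)
      ≈⟨ solve 4 (λ a g b p → a :* g :* (b :* p) := a :* b :* (g :* p)) ≋-refl (ι (σ * recip! k)) (g k) (ι (x ^ℚ k)) p ⟩
    ι (σ * recip! k) ⊗ ι (x ^ℚ k) ⊗ (g k ⊗ p)
      ≈⟨ ⊗-congʳ (≋-trans (≋-sym (ι-* (σ * recip! k) (x ^ℚ k))) (ι-cong (neg-^ℚ-recip! x k))) ⟩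
    ι (coefficient s (- x) k) ⊗ (g k ⊗ p)
      ∎
    where
    open SetoidReasoning setoid
    open ≋-Solver
    σ = -[1]^ k

  module _
    {s ρ τ : ℚ} {r p p′ J J′ : Carrier} {g h : ℕ → Carrier}
    (r²≋ρ : r ⊗ r ≋ ι ρ) (ρ≢0 : ρ ≢ 0ℚ)
    (g-rec : ∀ k → g k ≋ ι (s + ℕ→ℚ k + 1ℚ) ⊗ g (suc k)) (h≋g : ∀ k → h k ≋ g (suc k))
    (p′≋ : p′ ≋ p ⊗ (ι ½ ⊗ r))
    (J-sum : (λ n → sum n (bessel r g p)) ⇒ J) (J′-sum : (λ n → sum n (bessel r h p′)) ⇒ J′)
    (quotient : ι τ ⊗ J ≋ r ⊗ J′)
    where

    private
      x : ℚ
      x = ½ * ½ * ρ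

      x≢0 : x ≢ 0ℚ
      x≢0 = p*q≢0 {½ * ½} (λ ()) ρ≢0

      u : Carrier
      u = ι ½ ⊗ r

      u²≋x : u ⊗ u ≋ ι x
      u²≋x = begin
        ι ½ ⊗ r ⊗ (ι ½ ⊗ r)      ≈⟨ solve 1 (λ r → con ½ :* r :* (con ½ :* r) := con (½ * ½) :* (r :* r)) ≋-refl r ⟩
        ι (½ * ½) ⊗ (r ⊗ r)      ≈⟨ ⊗-congˡ r²≋ρ ⟩
        ι (½ * ½) ⊗ ι ρ          ≈⟨ ι-* (½ * ½) ρ ⟨
        ι x                      ∎
        where
        open SetoidReasoning setoid
        open ≋-Solver

      -- The power `p = (r/2)^s` is absorbed into the sequence, so the limit of `S 0` is `J` itself.
      G : ℕ → Carrier
      G k = g k ⊗ p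

      G-rec : ∀ k → G k ≋ ι (s + ℕ→ℚ k + 1ℚ) ⊗ G (suc k)
      G-rec k = ≋-trans (⊗-congʳ (g-rec k))
        (solve 3 (λ d g p → d :* g :* p := d :* (g :* p)) ≋-refl (ι (s + ℕ→ℚ k + 1ℚ)) (g (suc k)) p)
        where open ≋-Solver

      S₀⇒ : S s (- x) G G-rec 0 ⇒ J
      S₀⇒ = null-cong (λ n → ⊝-cong (sum-cong (bessel-coefficient {s} g p u²≋x) n) ≋-refl) J-sum

      bessel-h : ∀ k → bessel r h p′ k ≋ u ⊗ term s (- x) G G-rec 1 k
      bessel-h k = begin
        bessel r h p′ k                  ≈⟨ bessel-coefficient {s} h p′ u²≋x k ⟩
        ι c ⊗ (h k ⊗ p′)                 ≈⟨ ⊗-congˡ (⊗-cong (h≋g k) p′≋) ⟩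
        ι c ⊗ (g (suc k) ⊗ (p ⊗ u))      ≈⟨ solve 4 (λ c g p u → c :* (g :* (p :* u)) := u :* (c :* (g :* p))) ≋-refl (ι c) (g (suc k)) p u ⟩
        u ⊗ (ι c ⊗ (g (suc k) ⊗ p))      ∎
        where
        open SetoidReasoning setoid
        open ≋-Solver
        c = coefficient s (- x) k

      x⁻¹ : ℚ
      x⁻¹ = proj₁ (inverse x≢0)

      x⁻¹uu≋1 : ι x⁻¹ ⊗ (u ⊗ u) ≋ ι 1ℚ
      x⁻¹uu≋1 = ≋-trans (⊗-congˡ u²≋x) (≋-trans (≋-sym (ι-* x⁻¹ x)) (ι-cong (trans (ℚ.*-comm x⁻¹ x) (proj₂ (inverse x≢0)))))

      -- Termwise, the series of `J′` is `u` times that of `S 1`. Hence `τ J = r J′` becomes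
      -- `2u² = 2x` times the limit of `S 1`, which is therefore `τ/(2x)` times `J`.
      κ : ℚ
      κ = x⁻¹ * (½ * τ)

      κJ : ι x⁻¹ ⊗ u ⊗ J′ ≋ ι κ ⊗ J
      κJ = begin
        ι x⁻¹ ⊗ (ι ½ ⊗ r) ⊗ J′           ≈⟨ solve 4 (λ a b r J → a :* (b :* r) :* J := a :* (b :* (r :* J))) ≋-refl (ι x⁻¹) (ι ½) r J′ ⟩
        ι x⁻¹ ⊗ (ι ½ ⊗ (r ⊗ J′))         ≈⟨ ⊗-congˡ (⊗-congˡ quotient) ⟨
        ι x⁻¹ ⊗ (ι ½ ⊗ (ι τ ⊗ J))        ≈⟨ solve 4 (λ a b t J → a :* (b :* (t :* J)) := a :* (b :* t) :* J) ≋-refl (ι x⁻¹) (ι ½) (ι τ) J ⟩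
        ι x⁻¹ ⊗ (ι ½ ⊗ ι τ) ⊗ J          ≈⟨ ⊗-congʳ (≋-trans (ι-* x⁻¹ (½ * τ)) (⊗-congˡ (ι-* ½ τ))) ⟨
        ι κ ⊗ J                          ∎
        where
        open SetoidReasoning setoid
        open ≋-Solver

      -- Multiplication by `x⁻¹ u` undoes the factor `u`, because `u² = x`; it also carries `J′` to
      -- `κ J`.
      S₁⇒ : S s (- x) G G-rec 1 ⇒ ι κ ⊗ J
      S₁⇒ = null-cong eq (null-scale (ι x⁻¹ ⊗ u) J′-sum)
        where
        open SetoidReasoning setoid
        open ≋-Solver
        eq : ∀ n → ι x⁻¹ ⊗ u ⊗ (sum n (bessel r h p′) ⊝ J′) ≋ S s (- x) G G-rec 1 n ⊝ ι κ ⊗ J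
        eq n = begin
          ι x⁻¹ ⊗ u ⊗ (sum n (bessel r h p′) ⊝ J′)
            ≈⟨ ⊗-congˡ (⊝-cong (≋-trans (sum-cong bessel-h n) (sum-scale u (term s (- x) G G-rec 1) n)) ≋-refl) ⟩
          ι x⁻¹ ⊗ u ⊗ (u ⊗ S₁ ⊝ J′)
            ≈⟨ solve 4 (λ a u S J → a :* u :* (u :* S :- J) := a :* (u :* u) :* S :- a :* u :* J) ≋-refl (ι x⁻¹) u S₁ J′ ⟩
          ι x⁻¹ ⊗ (u ⊗ u) ⊗ S₁ ⊝ ι x⁻¹ ⊗ u ⊗ J′
            ≈⟨ ⊝-cong (≋-trans (⊗-congʳ x⁻¹uu≋1) (solve 1 (λ S → con 1ℚ :* S := S) ≋-refl S₁)) κJ ⟩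
          S₁ ⊝ ι κ ⊗ J
            ∎
          where S₁ = S s (- x) G G-rec 1 n

      -x≢0 : - x ≢ 0ℚ
      -x≢0 -x≡0 = x≢0 (ℚ.neg-injective -x≡0)

    rational-quotient⇒≋0 : J ≋ ι 0ℚ
    rational-quotient⇒≋0 = bessel-irrational s (- x) G G-rec {κ = κ} -x≢0 S₀⇒ S₁⇒

-- Transfer to the definitions of the statement

open NullSequences ℂ-normedRing using (_⇒_; null-cong)
open Series ℂ-normedRing using (sum)
open Exponential ℂ-normedRing using (pow; IsExponential; exponential-suc)
open GammaFunctionalEquation ℂ-normedRing using (approximant-suc; Γ-suc; reciprocal-suc)
open BesselQuotient ℂ-normedRing using (bessel; rational-quotient⇒≋0)

abstract

  sum<≈sum : ∀ {f g} → (∀ k → f k ≈ g k) → ∀ n → sum< n f ≈ sum n g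
  sum<≈sum f≈g zero    = ≈-refl
  sum<≈sum f≈g (suc n) = +ᶜ-cong (sum<≈sum f≈g n) (f≈g n)

  ^≈pow : ∀ z n → z ^ n ≈ pow z n
  ^≈pow z zero    = ≈-refl
  ^≈pow z (suc n) = *ᶜ-cong (≈-refl {z}) (^≈pow z n)

  ⟶⇒⇒ : ∀ {z w} → z ⟶ w → z ⇒ w
  ⟶⇒⇒ {z} {w} (mk⟶ᴿ re⟶ , mk⟶ᴿ im⟶) ε 0<ε =
    let M , re≤ = re⟶ (½ * ε) (0<* 0<½ 0<ε)
        N , im≤ = im⟶ (½ * ε) (0<* 0<½ 0<ε)
    in M ℕ.⊔ N , λ n MN≤n → bdᶜ λ η 0<η →
      let K , re< = _≤ᴿ_.below (re≤ n (ℕ.m⊔n≤o⇒m≤o M N MN≤n)) (½ * η) (0<* 0<½ 0<η)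
          L , im< = _≤ᴿ_.below (im≤ n (ℕ.m⊔n≤o⇒n≤o M N MN≤n)) (½ * η) (0<* 0<½ 0<η)
      in K ℕ.⊔ L , λ k KL≤k → subst (norm (z n -ᶜ w) k <_)
           (solve 2 (λ ε η → con ½ :* ε :+ con ½ :* η :+ (con ½ :* ε :+ con ½ :* η) := ε :+ η) refl ε η)
           (ℚ.+-mono-< (re< k (ℕ.m⊔n≤o⇒m≤o K L KL≤k)) (im< k (ℕ.m⊔n≤o⇒n≤o K L KL≤k)))
    where open +-*-Solver

  HasSum⇒ : ∀ {f g w} → (∀ k → f k ≈ g k) → HasSum f w → (λ n → sum n g) ⇒ w
  HasSum⇒ {w = w} f≈g f⟶w = null-cong (λ n → +ᶜ-cong (sum<≈sum f≈g n) (≈-refl { -ᶜ w})) (⟶⇒⇒ f⟶w)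

  IsExp⇒ : ∀ {z w} → IsExp z w → IsExponential z w
  IsExp⇒ {z} = HasSum⇒ (λ k → *ᶜ-cong (≈-refl {ℚ→ℂ (recip! k)}) (^≈pow z k))

-- Uniqueness of the real logarithm and the functional equation of 1/Γ

EventuallyAtLeast : ℚ → ℝ → Set
EventuallyAtLeast c x = ∃[ N ] ∀ n → N ℕ.≤ n → c ≤ seq x n

abstract

  -- One rational comparison decides, at an index after which the sequence moves by less than `ε/2`:
  -- a value of at most `ε/2` bounds the tail by `ε`, and a larger one would keep the tail above a
  -- positive constant.
  eventually-≤ : ∀ x → (∀ c → 0ℚ < c → ¬ EventuallyAtLeast c x) →
                 ∀ ε → 0ℚ < ε → ∃[ N ] ∀ n → N ℕ.≤ n → seq x n ≤ ε
  eventually-≤ x x≱ ε 0<ε with cauchy x (½ * ε) (0<* 0<½ 0<ε)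
  ... | N , near with seq x N ℚ.≤? ½ * ε
  ...   | yes q≤½ε = N , λ n N≤n → begin
    seq x n                                ≡⟨ solve 2 (λ a b → a := a :- b :+ b) refl (seq x n) (seq x N) ⟩
    (seq x n - seq x N) + seq x N          ≤⟨ ℚ.+-mono-≤ (ℚ.≤-trans (p≤∣p∣ (seq x n - seq x N)) (ℚ.<⇒≤ (near n N N≤n ℕ.≤-refl))) q≤½ε ⟩
    ½ * ε + ½ * ε                          ≡⟨ ½*p+½*p≡p ε ⟩
    ε                                      ∎
    where
    open ℚ.≤-Reasoning
    open +-*-Solver
  ...   | no q≰½ε = ⊥-elim (x≱ (seq x N - ½ * ε)
      (subst (_< seq x N - ½ * ε) (ℚ.+-inverseʳ (½ * ε)) (ℚ.+-monoˡ-< (- (½ * ε)) (ℚ.≰⇒> q≰½ε)))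
      (N , λ n N≤n → begin
        seq x N - ½ * ε                          ≡⟨ solve 3 (λ a b e → a :- e := b :+ ((a :- b) :- e)) refl (seq x N) (seq x n) (½ * ε) ⟩
        seq x n + (seq x N - seq x n - ½ * ε)    ≤⟨ ℚ.+-monoʳ-≤ (seq x n) (ℚ.+-monoˡ-≤ (- (½ * ε))
                                                      (ℚ.≤-trans (p≤∣p∣ (seq x N - seq x n)) (ℚ.<⇒≤ (near N n ℕ.≤-refl N≤n)))) ⟩
        seq x n + (½ * ε - ½ * ε)                ≡⟨ solve 2 (λ b e → b :+ (e :- e) := b) refl (seq x n) (½ * ε) ⟩
        seq x n                                  ∎))
    where
    open ℚ.≤-Reasoning
    open +-*-Solver

  ¬apart⇒≈ : ∀ x y → (∀ c → 0ℚ < c → ¬ EventuallyAtLeast c (x -ᴿ y)) →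
             (∀ c → 0ℚ < c → ¬ EventuallyAtLeast c (y -ᴿ x)) → ℝ→ℂ x ≈ ℝ→ℂ y
  ¬apart⇒≈ x y x-y≱ y-x≱ = mk≈ᴿ close , mk≈ᴿ (λ ε 0<ε → 0 , λ _ _ → 0<ε)
    where
    open +-*-Solver
    ∣∣≤ : ∀ {p q} → p ≤ q → - p ≤ q → ∣ p ∣ ≤ q
    ∣∣≤ {p} {q} p≤q -p≤q with ℚ.∣p∣≡p∨∣p∣≡-p p
    ... | inj₁ eq = subst (_≤ q) (sym eq) p≤q
    ... | inj₂ eq = subst (_≤ q) (sym eq) -p≤q
    close : ∀ ε → 0ℚ < ε → ∃[ N ] ∀ n → N ℕ.≤ n → ∣ seq x n - seq y n ∣ < ε
    close ε 0<ε =
      let M , x-y≤ = eventually-≤ (x -ᴿ y) x-y≱ (½ * ε) (0<* 0<½ 0<ε)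
          N , y-x≤ = eventually-≤ (y -ᴿ x) y-x≱ (½ * ε) (0<* 0<½ 0<ε)
          ½ε<ε = subst₂ _<_ (ℚ.+-identityʳ (½ * ε)) (½*p+½*p≡p ε) (ℚ.+-monoʳ-< (½ * ε) (0<* 0<½ 0<ε))
      in M ℕ.⊔ N , λ n MN≤n → ℚ.≤-<-trans (∣∣≤ (x-y≤ n (ℕ.m⊔n≤o⇒m≤o M N MN≤n))
           (subst (_≤ ½ * ε) (solve 2 (λ a b → b :- a := :- (a :- b)) refl (seq x n) (seq y n))
             (y-x≤ n (ℕ.m⊔n≤o⇒n≤o M N MN≤n)))) ½ε<ε

  eventually⇒NonNegᶜ : ∀ {c} x y → EventuallyAtLeast c (x -ᴿ y) → NonNegᶜ ((ℝ→ℂ x -ᶜ ℝ→ℂ y) -ᶜ ℚ→ℂ c)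
  eventually⇒NonNegᶜ {c} x y (N , c≤) = nonNegᶜ {representative = ∣ d ∣ᴿ}
    (mk≈ᴿ (λ ε 0<ε → N , λ n N≤n → subst (_< ε) (cong ∣_∣ (sym (eq n N≤n))) 0<ε) , mk≈ᴿ (λ ε 0<ε → 0 , λ _ _ → 0<ε))
    (λ n → ℚ.0≤∣p∣ (seq d n))
    where
    d : ℝ
    d = (x -ᴿ y) -ᴿ ℚ→ℝ c
    eq : ∀ n → N ℕ.≤ n → seq d n - ∣ seq d n ∣ ≡ 0ℚ
    eq n N≤n = trans (cong (λ a → seq d n - a) (ℚ.0≤p⇒∣p∣≡p
        (subst (_≤ seq d n) (ℚ.+-inverseʳ c) (ℚ.+-monoˡ-≤ (- c) (c≤ n N≤n)))))
      (ℚ.+-inverseʳ (seq d n))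

  log-unique : ∀ {q} x y → 1ℚ ≤ q → IsLog (ℚ→ℂ q) (ℝ→ℂ x) → IsLog (ℚ→ℂ q) (ℝ→ℂ y) → ℝ→ℂ x ≈ ℝ→ℂ y
  log-unique x y 1≤q log-x log-y = ¬apart⇒≈ x y
    (λ c 0<c c≤ → exponential-injective 1≤q (IsExp⇒ log-y) (IsExp⇒ log-x) 0<c (eventually⇒NonNegᶜ x y c≤))
    (λ c 0<c c≤ → exponential-injective 1≤q (IsExp⇒ log-x) (IsExp⇒ log-y) 0<c (eventually⇒NonNegᶜ y x c≤))
    where open OrderedExponential ℂ-normedRing ℂ-cone using (exponential-injective)

  ℕPower-suc : ∀ {z p p′} n → IsℕPower (suc n) z p → IsℕPower (suc n) (z + 1ℚ) p′ → p′ ≈ ℚ→ℂ (ℕ→ℚ (suc n)) *ᶜ p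
  ℕPower-suc {z} {p} n (x , log-x , power) (y , log-y , power′) = ≈-trans
    (exponential-suc {z} (log-unique x y (1≤ℕ→ℚ-suc n) log-x log-y) (IsExp⇒ power) (IsExp⇒ log-y) (IsExp⇒ power′))
    (*ᶜ-comm p (ℚ→ℂ (ℕ→ℚ (suc n))))

  IsΓ-suc : ∀ {z γ γ′} → ¬ IsNonPositiveInteger z → IsΓ z γ → IsΓ (z + 1ℚ) γ′ → γ′ ≈ ℚ→ℂ z *ᶜ γ
  IsΓ-suc {z} {γ} {γ′} z∉ (a , approximant , a⟶γ) (a′ , approximant′ , a′⟶γ′) = Γ-suc z∉ {a} {a′} {γ} {γ′}
    (λ n → let p , power , quotient = approximant n
               p′ , power′ , quotient′ = approximant′ n
           in approximant-suc z∉ n {a n} {a′ n} {p} {p′} quotient quotient′ (ℕPower-suc n power power′))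
    (⟶⇒⇒ a⟶γ) (⟶⇒⇒ a′⟶γ′)

  -- Poles of Γ at `z` and `z + 1` occur together except at `z = 0`, where the factor `z` accounts
  -- for the zero of `1/Γ`. Away from the poles this is the functional equation of Γ.
  Is1/Γ-suc : ∀ {z g g′} → Is1/Γ z g → Is1/Γ (z + 1ℚ) g′ → g ≈ ℚ→ℂ z *ᶜ g′
  Is1/Γ-suc {z} {g} {g′} (inj₁ (_ , g≈0)) (inj₁ (_ , g′≈0)) = ≈-trans g≈0 (≈-trans
    (≐⇒≈ ((λ _ → solve 1 (λ z → con 0ℚ := z :* con 0ℚ :- con 0ℚ :* con 0ℚ) refl z) ,
          (λ _ → solve 1 (λ z → con 0ℚ := z :* con 0ℚ :+ con 0ℚ :* con 0ℚ) refl z)))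
    (*ᶜ-cong (≈-refl {ℚ→ℂ z}) (≈-sym g′≈0)))
    where open +-*-Solver
  Is1/Γ-suc {g = g} {g′} (inj₁ ((zero , refl) , g≈0)) (inj₂ _) = ≈-trans g≈0
    (≐⇒≈ ((λ n → solve 2 (λ a b → con 0ℚ := con 0ℚ :* a :- con 0ℚ :* b) refl (seq (re g′) n) (seq (im g′) n)) ,
          (λ n → solve 2 (λ a b → con 0ℚ := con 0ℚ :* b :+ con 0ℚ :* a) refl (seq (re g′) n) (seq (im g′) n))))
    where open +-*-Solver
  Is1/Γ-suc (inj₁ ((suc m , refl) , _)) (inj₂ (z+1∉ , _)) = ⊥-elim (z+1∉ (m ,
    trans (cong (λ x → - x + 1ℚ) (ℕ→ℚ-suc m)) (solve 1 (λ m → :- (m :+ con 1ℚ) :+ con 1ℚ := :- m) refl (ℕ→ℚ m))))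
    where open +-*-Solver
  Is1/Γ-suc {z} (inj₂ (z∉ , _)) (inj₁ ((m , z+1≡-m) , _)) = ⊥-elim (z∉ (suc m ,
    trans (solve 1 (λ z → z := z :+ con 1ℚ :- con 1ℚ) refl z)
      (trans (cong (_- 1ℚ) z+1≡-m)
        (trans (solve 1 (λ m → :- m :- con 1ℚ := :- (m :+ con 1ℚ)) refl (ℕ→ℚ m)) (cong -_ (sym (ℕ→ℚ-suc m)))))))
    where open +-*-Solver
  Is1/Γ-suc {z} {g} {g′} (inj₂ (z∉ , γ , isΓ , gγ≈1)) (inj₂ (_ , γ′ , isΓ′ , g′γ′≈1)) =
    reciprocal-suc {z} {g} {g′} {γ} {γ′} gγ≈1 g′γ′≈1 (IsΓ-suc z∉ isΓ isΓ′)

  besselTerm≈bessel : ∀ r g p k → besselTerm r g p k ≈ bessel r g p k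
  besselTerm≈bessel r g p k = *ᶜ-cong (≈-refl {ℚ→ℂ ((-[1]^ k) * recip! k) *ᶜ g k})
    (*ᶜ-cong (^≈pow (r /2) (2 ℕ.* k)) (≈-refl {p}))

theorem2 : ∀ (s : ℚ) (r : ℂ) → IsRational (r *ᶜ r) → ¬ (r *ᶜ r ≈ 0ℂ) →
    ∀ (ℓ : ℂ) → IsLog (r /2) ℓ →
    ∀ (Jₛ Jₛ₊₁ : ℂ) → IsBesselJ ℓ s r Jₛ → IsBesselJ ℓ (s + 1ℚ) r Jₛ₊₁ →
    ¬ (Jₛ ≈ 0ℂ) →
    ∀ (t : ℂ) → IsQuotient (r *ᶜ Jₛ₊₁) Jₛ t → ¬ IsRational t
theorem2 s r (ρ , r²≈ρ) r²≉0 ℓ log J J′ (g , p , 1/Γ-g , power , J-sum) (h , p′ , 1/Γ-h , power′ , J′-sum)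
         J≉0 t tJ≈rJ′ (τ , t≈τ) =
  J≉0 (rational-quotient⇒≋0 {s} {ρ} {τ} {r} {p} {p′} {J} {J′} {g} {h} r²≈ρ ρ≢0 g-rec h≈g
    -- `(r/2)^(s+1) = (r/2)^s · r/2`, since both orders use the same logarithm `ℓ` of `r/2`.
    (exponential-suc {s} (≈-refl {ℓ}) (IsExp⇒ power) (IsExp⇒ log) (IsExp⇒ power′))
    (HasSum⇒ (besselTerm≈bessel r g p) J-sum) (HasSum⇒ (besselTerm≈bessel r h p′) J′-sum)
    (≈-trans (*ᶜ-cong (≈-sym t≈τ) (≈-refl {J})) tJ≈rJ′))
  where
  open +-*-Solver
  ρ≢0 : ρ ≢ 0ℚ
  ρ≢0 refl = r²≉0 r²≈ρ
  g-rec : ∀ k → g k ≈ ℚ→ℂ (s + ℕ→ℚ k + 1ℚ) *ᶜ g (suc k)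
  g-rec k = Is1/Γ-suc (1/Γ-g k) (subst (λ z → Is1/Γ z (g (suc k)))
    (trans (cong (λ m → s + m + 1ℚ) (ℕ→ℚ-suc k)) (solve 2 (λ s k → s :+ (k :+ con 1ℚ) :+ con 1ℚ := s :+ k :+ con 1ℚ :+ con 1ℚ) refl s (ℕ→ℚ k)))
    (1/Γ-g (suc k)))
  -- Both h k and g (suc k) are (s + k + 2) · h (suc k).
  h≈g : ∀ k → h k ≈ g (suc k)
  h≈g k = ≈-trans (Is1/Γ-suc (1/Γ-h k) h′) (≈-sym (Is1/Γ-suc
    (subst (λ z → Is1/Γ z (g (suc k)))
      (trans (cong (λ m → s + m + 1ℚ) (ℕ→ℚ-suc k)) (solve 2 (λ s k → s :+ (k :+ con 1ℚ) :+ con 1ℚ := s :+ con 1ℚ :+ k :+ con 1ℚ) refl s (ℕ→ℚ k)))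
      (1/Γ-g (suc k))) h′))
    where
    h′ : Is1/Γ (s + 1ℚ + ℕ→ℚ k + 1ℚ + 1ℚ) (h (suc k))
    h′ = subst (λ z → Is1/Γ z (h (suc k)))
      (trans (cong (λ m → s + 1ℚ + m + 1ℚ) (ℕ→ℚ-suc k)) (solve 2 (λ s k → s :+ (k :+ con 1ℚ) :+ con 1ℚ := s :+ k :+ con 1ℚ :+ con 1ℚ) refl (s + 1ℚ) (ℕ→ℚ k)))
      (1/Γ-h (suc k))
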